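{- For every integer $\gamma\ge 2$, there exists an algorithm for the minimum spanning tree problem under explorable uncertainty with predictions that is $\left(1+\frac{1}{\gamma}\right)$-consistent and $\gamma$-robust.
   Context: Minimum spanning tree (MST) problem under explorable uncertainty with predictions: an instance is a connected (multi)graph $G=(V,E)$. Each edge $e$ has an unknown true weight $w_e\in\mathbb{R}_+$ and a known uncertainty interval $I_e$, which is either an open interval $(L_e,U_e)$ containing $w_e$ (edge $e$ is non-trivial) or the trivial interval $\{w_e\}$ (then $L_e=U_e=w_e$). Querying an edge reveals $w_e$. A set $Q\subseteq E$ is a feasible query set if there is a spanning tree $T$ that is a minimum spanning tree for every weight assignment that equals $w_e$ for $e\in Q$ and takes arbitrary values in $I_e$ for $e\notin Q$. $\mathrm{OPT}$ denotes a feasible query set of minimum cardinality. An algorithm queries edges adaptively (each choice may depend on previously revealed values; true values may be chosen adversarially) until its set $\mathrm{ALG}$ of queried edges is feasible. In addition, for every edge $e$ the algorithm is given a (possibly wrong) prediction $\hat w_e\in I_e$. An algorithm is $\rho$-competitive if $|\mathrm{ALG}|\le\rho\,|\mathrm{OPT}|$ on every instance; it is $\alpha$-consistent if it is $\alpha$-competitive on all instances in which $\hat w_e=w_e$ for all $e$, and $\beta$-robust if it is $\beta$-competitive on all instances regardless of the predictions.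
   Formalization: The true edge weights, the endpoints of the uncertainty intervals and the predictions are rational numbers instead of real numbers. -}

module Defs where

open import Data.Nat as ℕ using (ℕ; zero; suc; _*_)
open import Data.Fin using (Fin; zero; suc)
open import Data.Fin.Subset using (Subset; _∈_; _∉_; ∣_∣; ⁅_⁆; _∪_; ⊥)
open import Data.Rational using (ℚ; 0ℚ; _+_; _≤_; _<_)
open import Data.Bool using (Bool; true; false; if_then_else_)
open import Data.Product using (Σ; ∃; _×_; _,_)
open import Data.Sum using (_⊎_)
open import Data.List using (List; []; _∷_; _++_; [_]; foldr)
open import Data.Maybe using (Maybe; just; nothing)
open import Data.Vec using (Vec; []; _∷_)
open import Function using (_∘_)
open import Relation.Nullary using (¬_)
open import Relation.Binary.PropositionalEquality using (_≡_)

-- Public part of an instance: the multigraph (vertices Fin n, edges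
-- Fin m, each edge e joins src e and tgt e; parallel edges allowed),
-- the uncertainty intervals and the predictions.  Edge e is trivial
-- iff triv e ≡ true, in which case I_e = {L e} (and L e = U e);
-- otherwise I_e is the open interval (L e , U e).

record Instance : Set where
  field
    n m   : ℕ
    src   : Fin m → Fin n
    tgt   : Fin m → Fin n
    triv  : Fin m → Bool
    L     : Fin m → ℚ
    U     : Fin m → ℚ
    pred  : Fin m → ℚ

open Instance public

InI : (P : Instance) → Fin (m P) → ℚ → Set
InI P e v with triv P e
... | true  = v ≡ L P e
... | false = (L P e < v) × (v < U P e)

WellFormedIntervals : Instance → Set
WellFormedIntervals P = ∀ e → (triv P e ≡ true → L P e ≡ U P e)
                            × (triv P e ≡ false → L P e < U P e)

data Reach (P : Instance) (S : Subset (m P)) : Fin (n P) → Fin (n P) → Set where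
  here : ∀ v → Reach P S v v
  step : ∀ {u v x} (e : Fin (m P)) → e ∈ S →
         ((src P e ≡ u × tgt P e ≡ v) ⊎ (tgt P e ≡ u × src P e ≡ v)) →
         Reach P S v x → Reach P S u x

allEdges : ∀ k → Subset k
allEdges zero = []
allEdges (suc k) = true ∷ allEdges k

Connected : Instance → Set
Connected P = ∀ u v → Reach P (allEdges (m P)) u v

Loopless : Instance → Set
Loopless P = ∀ e → ¬ (src P e ≡ tgt P e)

SpanningTree : (P : Instance) → Subset (m P) → Set
SpanningTree P T = (∀ u v → Reach P T u v) × (suc ∣ T ∣ ≡ n P)

wsum : ∀ {k} → (Fin k → ℚ) → Subset k → ℚ
wsum {zero}  w []      = 0ℚ
wsum {suc k} w (b ∷ s) = (if b then w zero else 0ℚ) + wsum (w ∘ suc) s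

IsMST : (P : Instance) → (Fin (m P) → ℚ) → Subset (m P) → Set
IsMST P w T = SpanningTree P T × (∀ T′ → SpanningTree P T′ → wsum w T ≤ wsum w T′)

Feasible : (P : Instance) → (Fin (m P) → ℚ) → Subset (m P) → Set
Feasible P w Q =
  Σ (Subset (m P)) λ T → SpanningTree P T ×
    (∀ (w′ : Fin (m P) → ℚ) →
       (∀ e → e ∈ Q → w′ e ≡ w e) →
       (∀ e → e ∉ Q → InI P e (w′ e)) →
       IsMST P w′ T)

IsOPT : (P : Instance) → (Fin (m P) → ℚ) → Subset (m P) → Set
IsOPT P w Q = Feasible P w Q × (∀ Q′ → Feasible P w Q′ → ∣ Q ∣ ℕ.≤ ∣ Q′ ∣)

Valid : (P : Instance) → (Fin (m P) → ℚ) → Set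
Valid P w = WellFormedIntervals P × Connected P × Loopless P
          × (∀ e → InI P e (pred P e))
          × (∀ e → 0ℚ ≤ w e) × (∀ e → InI P e (w e))

-- Adaptive algorithms.  A history is the list of (queried edge, revealed
-- value) pairs so far.  A deterministic adaptive algorithm sees the public
-- instance and the history and chooses the next edge to query
-- (nothing = no query this round).  The queried values are the true ones.

History : Instance → Set
History P = List (Fin (m P) × ℚ)

Algorithm : Set
Algorithm = (P : Instance) → History P → Maybe (Fin (m P))

history : Algorithm → (P : Instance) → (Fin (m P) → ℚ) → ℕ → History P
history A P w zero = []
history A P w (suc k) with A P (history A P w k)
... | nothing = history A P w k
... | just e  = history A P w k ++ [ (e , w e) ]

queriedSet : (P : Instance) → History P → Subset (m P)
queriedSet P = foldr (λ { (e , _) S → ⁅ e ⁆ ∪ S }) ⊥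

-- The algorithm queries until its queried set is feasible: it stops at
-- the first round k at which the queried set ALG is feasible.  It is
-- (num/den)-competitive on (P , w) if it stops and den·|ALG| ≤ num·|OPT|.
CompetitiveOn : Algorithm → (P : Instance) → (Fin (m P) → ℚ) → ℕ → ℕ → Set
CompetitiveOn A P w num den =
  ∀ OPT → IsOPT P w OPT →
  ∃ λ k → Feasible P w (queriedSet P (history A P w k))
        × (∀ j → j ℕ.< k → ¬ Feasible P w (queriedSet P (history A P w j)))
        × (den * ∣ queriedSet P (history A P w k) ∣ ℕ.≤ num * ∣ OPT ∣)

{-# OPTIONS --safe #-}
module Submission where

-- Only the symmetric exchange property of spanning trees is used.  Write C for the set of tree
-- edges that a non-tree edge f can replace.  If the tree T that is minimum for the lower limits is
-- not minimum for the upper limits, then some edge is in every feasible query set.  Otherwise either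
-- a prediction inside another interval yields a witness pair {x , y} such that x must be queried if
-- y is predicted correctly, or every query set meeting all pairs e ∈ C, f with overlapping intervals
-- is feasible for the predictions.  In the latter case König's theorem gives a minimum
-- vertex cover of the overlap graph whose members are matched to edges outside it, and these
-- matched pairs are witness sets if queried in a suitable order and correctly predicted so far.
--
-- As long as predictions are correct, the algorithm queries the edges x and charges each of them to
-- its partner y.  Only when y would receive its γ-th charge is y itself queried (first); this is the
-- single possibly wasted query, paid for by γ edges of the optimum.  Hence at most (1 + 1/γ)|OPT|
-- queries if all predictions are correct.  Since y and its at most γ − 1 charged edges contain an
-- edge of the optimum, after the first wrong prediction all charged edges y can be queried at a cost
-- of γ|OPT|, and repeatedly querying witness pairs is 2-competitive on the rest.

open import Defs
open import Algebra.Bundles using (CommutativeMonoid)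
open import Data.Bool using (Bool; true; false; if_then_else_; _∧_; _∨_; not)
import Data.Bool.Properties as 𝔹
open import Data.Empty using () renaming (⊥ to Empty)
open import Data.Fin using (Fin; zero; suc)
open import Data.Fin.Properties using (_≟_; any?; all?)
open import Data.Fin.Subset using (Subset; inside; outside; _∈_; _∉_; _⊆_; ∣_∣; ∁; ⊥; ⁅_⁆; _∪_; Nonempty)
open import Data.Fin.Subset.Properties
  using (_∈?_; ∉⊥; ∣⊥∣≡0; ⊆-antisym; anySubset?; nonempty?; Empty-unique; x∈⁅x⁆; x∈⁅y⁆⇒x≡y;
         p⊆p∪q; q⊆p∪q; x∈p∪q⁻; p⊆q⇒∣p∣≤∣q∣; x∈p⇒x∉∁p; x∉p⇒x∈∁p)
open import Data.List as List
  using (List; []; _∷_; _++_; [_]; length; map; take; foldr; filter; cartesianProduct; allFin)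
open import Data.List.Membership.Propositional using (find) renaming (_∈_ to _∈ₗ_)
open import Data.List.Membership.Propositional.Properties
  using (∈-∃++; ∈-++⁺ˡ; ∈-++⁺ʳ; ∈-++⁻; ∈-map⁻; ∈-filter⁺; ∈-filter⁻; ∈-cartesianProduct⁺; ∈-allFin)
open import Data.List.Properties using (length-++; length-map; length-tabulate; length-take; take-all; filter-all; ++-identityʳ)
open import Data.List.Relation.Binary.Permutation.Propositional using (↭-sym; ↭⇒↭ₛ)
open import Data.List.Relation.Binary.Permutation.Propositional.Properties
  using (All-resp-↭; ∈-resp-↭) renaming (map⁺ to ↭-map⁺)
import Data.List.Relation.Binary.Permutation.Setoid.Properties as ↭ₛ
open import Data.List.Relation.Unary.All as All using (All; []; _∷_)
import Data.List.Relation.Unary.All.Properties as Allₚ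
open import Data.List.Relation.Unary.AllPairs as AllPairs using (AllPairs; []; _∷_)
import Data.List.Relation.Unary.AllPairs.Properties as AllPairsₚ
open import Data.List.Relation.Unary.Any as Any using (here; there)
open import Data.List.Relation.Unary.Sorted.TotalOrder.Properties using (Sorted⇒AllPairs)
open import Data.List.Relation.Unary.Unique.Propositional.Properties using (allFin⁺)
import Data.List.Sort as Sort
open import Data.Maybe using (Maybe; just; nothing)
open import Data.Nat as ℕ using (ℕ; zero; suc; _+_; _*_; _≤_; _<_; z≤n; s≤s)
open import Data.Nat.Induction using (<-wellFounded)
import Data.Nat.Properties as ℕₚ
open import Data.Nat.Tactic.RingSolver using (solve-∀)
open import Data.Product as Product using (Σ; ∃; _×_; _,_; proj₁; proj₂)
open import Data.Rational as ℚ using (ℚ; 0ℚ)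
import Data.Rational.Properties as ℚₚ
open import Data.Sum as Sum using (_⊎_; inj₁; inj₂; [_,_]′)
open import Data.Unit using (⊤; tt)
open import Data.Vec using ([]; _∷_; _[_]≔_; lookup; here; there; tabulate)
open import Data.Vec.Properties
  using ([]≔-updates; []≔-minimal; []=⇒lookup; lookup⇒[]=; lookup∘update; lookup∘update′; lookup∘tabulate)
open import Function using (_∘_; id; flip; case_of_)
open import Induction.WellFounded using (Acc; acc)
open import Relation.Binary.Bundles using (DecTotalOrder)
import Relation.Binary.Construct.On as On
open import Relation.Binary.PropositionalEquality
  using (_≡_; _≢_; refl; sym; trans; cong; cong₂; subst; subst₂; module ≡-Reasoning; setoid)
open import Relation.Nullary using (¬_; Dec; yes; no; contradiction; does; ¬?)
open import Relation.Nullary.Decidable using (_×-dec_; _⊎-dec_; _→-dec_; map′; decidable-stable)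
open import Algebra.Properties.CommutativeSemigroup (CommutativeMonoid.commutativeSemigroup ℚₚ.+-0-commutativeMonoid)
  using (x∙yz≈y∙xz)
open import Algebra.Properties.Semiring.Sum ℕₚ.+-*-semiring using (sum; sum-cong-≗; *-distribˡ-sum)

-- Following the predictions blindly would query only edges x, and with wrong predictions many of
-- them may belong to one y that is the whole optimum. The charge count `k y` balances the two
-- demands. For robustness it is a debt, kept below γ so that one edge of the optimum can pay for
-- it. For consistency it is a saving: a round brings γ + 1 units, a query costs γ, and the unit
-- left over is the charge. With γ - 1 units saved at y the next round can afford y and x, since 2γ
-- = (γ + 1) + (γ - 1). Edge weights are summed over whole trees only in the translation from
-- `Feasible`. Elsewhere a tree is certified pair by pair: the upper limit of e is at most the lower
-- limit of f whenever f can replace e. The delicate point is equality of limits: the arguments need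
-- strict inequalities, and ties yield them only if points and open intervals with the same limit
-- are ordered as well.

private variable ν : ℕ

-- Finite sums and ranks of strict partial orders

sum-mono : (f g : Fin ν → ℕ) → (∀ i → f i ≤ g i) → sum f ≤ sum g
sum-mono {zero}  f g le = z≤n
sum-mono {suc ν} f g le = ℕₚ.+-mono-≤ (le zero) (sum-mono (f ∘ suc) (g ∘ suc) (le ∘ suc))

sum-agree-except : (f g : Fin ν → ℕ) (x : Fin ν) → (∀ i → i ≢ x → f i ≡ g i) →
                   sum f + g x ≡ sum g + f x
sum-agree-except {suc ν} f g zero eq = begin
  f zero + sum (f ∘ suc) + g zero  ≡⟨ ℕₚ.+-comm _ (g zero) ⟩
  g zero + (f zero + sum (f ∘ suc))
    ≡⟨ cong (λ s → g zero + (f zero + s)) (sum-cong-≗ {ν} (λ i → eq (suc i) λ ())) ⟩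
  g zero + (f zero + sum (g ∘ suc))  ≡⟨ cong (g zero +_) (ℕₚ.+-comm (f zero) _) ⟩
  g zero + (sum (g ∘ suc) + f zero)  ≡⟨ sym (ℕₚ.+-assoc (g zero) _ _) ⟩
  g zero + sum (g ∘ suc) + f zero  ∎
  where open ≡-Reasoning
sum-agree-except {suc ν} f g (suc x) eq = begin
  f zero + sum (f ∘ suc) + g (suc x)    ≡⟨ ℕₚ.+-assoc (f zero) _ _ ⟩
  f zero + (sum (f ∘ suc) + g (suc x))
    ≡⟨ cong₂ _+_ (eq zero λ ()) (sum-agree-except (f ∘ suc) (g ∘ suc) x λ i i≢x → eq (suc i) (i≢x ∘ sucinj)) ⟩
  g zero + (sum (g ∘ suc) + f (suc x))  ≡⟨ sym (ℕₚ.+-assoc (g zero) _ _) ⟩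
  g zero + sum (g ∘ suc) + f (suc x)  ∎
  where
  open ≡-Reasoning
  sucinj : ∀ {i j : Fin ν} → suc i ≡ suc j → i ≡ j
  sucinj refl = refl

argmin : {P : Fin ν → Set} → (∀ i → Dec (P i)) → (r : Fin ν → ℕ) → ∀ i → P i →
         ∃ λ j → P j × (∀ k → P k → r j ≤ r k)
argmin {ν} {P} P? r i Pi = go i Pi (<-wellFounded (r i))
  where
  go : ∀ i → P i → Acc _<_ (r i) → ∃ λ j → P j × (∀ k → P k → r j ≤ r k)
  go i Pi (acc rs) with any? (λ k → P? k ×-dec (r k ℕ.<? r i))
  ... | yes (k , Pk , lt) = go k Pk (rs lt)
  ... | no none = i , Pi , λ k Pk → ℕₚ.≮⇒≥ λ lt → none (k , Pk , lt)

-- Counting predecessors yields a natural number that strictly increases along the order. `argmin`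
-- can then select extremal edges and a descent can be measured, although the order is only partial.
module Rank {_≺_ : Fin ν → Fin ν → Set} (_≺?_ : ∀ i j → Dec (i ≺ j))
            (≺-trans : ∀ {i j k} → i ≺ j → j ≺ k → i ≺ k) (≺-irrefl : ∀ {i} → ¬ (i ≺ i)) where

  below : Fin ν → Fin ν → ℕ
  below j i = if does (i ≺? j) then 1 else 0

  rank : Fin ν → ℕ
  rank j = sum (below j)

  below-yes : ∀ {i j} → i ≺ j → below j i ≡ 1
  below-yes {i} {j} p with i ≺? j
  ... | yes _ = refl
  ... | no ¬p = contradiction p ¬p

  below-no : ∀ {i j} → ¬ (i ≺ j) → below j i ≡ 0
  below-no {i} {j} ¬p with i ≺? j
  ... | yes p = contradiction p ¬p
  ... | no _  = refl

  rank-mono : ∀ {i j} → i ≺ j → rank i < rank j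
  rank-mono {i} {j} i≺j = begin-strict
    sum (below i)         <⟨ ℕₚ.n<1+n _ ⟩
    suc (sum (below i))   ≡⟨ ℕₚ.+-comm 1 _ ⟩
    sum (below i) + 1     ≡⟨ cong (sum (below i) +_) (sym g-at) ⟩
    sum (below i) + g i   ≡⟨ sum-agree-except (below i) g i (λ k k≢i → sym (g-off k k≢i)) ⟩
    sum g + below i i     ≡⟨ cong (sum g +_) (below-no ≺-irrefl) ⟩
    sum g + 0             ≡⟨ ℕₚ.+-identityʳ _ ⟩
    sum g                 ≤⟨ sum-mono g (below j) g≤ ⟩
    sum (below j)         ∎
    where
    open ℕₚ.≤-Reasoning
    -- `g` counts the predecessors of `i` and `i` itself, all of which precede `j`.
    g : Fin ν → ℕ
    g k = if does (k ≟ i) then 1 else below i k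
    g-at : g i ≡ 1
    g-at with i ≟ i
    ... | yes _ = refl
    ... | no ne = contradiction refl ne
    g-off : ∀ k → k ≢ i → g k ≡ below i k
    g-off k k≢i with k ≟ i
    ... | yes eq = contradiction eq k≢i
    ... | no _ = refl
    g≤ : ∀ k → g k ≤ below j k
    g≤ k with k ≟ i
    ... | yes refl = ℕₚ.≤-reflexive (sym (below-yes i≺j))
    ... | no _ with k ≺? i
    ...   | yes p = ℕₚ.≤-reflexive (sym (below-yes (≺-trans p i≺j)))
    ...   | no _  = z≤n

  rank≤⇒⊀ : ∀ {i j} → rank i ≤ rank j → ¬ (j ≺ i)
  rank≤⇒⊀ le j≺i = ℕₚ.<⇒≱ (rank-mono j≺i) le

-- Subsets under deletion, insertion and swaps

del add : Subset ν → Fin ν → Subset ν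
del S e = S [ e ]≔ outside
add S e = S [ e ]≔ inside

swap : Subset ν → Fin ν → Fin ν → Subset ν
swap T e f = add (del T e) f

module _ {S : Subset ν} where

  ∈-del⁺ : ∀ {e x} → x ∈ S → x ≢ e → x ∈ del S e
  ∈-del⁺ {e} {x} x∈S x≢e = []≔-minimal S x e x≢e x∈S

  ∉-del : ∀ {e} → e ∉ del S e
  ∉-del {e} e∈ = case trans (sym (lookup∘update e S outside)) ([]=⇒lookup e∈) of λ ()

  ∈-del⁻ : ∀ {e x} → x ∈ del S e → x ∈ S × x ≢ e
  ∈-del⁻ {e} {x} x∈ with x ≟ e
  ... | yes refl = contradiction x∈ ∉-del
  ... | no x≢e = lookup⇒[]= x S (trans (sym (lookup∘update′ x≢e S outside)) ([]=⇒lookup x∈)) , x≢e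

  ∈-add : ∀ {e} → e ∈ add S e
  ∈-add {e} = []≔-updates S e

  ∈-add⁺ : ∀ {e x} → x ∈ S → x ∈ add S e
  ∈-add⁺ {e} {x} x∈S with x ≟ e
  ... | yes refl = ∈-add
  ... | no x≢e = []≔-minimal S x e x≢e x∈S

  ∈-add⁻ : ∀ {e x} → x ∈ add S e → x ≡ e ⊎ x ∈ S
  ∈-add⁻ {e} {x} x∈ with x ≟ e
  ... | yes x≡e = inj₁ x≡e
  ... | no x≢e = inj₂ (lookup⇒[]= x S (trans (sym (lookup∘update′ x≢e S inside)) ([]=⇒lookup x∈)))

∣del∣ : (S : Subset ν) {e : Fin ν} → e ∈ S → suc ∣ del S e ∣ ≡ ∣ S ∣
∣del∣ (_ ∷ S) here = refl
∣del∣ (true ∷ S) (there e∈) = cong suc (∣del∣ S e∈)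
∣del∣ (false ∷ S) (there e∈) = ∣del∣ S e∈

∣add∣ : (S : Subset ν) {e : Fin ν} → e ∉ S → ∣ add S e ∣ ≡ suc ∣ S ∣
∣add∣ (true ∷ S) {zero} e∉ = contradiction here e∉
∣add∣ (false ∷ S) {zero} e∉ = refl
∣add∣ (true ∷ S) {suc e} e∉ = cong suc (∣add∣ S (e∉ ∘ there))
∣add∣ (false ∷ S) {suc e} e∉ = ∣add∣ S (e∉ ∘ there)

∣add∣≤ : (S : Subset ν) (e : Fin ν) → ∣ add S e ∣ ≤ suc ∣ S ∣
∣add∣≤ (true ∷ S) zero = ℕₚ.n≤1+n _
∣add∣≤ (false ∷ S) zero = ℕₚ.≤-refl
∣add∣≤ (true ∷ S) (suc e) = s≤s (∣add∣≤ S e)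
∣add∣≤ (false ∷ S) (suc e) = ∣add∣≤ S e

module _ {T : Subset ν} {e f : Fin ν} where

  ∈-swap : f ∈ swap T e f
  ∈-swap = ∈-add

  ∈-swap⁺ : ∀ {x} → x ∈ T → x ≢ e → x ∈ swap T e f
  ∈-swap⁺ x∈ x≢e = ∈-add⁺ (∈-del⁺ x∈ x≢e)

  ∈-swap⁻ : ∀ {x} → x ∈ swap T e f → x ≡ f ⊎ (x ∈ T × x ≢ e)
  ∈-swap⁻ x∈ with ∈-add⁻ {S = del T e} x∈
  ... | inj₁ eq = inj₁ eq
  ... | inj₂ x∈d = inj₂ (∈-del⁻ x∈d)

  ∉-swap : e ≢ f → e ∉ swap T e f
  ∉-swap e≢f e∈ = [ e≢f , (λ p → proj₂ p refl) ]′ (∈-swap⁻ e∈)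

∈∉⇒≢ : {S : Subset ν} {x y : Fin ν} → x ∈ S → y ∉ S → x ≢ y
∈∉⇒≢ x∈ y∉ refl = y∉ x∈

swap-swapˡ : {T : Subset ν} {e f g : Fin ν} → f ∉ T → f ≢ g → swap (swap T e f) f g ≡ swap T e g
swap-swapˡ {T = T} {e} {f} {g} f∉T f≢g = ⊆-antisym to from
  where
  to : ∀ {x} → x ∈ swap (swap T e f) f g → x ∈ swap T e g
  to x∈ with ∈-swap⁻ {T = swap T e f} x∈
  ... | inj₁ refl = ∈-swap
  ... | inj₂ (x∈′ , x≢f) with ∈-swap⁻ {T = T} x∈′
  ...   | inj₁ x≡f = contradiction x≡f x≢f
  ...   | inj₂ (x∈T , x≢e) = ∈-swap⁺ x∈T x≢e
  from : ∀ {x} → x ∈ swap T e g → x ∈ swap (swap T e f) f g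
  from x∈ with ∈-swap⁻ {T = T} x∈
  ... | inj₁ refl = ∈-swap
  ... | inj₂ (x∈T , x≢e) = ∈-swap⁺ {T = swap T e f} (∈-swap⁺ x∈T x≢e) (∈∉⇒≢ x∈T f∉T)

swap-swapʳ : {T : Subset ν} {e f g : Fin ν} → e ∈ T → g ≢ e → g ≢ f → swap (swap T e f) g e ≡ swap T g f
swap-swapʳ {T = T} {e} {f} {g} e∈T g≢e g≢f = ⊆-antisym to from
  where
  to : ∀ {x} → x ∈ swap (swap T e f) g e → x ∈ swap T g f
  to x∈ with ∈-swap⁻ {T = swap T e f} x∈
  ... | inj₁ refl = ∈-swap⁺ e∈T (g≢e ∘ sym)
  ... | inj₂ (x∈′ , x≢g) with ∈-swap⁻ {T = T} x∈′
  ...   | inj₁ refl = ∈-swap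
  ...   | inj₂ (x∈T , _) = ∈-swap⁺ x∈T x≢g
  from : ∀ {x} → x ∈ swap T g f → x ∈ swap (swap T e f) g e
  from {x} x∈ with ∈-swap⁻ {T = T} x∈
  ... | inj₁ refl = ∈-swap⁺ {T = swap T e f} ∈-swap (g≢f ∘ sym)
  ... | inj₂ (x∈T , x≢g) with x ≟ e
  ...   | yes refl = ∈-swap
  ...   | no x≢e = ∈-swap⁺ {T = swap T e f} (∈-swap⁺ x∈T x≢e) x≢g

-- König's theorem

Edge : ℕ → Set
Edge ν = Fin ν × Fin ν

Covers : Subset ν → Edge ν → Set
Covers C (a , b) = a ∈ C ⊎ b ∈ C

Disjoint : Edge ν → Edge ν → Set
Disjoint (a , b) (c , d) = a ≢ c × a ≢ d × b ≢ c × b ≢ d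

covers? : (C : Subset ν) (p : Edge ν) → Dec (Covers C p)
covers? C (a , b) = (a ∈? C) ⊎-dec (b ∈? C)

disjoint? : (p q : Edge ν) → Dec (Disjoint p q)
disjoint? (a , b) (c , d) = ¬? (a ≟ c) ×-dec ¬? (a ≟ d) ×-dec ¬? (b ≟ c) ×-dec ¬? (b ≟ d)

Incident : Fin ν → Edge ν → Set
Incident z (a , b) = z ≡ a ⊎ z ≡ b

shared : {p q : Edge ν} → ¬ Disjoint p q → ∃ λ z → Incident z p × Incident z q
shared {p = a , b} {q = c , d} nd with a ≟ c | a ≟ d | b ≟ c | b ≟ d
... | yes e | _ | _ | _ = a , inj₁ refl , inj₁ e
... | no _ | yes e | _ | _ = a , inj₁ refl , inj₂ e
... | no _ | no _ | yes e | _ = b , inj₂ refl , inj₁ e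
... | no _ | no _ | no _ | yes e = b , inj₂ refl , inj₂ e
... | no ac | no ad | no bc | no bd = contradiction (ac , ad , bc , bd) nd

-- The intersection on `B` and the union off `B`. If `B` is one side of a bipartite graph, this is a
-- lattice operation on vertex covers and `∁ B` gives the dual one; together the two preserve the
-- total size (`∣mix∣`).
mix : Subset ν → Subset ν → Subset ν → Subset ν
mix [] [] [] = []
mix (b ∷ B) (c ∷ C) (d ∷ D) = (if b then c ∧ d else c ∨ d) ∷ mix B C D

∈-mix-∩ : {B C D : Subset ν} {i : Fin ν} → i ∈ B → i ∈ C → i ∈ D → i ∈ mix B C D
∈-mix-∩ here here here = here
∈-mix-∩ {B = _ ∷ _} (there b) (there c) (there d) = there (∈-mix-∩ b c d)

∈-mix-∪ : {B C D : Subset ν} {i : Fin ν} → i ∉ B → i ∈ C ⊎ i ∈ D → i ∈ mix B C D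
∈-mix-∪ {B = true ∷ B} {i = zero} b _ = contradiction here b
∈-mix-∪ {B = false ∷ B} {_ ∷ C} {_ ∷ D} b (inj₁ here) = here
∈-mix-∪ {B = false ∷ B} {true ∷ C} {_ ∷ D} b (inj₂ here) = here
∈-mix-∪ {B = false ∷ B} {false ∷ C} {_ ∷ D} b (inj₂ here) = here
∈-mix-∪ {B = _ ∷ B} {_ ∷ C} {_ ∷ D} b (inj₁ (there c)) = there (∈-mix-∪ (b ∘ there) (inj₁ c))
∈-mix-∪ {B = _ ∷ B} {_ ∷ C} {_ ∷ D} b (inj₂ (there c)) = there (∈-mix-∪ (b ∘ there) (inj₂ c))

∣mix∣ : (B C D : Subset ν) → ∣ mix B C D ∣ + ∣ mix (∁ B) C D ∣ ≡ ∣ C ∣ + ∣ D ∣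
∣mix∣ [] [] [] = refl
∣mix∣ (true  ∷ B) (true  ∷ C) (true  ∷ D) = cong suc (trans (ℕₚ.+-suc _ _) (trans (cong suc (∣mix∣ B C D)) (sym (ℕₚ.+-suc _ _))))
∣mix∣ (true  ∷ B) (true  ∷ C) (false ∷ D) = trans (ℕₚ.+-suc _ _) (cong suc (∣mix∣ B C D))
∣mix∣ (true  ∷ B) (false ∷ C) (true  ∷ D) = trans (ℕₚ.+-suc _ _) (trans (cong suc (∣mix∣ B C D)) (sym (ℕₚ.+-suc _ _)))
∣mix∣ (true  ∷ B) (false ∷ C) (false ∷ D) = ∣mix∣ B C D
∣mix∣ (false ∷ B) (true  ∷ C) (true  ∷ D) = cong suc (trans (ℕₚ.+-suc _ _) (trans (cong suc (∣mix∣ B C D)) (sym (ℕₚ.+-suc _ _))))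
∣mix∣ (false ∷ B) (true  ∷ C) (false ∷ D) = cong suc (∣mix∣ B C D)
∣mix∣ (false ∷ B) (false ∷ C) (true  ∷ D) = trans (cong suc (∣mix∣ B C D)) (sym (ℕₚ.+-suc _ _))
∣mix∣ (false ∷ B) (false ∷ C) (false ∷ D) = ∣mix∣ B C D

Separates : Subset ν → Edge ν → Set
Separates B (a , b) = (a ∈ B × b ∉ B) ⊎ (a ∉ B × b ∈ B)

mix-covers : {B C D : Subset ν} (p : Edge ν) → Separates B p →
             Covers C p → Covers D p → Covers (mix B C D) p
mix-covers _ (inj₁ (a∈ , b∉)) (inj₁ c) (inj₁ d) = inj₁ (∈-mix-∩ a∈ c d)
mix-covers _ (inj₁ (a∈ , b∉)) (inj₂ c) _        = inj₂ (∈-mix-∪ b∉ (inj₁ c))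
mix-covers _ (inj₁ (a∈ , b∉)) _        (inj₂ d) = inj₂ (∈-mix-∪ b∉ (inj₂ d))
mix-covers _ (inj₂ (a∉ , b∈)) (inj₂ c) (inj₂ d) = inj₂ (∈-mix-∩ b∈ c d)
mix-covers _ (inj₂ (a∉ , b∈)) (inj₁ c) _        = inj₁ (∈-mix-∪ a∉ (inj₁ c))
mix-covers _ (inj₂ (a∉ , b∈)) _        (inj₁ d) = inj₁ (∈-mix-∪ a∉ (inj₂ d))

module König {ν : ℕ} (side : Fin ν → Bool) where

  Bipartite : Edge ν → Set
  Bipartite (a , b) = side a ≢ side b

  mask : Bool → Subset ν
  mask s = tabulate (λ i → does (side i 𝔹.≟ s))

  ∈-mask⁺ : ∀ {s i} → side i ≡ s → i ∈ mask s
  ∈-mask⁺ {s} {i} eq = lookup⇒[]= i _ (trans (lookup∘tabulate _ i) lem)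
    where
    lem : does (side i 𝔹.≟ s) ≡ true
    lem with side i 𝔹.≟ s
    ... | yes _ = refl
    ... | no ne = contradiction eq ne

  ∈-mask⁻ : ∀ {s i} → i ∈ mask s → side i ≡ s
  ∈-mask⁻ {s} {i} i∈ with trans (sym (lookup∘tabulate _ i)) ([]=⇒lookup i∈)
  ... | eq with side i 𝔹.≟ s
  ...   | yes p = p
  ∈-mask⁻ {s} {i} i∈ | () | no _

  separates : ∀ s p → Bipartite p → Separates (mask s) p
  separates s (a , b) bip with side a 𝔹.≟ s | side b 𝔹.≟ s
  ... | yes a≡ | yes b≡ = contradiction (trans a≡ (sym b≡)) bip
  ... | yes a≡ | no b≢ = inj₁ (∈-mask⁺ a≡ , b≢ ∘ ∈-mask⁻)
  ... | no a≢ | yes b≡ = inj₂ (a≢ ∘ ∈-mask⁻ , ∈-mask⁺ b≡)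
  ... | no a≢ | no b≢ = contradiction (trans (𝔹.¬-not a≢) (sym (𝔹.¬-not b≢))) bip

  separates-∁ : ∀ s p → Bipartite p → Separates (∁ (mask s)) p
  separates-∁ s p bip with separates s p bip
  ... | inj₁ (a∈ , b∉) = inj₂ (x∈p⇒x∉∁p a∈ , x∉p⇒x∈∁p b∉)
  ... | inj₂ (a∉ , b∈) = inj₁ (x∉p⇒x∈∁p a∉ , x∈p⇒x∉∁p b∈)

  -- A cover that avoids `z` covers an edge at `z` by its other end. That end lies on the side where
  -- the union is taken, so one of the two covers is enough.
  mix-covers-at : ∀ {z C D} p → Bipartite p → Incident z p →
                  (Covers C p × z ∉ C) ⊎ (Covers D p × z ∉ D) → Covers (mix (mask (side z)) C D) p
  mix-covers-at _ bip (inj₁ refl) (inj₁ (inj₁ c , z∉)) = contradiction c z∉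
  mix-covers-at _ bip (inj₁ refl) (inj₁ (inj₂ c , z∉)) = inj₂ (∈-mix-∪ (λ b∈ → bip (sym (∈-mask⁻ b∈))) (inj₁ c))
  mix-covers-at _ bip (inj₁ refl) (inj₂ (inj₁ d , z∉)) = contradiction d z∉
  mix-covers-at _ bip (inj₁ refl) (inj₂ (inj₂ d , z∉)) = inj₂ (∈-mix-∪ (λ b∈ → bip (sym (∈-mask⁻ b∈))) (inj₂ d))
  mix-covers-at _ bip (inj₂ refl) (inj₁ (inj₂ c , z∉)) = contradiction c z∉
  mix-covers-at _ bip (inj₂ refl) (inj₁ (inj₁ c , z∉)) = inj₁ (∈-mix-∪ (λ a∈ → bip (∈-mask⁻ a∈)) (inj₁ c))
  mix-covers-at _ bip (inj₂ refl) (inj₂ (inj₂ d , z∉)) = contradiction d z∉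
  mix-covers-at _ bip (inj₂ refl) (inj₂ (inj₁ d , z∉)) = inj₁ (∈-mix-∪ (λ a∈ → bip (∈-mask⁻ a∈)) (inj₂ d))

  -- Two covers of size ≤ k that each miss one of two edges sharing a vertex z
  -- are uncrossed into a cover of everything of size ≤ k.
  uncross : ∀ {k C D p q} as bs → All Bipartite (p ∷ as ++ q ∷ bs) → ¬ Disjoint p q →
            All (Covers C) (as ++ q ∷ bs) → All (Covers D) (p ∷ as ++ bs) → ∣ C ∣ ≤ k → ∣ D ∣ ≤ k →
            ∃ λ E → All (Covers E) (p ∷ as ++ q ∷ bs) × ∣ E ∣ ≤ k
  uncross {k} {C} {D} {p} {q} as bs bips nd covC covD C≤ D≤
    with covers? C p | covers? D q
  ... | yes Cp | _ = C , Cp ∷ covC , C≤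
  ... | no _ | yes Dq = D , All.head covD ∷ Allₚ.++⁺ (Allₚ.++⁻ˡ as (All.tail covD)) (Dq ∷ Allₚ.++⁻ʳ as (All.tail covD)) , D≤
  ... | no ¬Cp | no ¬Dq = conclude
    where
    share = shared nd
    z = proj₁ share
    z∈p = proj₁ (proj₂ share)
    z∈q = proj₂ (proj₂ share)
    B = mask (side z)
    incident-covers : ∀ {S r} → Incident z r → z ∈ S → Covers S r
    incident-covers (inj₁ refl) = inj₁
    incident-covers (inj₂ refl) = inj₂
    z∉C : z ∉ C
    z∉C = ¬Cp ∘ incident-covers z∈p
    z∉D : z ∉ D
    z∉D = ¬Dq ∘ incident-covers z∈q
    bip-q = All.head (Allₚ.++⁻ʳ as (All.tail bips))
    others : ∀ {B′} → (∀ r → Bipartite r → Separates B′ r) → ∀ rs → All Bipartite rs →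
             All (Covers C) rs → All (Covers D) rs → All (Covers (mix B′ C D)) rs
    others sep [] _ _ _ = []
    others sep (r ∷ rs) (b ∷ bs) (c ∷ cs) (d ∷ ds) = mix-covers r (sep r b) c d ∷ others sep rs bs cs ds
    bas = Allₚ.++⁻ˡ as (All.tail bips)
    bbs = All.tail (Allₚ.++⁻ʳ as (All.tail bips))
    Cas = Allₚ.++⁻ˡ as covC
    Cbs = All.tail (Allₚ.++⁻ʳ as covC)
    Das = Allₚ.++⁻ˡ as (All.tail covD)
    Dbs = Allₚ.++⁻ʳ as (All.tail covD)
    E₁ = mix B C D
    E₂ = mix (∁ B) C D
    cov₁ : All (Covers E₁) (p ∷ as ++ q ∷ bs)
    cov₁ = mix-covers-at p (All.head bips) z∈p (inj₂ (All.head covD , z∉D))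
         ∷ Allₚ.++⁺ (others (separates _) as bas Cas Das)
                    (mix-covers-at q bip-q z∈q (inj₁ (All.head (Allₚ.++⁻ʳ as covC) , z∉C))
                     ∷ others (separates _) bs bbs Cbs Dbs)
    grow : ∀ {rs} → All (Covers E₂) rs → All (Covers (add E₂ z)) rs
    grow = All.map [ inj₁ ∘ ∈-add⁺ , inj₂ ∘ ∈-add⁺ ]′
    cov₂ : All (Covers (add E₂ z)) (p ∷ as ++ q ∷ bs)
    cov₂ = incident-covers z∈p ∈-add
         ∷ Allₚ.++⁺ (grow (others (separates-∁ _) as bas Cas Das))
                    (incident-covers z∈q ∈-add ∷ grow (others (separates-∁ _) bs bbs Cbs Dbs))
    conclude : ∃ λ E → All (Covers E) (p ∷ as ++ q ∷ bs) × ∣ E ∣ ≤ k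
    conclude with ∣ E₁ ∣ ℕ.≤? k
    ... | yes le = E₁ , cov₁ , le
    -- The sizes of `E₁` and `E₂` add up to at most 2k, so if `E₁` is too large, `E₂` is smaller
    -- than `k` and has room for `z`, which covers both `p` and `q`.
    ... | no gt = add E₂ z , cov₂ , ℕₚ.≤-trans (∣add∣≤ E₂ z) (ℕₚ.+-cancelˡ-≤ k _ _ (begin
      k + suc ∣ E₂ ∣     ≡⟨ ℕₚ.+-suc k _ ⟩
      suc k + ∣ E₂ ∣     ≤⟨ ℕₚ.+-monoˡ-≤ _ (ℕₚ.≰⇒> gt) ⟩
      ∣ E₁ ∣ + ∣ E₂ ∣    ≡⟨ ∣mix∣ B C D ⟩
      ∣ C ∣ + ∣ D ∣      ≤⟨ ℕₚ.+-mono-≤ C≤ D≤ ⟩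
      k + k              ∎))
      where open ℕₚ.≤-Reasoning

  König : List (Edge ν) → Set
  König es = ∃ λ C → ∃ λ M → All (Covers C) es × All (_∈ₗ es) M × AllPairs Disjoint M × ∣ C ∣ ≤ length M

  -- Induction on the number of edges. The new edge `p` needs attention only if no cover of size
  -- `length M` exists. Then either `p` is disjoint from all other edges and enlarges `M`, or it
  -- meets some `q`. In that case the graph without `q` has a larger matching, since otherwise its
  -- cover and `C` could be uncrossed into a cover of size `length M`.
  könig : ∀ es → All Bipartite es → König es
  könig es = go (length es) es ℕₚ.≤-refl
    where
    go : ∀ fuel es → length es ≤ fuel → All Bipartite es → König es
    go _ [] _ _ = ⊥ , [] , [] , [] , [] , ℕₚ.≤-reflexive (∣⊥∣≡0 ν)
    go (suc fuel) (p ∷ es) (s≤s len) (bp ∷ bips) with go fuel es len bips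
    ... | C , M , cov , M⊆ , disj , C≤
      with anySubset? (λ E → All.all? (covers? E) (p ∷ es) ×-dec (∣ E ∣ ℕ.≤? length M))
         | Any.any? (λ q → ¬? (disjoint? p q)) es
    ...   | yes (E , covE , E≤) | _ = E , M , covE , All.map there M⊆ , disj , E≤
    ...   | no none | no alone =
      add C (proj₁ p) , p ∷ M , inj₁ ∈-add ∷ All.map [ inj₁ ∘ ∈-add⁺ , inj₂ ∘ ∈-add⁺ ]′ cov ,
      here refl ∷ All.map there M⊆ ,
      All.map (λ {q} q∈ → decidable-stable (disjoint? p q) (λ nd → alone (Any.map (λ { refl → nd }) q∈))) M⊆ ∷ disj ,
      ℕₚ.≤-trans (∣add∣≤ C (proj₁ p)) (s≤s C≤)
    ...   | no none | yes meets with find meets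
    ...     | q , q∈ , nd with ∈-∃++ q∈
    ...       | as , bs , refl with go fuel (p ∷ as ++ bs) shorter (bp ∷ Allₚ.++⁺ (Allₚ.++⁻ˡ as bips) (All.tail (Allₚ.++⁻ʳ as bips)))
      where
      shorter : suc (length (as ++ bs)) ≤ fuel
      shorter = subst (_≤ fuel) (trans (length-++ as) (trans (ℕₚ.+-suc _ _) (cong suc (sym (length-++ as))))) len
    ...         | D , N , covD , N⊆ , disjN , D≤ with suc (length M) ℕ.≤? length N
    ...           | yes more =
      add C (proj₁ p) , N , inj₁ ∈-add ∷ All.map [ inj₁ ∘ ∈-add⁺ , inj₂ ∘ ∈-add⁺ ]′ cov ,
      All.map keep N⊆ , disjN , ℕₚ.≤-trans (∣add∣≤ C (proj₁ p)) (ℕₚ.≤-trans (s≤s C≤) more)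
      where
      keep : ∀ {e} → e ∈ₗ p ∷ as ++ bs → e ∈ₗ p ∷ as ++ q ∷ bs
      keep (here eq) = here eq
      keep (there e∈) = there ([ ∈-++⁺ˡ , ∈-++⁺ʳ as ∘ there ]′ (∈-++⁻ as e∈))
    ...           | no fewer =
      contradiction (uncross as bs (bp ∷ bips) nd cov covD C≤ (ℕₚ.≤-trans D≤ (ℕₚ.≮⇒≥ fewer))) none

unique⇒length≤ : (C : Subset ν) {xs : List (Fin ν)} → AllPairs _≢_ xs → All (_∈ C) xs → length xs ≤ ∣ C ∣
unique⇒length≤ C [] [] = z≤n
unique⇒length≤ C {x ∷ xs} (x≢ ∷ uniq) (x∈ ∷ xs∈) =
  ℕₚ.≤-trans (s≤s (unique⇒length≤ (del C x) uniq (All.zipWith (λ (y∈ , x≢y) → ∈-del⁺ y∈ (x≢y ∘ sym)) (xs∈ , x≢))))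
             (ℕₚ.≤-reflexive (∣del∣ C x∈))

unique-exhausts : (C : Subset ν) {xs : List (Fin ν)} → AllPairs _≢_ xs → All (_∈ C) xs →
                  ∣ C ∣ ≤ length xs → ∀ {c} → c ∈ C → c ∈ₗ xs
unique-exhausts C {xs} uniq xs∈ C≤ {c} c∈ with Any.any? (c ≟_) xs
... | yes c∈xs = c∈xs
... | no c∉xs = contradiction (unique⇒length≤ C (Allₚ.¬Any⇒All¬ xs c∉xs ∷ uniq) (c∈ ∷ xs∈)) (ℕₚ.<⇒≱ (s≤s C≤))

AllPairs-lookup : ∀ {A : Set} {R : A → A → Set} → (∀ {x y} → R x y → R y x) → ∀ {xs x y} →
                  AllPairs R xs → x ∈ₗ xs → y ∈ₗ xs → x ≡ y ⊎ R x y
AllPairs-lookup R-sym (_ ∷ _) (here refl) (here refl) = inj₁ refl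
AllPairs-lookup R-sym (rs ∷ _) (here refl) (there y∈) = inj₂ (All.lookup rs y∈)
AllPairs-lookup R-sym (rs ∷ _) (there x∈) (here refl) = inj₂ (R-sym (All.lookup rs x∈))
AllPairs-lookup R-sym (_ ∷ rss) (there x∈) (there y∈) = AllPairs-lookup R-sym rss x∈ y∈

disjoint-sym : {p q : Edge ν} → Disjoint p q → Disjoint q p
disjoint-sym (ac , ad , bc , bd) = ac ∘ sym , bc ∘ sym , ad ∘ sym , bd ∘ sym

record CoverMatching (es : List (Edge ν)) : Set where
  field
    cover   : Subset ν
    covers  : All (Covers cover) es
    pairs   : List (Edge ν)
    inside∉ : All (λ (x , y) → x ∈ cover × y ∉ cover × ((x , y) ∈ₗ es ⊎ (y , x) ∈ₗ es)) pairs
    disjoint : AllPairs Disjoint pairs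
    exhausts : ∀ {c} → c ∈ cover → c ∈ₗ List.map proj₁ pairs

module _ (side : Fin ν → Bool) where
  open König side

  -- The matching has at least as many edges as the cover has vertices, so the covered ends, being
  -- distinct, exhaust the cover. A second covered end would then be the chosen end of some matched
  -- edge: bipartiteness excludes the same edge, disjointness any other.
  coverMatching : ∀ es → All Bipartite es → CoverMatching es
  coverMatching es bips with könig es bips
  ... | C , M , cov , M⊆ , disj , C≤ = record
    { cover = C ; covers = cov ; pairs = ps ; inside∉ = ps-ok ; disjoint = ps-disj ; exhausts = exhaust }
    where
    orient : Edge ν → Edge ν
    orient (a , b) = case a ∈? C of λ { (yes _) → a , b ; (no _) → b , a }
    ps = List.map orient M
    xs = List.map proj₁ ps

    orient-disj : ∀ {p q} → Disjoint p q → Disjoint (orient p) (orient q)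
    orient-disj {a , b} {c , d} (ac , ad , bc , bd) with a ∈? C | c ∈? C
    ... | yes _ | yes _ = ac , ad , bc , bd
    ... | yes _ | no _  = ad , ac , bd , bc
    ... | no _  | yes _ = bc , bd , ac , ad
    ... | no _  | no _  = bd , bc , ad , ac

    orient-covered : ∀ {p} → Covers C p → proj₁ (orient p) ∈ C
    orient-covered {a , b} c with a ∈? C | c
    ... | yes a∈ | _ = a∈
    ... | no a∉ | inj₁ a∈ = contradiction a∈ a∉
    ... | no _  | inj₂ b∈ = b∈

    orient-∈ : ∀ {p} → p ∈ₗ es → orient p ∈ₗ es ⊎ (proj₂ (orient p) , proj₁ (orient p)) ∈ₗ es
    orient-∈ {a , b} p∈ with a ∈? C
    ... | yes _ = inj₁ p∈
    ... | no _  = inj₂ p∈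

    orient-≢ : ∀ {p} → Bipartite p → proj₁ (orient p) ≢ proj₂ (orient p)
    orient-≢ {a , b} bip eq with a ∈? C
    ... | yes _ = bip (cong side eq)
    ... | no _  = bip (cong side (sym eq))

    ps-disj : AllPairs Disjoint ps
    ps-disj = AllPairsₚ.map⁺ (AllPairs.map orient-disj disj)

    xs-uniq : AllPairs _≢_ xs
    xs-uniq = AllPairsₚ.map⁺ (AllPairs.map proj₁ ps-disj)

    xs∈C : All (_∈ C) xs
    xs∈C = Allₚ.map⁺ (Allₚ.map⁺ (All.map (λ p∈ → orient-covered (All.lookup cov p∈)) M⊆))

    exhaust : ∀ {c} → c ∈ C → c ∈ₗ xs
    exhaust = unique-exhausts C xs-uniq xs∈C
      (ℕₚ.≤-trans C≤ (ℕₚ.≤-reflexive (sym (trans (length-map proj₁ ps) (length-map orient M)))))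

    partner∉ : ∀ {p} → p ∈ₗ M → proj₂ (orient p) ∉ C
    partner∉ {p} p∈M y∈ with ∈-map⁻ proj₁ (exhaust y∈)
    ... | _ , r∈ , eq with ∈-map⁻ orient r∈
    ...   | q , q∈M , refl with AllPairs-lookup disjoint-sym disj p∈M q∈M
    ...     | inj₁ refl = orient-≢ (All.lookup bips (All.lookup M⊆ p∈M)) (sym eq)
    ...     | inj₂ d = proj₁ (proj₂ (proj₂ (orient-disj d))) eq

    ps-ok : All (λ (x , y) → x ∈ C × y ∉ C × ((x , y) ∈ₗ es ⊎ (y , x) ∈ₗ es)) ps
    ps-ok = Allₚ.map⁺ (All.tabulate λ {p} p∈M →
      orient-covered (All.lookup cov (All.lookup M⊆ p∈M)) , partner∉ p∈M , orient-∈ (All.lookup M⊆ p∈M))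

<⇒≱ : {p q : ℚ} → p ℚ.< q → ¬ (q ℚ.≤ p)
<⇒≱ p<q q≤p = ℚₚ.<-irrefl refl (ℚₚ.<-≤-trans p<q q≤p)

-- Uncertainty intervals

data Interval : Set where
  point : ℚ → Interval
  open′ : (l u : ℚ) → l ℚ.< u → Interval

lo hi : Interval → ℚ
lo (point v) = v
lo (open′ l _ _) = l
hi (point v) = v
hi (open′ _ u _) = u

_∈ᴵ_ : ℚ → Interval → Set
v ∈ᴵ point a = v ≡ a
v ∈ᴵ open′ l u _ = l ℚ.< v × v ℚ.< u

nontrivial : Interval → Bool
nontrivial (point _) = false
nontrivial (open′ _ _ _) = true

lo≤ : ∀ I {v} → v ∈ᴵ I → lo I ℚ.≤ v
lo≤ (point _) refl = ℚₚ.≤-refl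
lo≤ (open′ _ _ _) (p , _) = ℚₚ.<⇒≤ p

≤hi : ∀ I {v} → v ∈ᴵ I → v ℚ.≤ hi I
≤hi (point _) refl = ℚₚ.≤-refl
≤hi (open′ _ _ _) (_ , p) = ℚₚ.<⇒≤ p

lo< : ∀ I {v} → nontrivial I ≡ true → v ∈ᴵ I → lo I ℚ.< v
lo< (open′ _ _ _) _ (p , _) = p

<hi : ∀ I {v} → nontrivial I ≡ true → v ∈ᴵ I → v ℚ.< hi I
<hi (open′ _ _ _) _ (_ , p) = p

lo≤hi : ∀ I → lo I ℚ.≤ hi I
lo≤hi (point _) = ℚₚ.≤-refl
lo≤hi (open′ _ _ l<u) = ℚₚ.<⇒≤ l<u

lo<hi : ∀ I → nontrivial I ≡ true → lo I ℚ.< hi I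
lo<hi (open′ _ _ l<u) _ = l<u

trivial⇒lo≡hi : ∀ I → nontrivial I ≡ false → lo I ≡ hi I
trivial⇒lo≡hi (point _) _ = refl

-- `late` orders equal keys. At a common lower limit an open interval lies above a point, at a
-- common upper limit below it, so the two instances `L` and `U` use opposite flags.
module Lex (key : Fin ν → ℚ) (late : Fin ν → Bool) where

  _≺_ : Fin ν → Fin ν → Set
  a ≺ b = key a ℚ.< key b ⊎ (key a ≡ key b × late a ≡ false × late b ≡ true)

  _≺?_ : ∀ a b → Dec (a ≺ b)
  a ≺? b = (key a ℚₚ.<? key b) ⊎-dec (key a ℚₚ.≟ key b) ×-dec (late a 𝔹.≟ false) ×-dec (late b 𝔹.≟ true)

  ≺-trans : ∀ {a b c} → a ≺ b → b ≺ c → a ≺ c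
  ≺-trans (inj₁ p) (inj₁ q) = inj₁ (ℚₚ.<-trans p q)
  ≺-trans {a} (inj₁ p) (inj₂ (e , _)) = inj₁ (subst (key a ℚ.<_) e p)
  ≺-trans {c = c} (inj₂ (e , _)) (inj₁ q) = inj₁ (subst (ℚ._< key c) (sym e) q)
  ≺-trans (inj₂ (_ , _ , t)) (inj₂ (_ , f , _)) = case trans (sym t) f of λ ()

  ≺-irrefl : ∀ {a} → ¬ (a ≺ a)
  ≺-irrefl (inj₁ p) = ℚₚ.<-irrefl refl p
  ≺-irrefl (inj₂ (_ , f , t)) = case trans (sym t) f of λ ()

  ⊀⇒key≤ : ∀ {a b} → ¬ (a ≺ b) → key b ℚ.≤ key a
  ⊀⇒key≤ a⊀b = ℚₚ.≮⇒≥ (a⊀b ∘ inj₁)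

  ⊀⇒late : ∀ {a b} → ¬ (a ≺ b) → key b ≡ key a → late b ≡ true → late a ≡ true
  ⊀⇒late a⊀b eq t = 𝔹.¬-not λ f → a⊀b (inj₂ (sym eq , f , t))

-- Querying replaces the interval of an edge by a `point`. What has been learned is thus part of the
-- state, and induction over queries is induction over states.
State : ℕ → Set
State ν = Fin ν → Interval

_∈ˢ_ : (Fin ν → ℚ) → State ν → Set
w ∈ˢ σ = ∀ e → w e ∈ᴵ σ e

reveal : State ν → Subset ν → (Fin ν → ℚ) → State ν
reveal σ Q w e = if lookup Q e then point (w e) else σ e

fix : State ν → Fin ν → ℚ → State ν
fix σ x v e = if does (e ≟ x) then point v else σ e

fix-at : (σ : State ν) (x : Fin ν) (v : ℚ) → fix σ x v x ≡ point v
fix-at σ x v with x ≟ x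
... | yes _ = refl
... | no ne = contradiction refl ne

fix-off : (σ : State ν) {x e : Fin ν} (v : ℚ) → e ≢ x → fix σ x v e ≡ σ e
fix-off σ {x} {e} v ne with e ≟ x
... | yes eq = contradiction eq ne
... | no _ = refl

∈ˢ-fix : {w : Fin ν → ℚ} {σ : State ν} (x : Fin ν) → w ∈ˢ σ → w ∈ˢ fix σ x (w x)
∈ˢ-fix x w∈ e with e ≟ x
... | yes refl = refl
... | no _ = w∈ e

reveal-∉ : (σ : State ν) {Q : Subset ν} {w : Fin ν → ℚ} {e : Fin ν} → e ∉ Q → reveal σ Q w e ≡ σ e
reveal-∉ σ {Q} {w} {e} e∉ with lookup Q e in eq
... | true = contradiction (lookup⇒[]= e Q eq) e∉
... | false = refl

reveal-∈ : (σ : State ν) {Q : Subset ν} {w : Fin ν → ℚ} {e : Fin ν} → e ∈ Q → reveal σ Q w e ≡ point (w e)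
reveal-∈ σ {Q} {w} {e} e∈ rewrite []=⇒lookup e∈ = refl

module _ {σ : State ν} {Q : Subset ν} {w : Fin ν → ℚ} (w∈ : w ∈ˢ σ) where

  lo-reveal≤ : ∀ e → lo (reveal σ Q w e) ℚ.≤ w e
  lo-reveal≤ e with lookup Q e
  ... | true = ℚₚ.≤-refl
  ... | false = lo≤ (σ e) (w∈ e)

  ≤hi-reveal : ∀ e → w e ℚ.≤ hi (reveal σ Q w e)
  ≤hi-reveal e with lookup Q e
  ... | true = ℚₚ.≤-refl
  ... | false = ≤hi (σ e) (w∈ e)

toSubset : {m : ℕ} → List (Fin m) → Subset m
toSubset = foldr (λ e S → ⁅ e ⁆ ∪ S) ⊥

∈-toSubset : {m : ℕ} {xs : List (Fin m)} {x : Fin m} → x ∈ₗ xs → x ∈ toSubset xs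
∈-toSubset {xs = x ∷ xs} (here refl) = p⊆p∪q (toSubset xs) (x∈⁅x⁆ x)
∈-toSubset {xs = x ∷ xs} (there x∈) = q⊆p∪q ⁅ x ⁆ _ (∈-toSubset x∈)

∉⇒lookup : {m : ℕ} {T : Subset m} {f : Fin m} → f ∉ T → lookup T f ≡ false
∉⇒lookup {T = T} {f} f∉ = 𝔹.¬-not (f∉ ∘ lookup⇒[]= f T)

-- Decision trees

data Tree (m : ℕ) : Set where
  done : Tree m
  ask  : Fin m → (ℚ → Tree m) → Tree m

path : {m : ℕ} → Tree m → (Fin m → ℚ) → List (Fin m)
path done w = []
path (ask e t) w = e ∷ path (t (w e)) w

[_∈?]ℕ : {m : ℕ} → Subset m → Fin m → ℕ
[ Q ∈?]ℕ e = if lookup Q e then 1 else 0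

indicator-∈ : {m : ℕ} {Q : Subset m} {e : Fin m} → e ∈ Q → [ Q ∈?]ℕ e ≡ 1
indicator-∈ e∈ rewrite []=⇒lookup e∈ = refl

-- Queried edges are trivial and drop out of the sum: what was booked on them counts as settled.
total : {m : ℕ} → State m → (Fin m → ℕ) → ℕ
total σ k = sum λ e → if nontrivial (σ e) then k e else 0

bump : {m : ℕ} → (Fin m → ℕ) → Fin m → ℕ → Fin m → ℕ
bump k y a e = if does (e ≟ y) then a + k e else k e

bump-at : {m : ℕ} (k : Fin m → ℕ) (y : Fin m) (a : ℕ) → bump k y a y ≡ a + k y
bump-at k y a with y ≟ y
... | yes _ = refl
... | no ne = contradiction refl ne

bump-off : {m : ℕ} (k : Fin m → ℕ) {y e : Fin m} (a : ℕ) → e ≢ y → bump k y a e ≡ k e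
bump-off k {y} {e} a ne with e ≟ y
... | yes eq = contradiction eq ne
... | no _ = refl

nontrivial-unfix : {m : ℕ} {σ : State m} {x e : Fin m} {v : ℚ} →
                   nontrivial (fix σ x v e) ≡ true → nontrivial (σ e) ≡ true × e ≢ x
nontrivial-unfix {x = x} {e} nt with e ≟ x
... | no ne = nt , ne

nontrivial-fix : {m : ℕ} {σ : State m} {x e : Fin m} {v : ℚ} →
                 nontrivial (σ e) ≡ true → e ≢ x → nontrivial (fix σ x v e) ≡ true
nontrivial-fix {σ = σ} {v = v} nt ne = trans (cong nontrivial (fix-off σ v ne)) nt

total-fix : {m : ℕ} {σ : State m} {x : Fin m} (k : Fin m → ℕ) (v : ℚ) → nontrivial (σ x) ≡ true →
            total σ k ≡ k x + total (fix σ x v) k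
total-fix {σ = σ} {x} k v nt = begin
  total σ k              ≡⟨ sym (ℕₚ.+-identityʳ _) ⟩
  total σ k + 0          ≡⟨ cong (λ I → total σ k + (if nontrivial I then k x else 0)) (sym (fix-at σ x v)) ⟩
  total σ k + (if nontrivial (fix σ x v x) then k x else 0)
    ≡⟨ sum-agree-except _ _ x (λ e ne → cong (λ I → if nontrivial I then k e else 0) (sym (fix-off σ v ne))) ⟩
  total (fix σ x v) k + (if nontrivial (σ x) then k x else 0)
    ≡⟨ cong (λ b → total (fix σ x v) k + (if b then k x else 0)) nt ⟩
  total (fix σ x v) k + k x  ≡⟨ ℕₚ.+-comm _ (k x) ⟩
  k x + total (fix σ x v) k  ∎
  where open ≡-Reasoning

total-bump : {m : ℕ} {σ : State m} {y : Fin m} (k : Fin m → ℕ) (a : ℕ) → nontrivial (σ y) ≡ true →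
             total σ (bump k y a) ≡ a + total σ k
total-bump {σ = σ} {y} k a nt = ℕₚ.+-cancelʳ-≡ (k y) _ _ (begin
  total σ (bump k y a) + k y
    ≡⟨ cong (λ b → total σ (bump k y a) + (if b then k y else 0)) (sym nt) ⟩
  total σ (bump k y a) + (if nontrivial (σ y) then k y else 0)
    ≡⟨ sum-agree-except _ _ y (λ e ne → cong (if nontrivial (σ e) then_else 0) (bump-off k a ne)) ⟩
  total σ k + (if nontrivial (σ y) then bump k y a y else 0)
    ≡⟨ cong (λ b → total σ k + (if b then bump k y a y else 0)) nt ⟩
  total σ k + bump k y a y  ≡⟨ cong (total σ k +_) (bump-at k y a) ⟩
  total σ k + (a + k y)     ≡⟨ lemma (total σ k) a (k y) ⟩
  a + total σ k + k y       ∎)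
  where
  open ≡-Reasoning
  lemma : ∀ t a k → t + (a + k) ≡ a + t + k
  lemma = solve-∀

total-mono : {m : ℕ} {σ : State m} {k l : Fin m → ℕ} → (∀ e → nontrivial (σ e) ≡ true → k e ≤ l e) →
             total σ k ≤ total σ l
total-mono {σ = σ} {k} {l} le = sum-mono _ _ pointwise
  where
  pointwise : ∀ e → (if nontrivial (σ e) then k e else 0) ≤ (if nontrivial (σ e) then l e else 0)
  pointwise e with nontrivial (σ e) | le e
  ... | true | k≤l = k≤l refl
  ... | false | _ = z≤n

total-* : {m : ℕ} {σ : State m} (c : ℕ) (k : Fin m → ℕ) → c * total σ k ≡ total σ (λ e → c * k e)
total-* {m} {σ} c k = trans (*-distribˡ-sum {m} c _) (sum-cong-≗ {m} pointwise)
  where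
  pointwise : ∀ e → c * (if nontrivial (σ e) then k e else 0) ≡ (if nontrivial (σ e) then c * k e else 0)
  pointwise e with nontrivial (σ e)
  ... | true = refl
  ... | false = ℕₚ.*-zeroʳ c

∈∪⁻ : ∀ {m} {x e : Fin m} {Q} → e ∈ ⁅ x ⁆ ∪ Q → e ≡ x ⊎ e ∈ Q
∈∪⁻ {x = x} {Q = Q} e∈ = Sum.map₁ (x∈⁅y⁆⇒x≡y x) (x∈p∪q⁻ ⁅ x ⁆ Q e∈)

reveal-fix : ∀ {m} (σ : State m) (x : Fin m) (Q : Subset m) (w : Fin m → ℚ) →
             ∀ e → reveal (fix σ x (w x)) Q w e ≡ reveal σ (⁅ x ⁆ ∪ Q) w e
reveal-fix σ x Q w e = by (e ∈? Q) (e ≟ x)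
  where
  by : Dec (e ∈ Q) → Dec (e ≡ x) → reveal (fix σ x (w x)) Q w e ≡ reveal σ (⁅ x ⁆ ∪ Q) w e
  by (yes e∈) _ = trans (reveal-∈ (fix σ x (w x)) {w = w} e∈) (sym (reveal-∈ σ {w = w} (q⊆p∪q ⁅ x ⁆ Q e∈)))
  by (no e∉) (yes refl) = trans (reveal-∉ (fix σ e (w e)) {w = w} e∉)
    (trans (fix-at σ e (w e)) (sym (reveal-∈ σ {w = w} (p⊆p∪q Q (x∈⁅x⁆ e)))))
  by (no e∉) (no e≢x) = trans (reveal-∉ (fix σ x (w x)) {w = w} e∉)
    (trans (fix-off σ (w x) e≢x) (sym (reveal-∉ σ {w = w} ([ e≢x , e∉ ]′ ∘ ∈∪⁻))))

-- Set systems with symmetric base exchange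

module Matroid {m : ℕ} (𝓑 : Subset m → Set) (𝓑? : ∀ T → Dec (𝓑 T))
  (exchange : ∀ {T T′} → 𝓑 T → 𝓑 T′ → ∀ {f} → f ∈ T′ → f ∉ T →
              ∃ λ e → e ∈ T × e ∉ T′ × 𝓑 (swap T e f) × 𝓑 (swap T′ f e)) where

  record Pair (T : Subset m) (e f : Fin m) : Set where
    constructor pair
    field
      e∈ : e ∈ T
      f∉ : f ∉ T
      base : 𝓑 (swap T e f)
  open Pair public

  pair? : ∀ T e f → Dec (Pair T e f)
  pair? T e f with e ∈? T | f ∈? T | 𝓑? (swap T e f)
  ... | yes a | no b | yes c = yes (pair a b c)
  ... | no a | _ | _ = no (a ∘ e∈)
  ... | yes _ | yes b | _ = no λ p → f∉ p b
  ... | yes _ | no _ | no c = no (c ∘ base)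

  -- The certificate by limits. For spanning trees it is equivalent to being minimum for all weights
  -- in the intervals; `Feas⇒Feasible` and `Feasible⇒Feas` rest on this.
  Optimal : State m → Subset m → Set
  Optimal σ T = 𝓑 T × (∀ e f → Pair T e f → hi (σ e) ℚ.≤ lo (σ f))

  record Feas (σ : State m) (w : Fin m → ℚ) (Q : Subset m) : Set where
    constructor _,_
    field
      tree    : Subset m
      optimal : Optimal (reveal σ Q w) tree

  Optimal-resp : ∀ {σ σ′ T} → (∀ e → hi (σ′ e) ℚ.≤ hi (σ e) × lo (σ e) ℚ.≤ lo (σ′ e)) → Optimal σ T → Optimal σ′ T
  Optimal-resp tighter (T∈ , opt) =
    T∈ , λ e f p → ℚₚ.≤-trans (proj₁ (tighter e)) (ℚₚ.≤-trans (opt e f p) (proj₂ (tighter f)))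

  Optimal-≗ : ∀ {σ σ′ T} → (∀ e → σ e ≡ σ′ e) → Optimal σ T → Optimal σ′ T
  Optimal-≗ {σ} {σ′} eq = Optimal-resp {σ} {σ′} λ e → ℚₚ.≤-reflexive (cong hi (sym (eq e))) , ℚₚ.≤-reflexive (cong lo (eq e))

  weight : (Fin m → ℕ) → Subset m → ℕ
  weight r T = sum λ i → if lookup T i then r i else 0

  weight-del : ∀ r T {e} → e ∈ T → weight r (del T e) + r e ≡ weight r T
  weight-del r T {e} e∈ = begin
    weight r (del T e) + r e
      ≡⟨ cong (λ b → weight r (del T e) + (if b then r e else 0)) (sym ([]=⇒lookup e∈)) ⟩
    weight r (del T e) + (if lookup T e then r e else 0)
      ≡⟨ sum-agree-except _ _ e (λ i i≢e → cong (if_then r i else 0) (lookup∘update′ i≢e T outside)) ⟩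
    weight r T + (if lookup (del T e) e then r e else 0)
      ≡⟨ cong (λ b → weight r T + (if b then r e else 0)) (lookup∘update e T outside) ⟩
    weight r T + 0  ≡⟨ ℕₚ.+-identityʳ _ ⟩
    weight r T      ∎
    where open ≡-Reasoning

  weight-add : ∀ r T {f} → f ∉ T → weight r (add T f) ≡ weight r T + r f
  weight-add r T {f} f∉ = begin
    weight r (add T f)  ≡⟨ sym (ℕₚ.+-identityʳ _) ⟩
    weight r (add T f) + 0
      ≡⟨ cong (λ b → weight r (add T f) + (if b then r f else 0)) (sym f-out) ⟩
    weight r (add T f) + (if lookup T f then r f else 0)
      ≡⟨ sum-agree-except _ _ f (λ i i≢f → cong (if_then r i else 0) (lookup∘update′ i≢f T inside)) ⟩
    weight r T + (if lookup (add T f) f then r f else 0)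
      ≡⟨ cong (λ b → weight r T + (if b then r f else 0)) (lookup∘update f T inside) ⟩
    weight r T + r f  ∎
    where
    open ≡-Reasoning
    f-out : lookup T f ≡ false
    f-out with lookup T f in eq
    ... | true = contradiction (lookup⇒[]= f T eq) f∉
    ... | false = refl

  minimum-base : (r : Fin m → ℕ) → ∀ T → 𝓑 T → ∃ λ T′ → 𝓑 T′ × (∀ e f → Pair T′ e f → r e ≤ r f)
  minimum-base r T T∈ = go T T∈ (<-wellFounded (weight r T))
    where
    go : ∀ T → 𝓑 T → Acc _<_ (weight r T) → ∃ λ T′ → 𝓑 T′ × (∀ e f → Pair T′ e f → r e ≤ r f)
    go T T∈ (acc rs) with any? (λ e → any? λ f → pair? T e f ×-dec (r f ℕ.<? r e))
    ... | no none = T , T∈ , λ e f p → ℕₚ.≮⇒≥ λ lt → none (e , f , p , lt)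
    ... | yes (e , f , p , lt) = go (swap T e f) (base p) (rs (begin-strict
      weight r (swap T e f)      ≡⟨ weight-add r (del T e) (f∉ p ∘ proj₁ ∘ ∈-del⁻) ⟩
      weight r (del T e) + r f   <⟨ ℕₚ.+-monoʳ-< _ lt ⟩
      weight r (del T e) + r e   ≡⟨ weight-del r T (e∈ p) ⟩
      weight r T                 ∎))
      where open ℕₚ.≤-Reasoning

  -- Mandatory edges, witness pairs and forcing predictions

  module _ (σ : State m) where

    nt : Fin m → Set
    nt e = nontrivial (σ e) ≡ true

    module L = Lex (λ e → lo (σ e)) (λ e → nontrivial (σ e))
    module U = Lex (λ e → hi (σ e)) (λ e → not (nontrivial (σ e)))
    module L-rank = Rank L._≺?_ (λ {i} → L.≺-trans {i}) (λ {i} → L.≺-irrefl {i})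
    module U-rank = Rank (flip U._≺?_) (λ {i} {j} {k} p q → U.≺-trans {k} {j} {i} q p) (λ {i} → U.≺-irrefl {i})

    Mandatory : Fin m → Set
    Mandatory x = ∀ w Q → w ∈ˢ σ → Feas σ w Q → x ∈ Q

    Witness : Fin m → Fin m → Set
    Witness x y = ∀ w Q → w ∈ˢ σ → Feas σ w Q → x ∈ Q ⊎ y ∈ Q

    -- Locally minimum both for weights just above the lower limits and for weights just below the
    -- upper limits: the lower limit tree and the upper limit tree coincide.
    record Tame (T : Subset m) : Set where
      field
        base-T : 𝓑 T
        L-opt : ∀ {e f} → Pair T e f → ¬ (f L.≺ e)
        U-opt : ∀ {e f} → Pair T e f → ¬ (f U.≺ e)

    -- On a tie `e` is late, hence so is `f`: its interval is open and lies strictly above the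
    -- common limit.
    lo-below : ∀ {e f v} → ¬ (f L.≺ e) → nt e → v ∈ᴵ σ f → lo (σ e) ℚ.< v
    lo-below {e} {f} {v} f⊀e nte v∈ with ℚₚ._<?_ (lo (σ e)) (lo (σ f))
    ... | yes lt = ℚₚ.<-≤-trans lt (lo≤ (σ f) v∈)
    ... | no ge = subst (ℚ._< v) (sym eq) (lo< (σ f) (L.⊀⇒late {f} {e} f⊀e eq nte) v∈)
      where eq = ℚₚ.≤-antisym (L.⊀⇒key≤ f⊀e) (ℚₚ.≮⇒≥ ge)

    hi-above : ∀ {e f v} → ¬ (f U.≺ e) → nt f → v ∈ᴵ σ e → v ℚ.< hi (σ f)
    hi-above {e} {f} {v} f⊀e ntf v∈ with ℚₚ._<?_ (hi (σ e)) (hi (σ f)) | nontrivial (σ e) 𝔹.≟ true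
    ... | yes lt | _ = ℚₚ.≤-<-trans (≤hi (σ e) v∈) lt
    ... | no ge | yes nte = subst (v ℚ.<_) (ℚₚ.≤-antisym (U.⊀⇒key≤ {f} {e} f⊀e) (ℚₚ.≮⇒≥ ge)) (<hi (σ e) nte v∈)
    ... | no ge | no te = contradiction
      (inj₂ (sym (ℚₚ.≤-antisym (U.⊀⇒key≤ {f} {e} f⊀e) (ℚₚ.≮⇒≥ ge)) , cong not ntf , cong not (𝔹.¬-not te))) f⊀e

    module _ {w : Fin m → ℚ} {Q : Subset m} (w∈ : w ∈ˢ σ) {T′ : Subset m} (opt : Optimal (reveal σ Q w) T′) where

      -- This and `hi≤value` are the source of the contradictions below: a pair of the certifying
      -- tree bounds a true value, queried or not, by a limit of an unqueried edge.
      value≤lo : ∀ {e f} → f ∉ Q → Pair T′ e f → w e ℚ.≤ lo (σ f)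
      value≤lo {e} {f} f∉Q p = subst (w e ℚ.≤_) (cong lo (reveal-∉ σ {w = w} f∉Q)) (ℚₚ.≤-trans (≤hi-reveal {σ = σ} {Q} w∈ e) (proj₂ opt e f p))

      hi≤value : ∀ {e f} → e ∉ Q → Pair T′ e f → hi (σ e) ℚ.≤ w f
      hi≤value {e} {f} e∉Q p = subst (ℚ._≤ w f) (cong hi (reveal-∉ σ {w = w} e∉Q)) (ℚₚ.≤-trans (proj₂ opt e f p) (lo-reveal≤ {σ = σ} {Q} w∈ f))

    -- The mandatory edge is the swap partner of f with the largest upper limit.
    upward-mandatory : ∀ {T} → 𝓑 T → (∀ {e f} → Pair T e f → ¬ (f L.≺ e)) →
                       ∀ {e f} → Pair T e f → f U.≺ e → ∃ λ x → nt x × Mandatory x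
    upward-mandatory {T} T∈ L-opt {e₀} {f} p₀ f≺e₀
      with argmin (λ e → pair? T e f ×-dec (f U.≺? e)) U-rank.rank e₀ (p₀ , f≺e₀)
    ... | e , (p , f≺e) , e-max = e , nte , mandatory
      where
      unbeaten : ∀ {g} → Pair T g f → ¬ (e U.≺ g)
      unbeaten {g} q e≺g = U-rank.rank≤⇒⊀ (e-max g (q , U.≺-trans {f} {e} {g} f≺e e≺g)) e≺g

      nte : nt e
      nte with nontrivial (σ e) in eq
      ... | true = refl
      ... | false = contradiction f≺e λ where
          (inj₁ lt) → <⇒≱ lt (ℚₚ.≤-trans (ℚₚ.≤-reflexive (sym (trivial⇒lo≡hi (σ e) eq)))
                                   (ℚₚ.≤-trans (L.⊀⇒key≤ (L-opt p)) (lo≤hi (σ f))))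
          (inj₂ (eqh , ntf , _)) → <⇒≱ (lo<hi (σ f) (𝔹.not-injective {_} {true} ntf))
              (ℚₚ.≤-trans (ℚₚ.≤-reflexive (trans eqh (sym (trivial⇒lo≡hi (σ e) eq)))) (L.⊀⇒key≤ (L-opt p)))

      mandatory : Mandatory e
      mandatory w Q w∈ (T′ , opt) with e ∈? Q | e ∈? T′
      ... | yes e∈Q | _ = e∈Q
      -- If `T′` omits `e`, some `g` that `e` can replace in `T′` must be worth at most the lower
      -- limit of `e`. But `g` can also replace `e` in `T`, so `L-opt` makes it worth more.
      ... | no e∉Q | no e∉T′ with exchange (proj₁ opt) T∈ (e∈ p) e∉T′
      ...   | g , g∈T′ , g∉T , b′ , b = contradiction (value≤lo w∈ opt e∉Q (pair g∈T′ e∉T′ b′))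
                                          (<⇒≱ (lo-below (L-opt (pair (e∈ p) g∉T b)) nte (w∈ g)))
      -- If `T′` contains `e`, an exchange with `T` after the swap of `e` for `f` finds some `g` on
      -- the cycle closed by `f` that can replace `e` in `T′`. It must be worth at least the upper
      -- limit of `e`, but by the choice of `e` it is worth less.
      mandatory w Q w∈ (T′ , opt) | no e∉Q | yes e∈T′
        with exchange (base p) (proj₁ opt) e∈T′ (∉-swap (∈∉⇒≢ (e∈ p) (f∉ p)))
      ... | g , g∈T₁ , g∉T′ , b₁ , b′ = contradiction (hi≤value w∈ opt e∉Q (pair e∈T′ g∉T′ b′)) (<⇒≱ below)
        where
        below : w g ℚ.< hi (σ e)
        below with ∈-swap⁻ {T = T} g∈T₁
        ... | inj₁ refl = [ ℚₚ.≤-<-trans (≤hi (σ g) (w∈ g))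
                          , (λ (eqh , ntf , _) → subst (w g ℚ.<_) eqh (<hi (σ g) (𝔹.not-injective {_} {true} ntf) (w∈ g))) ]′ f≺e
        ... | inj₂ (g∈T , g≢e) =
          hi-above (unbeaten (pair g∈T (f∉ p) (subst 𝓑 (swap-swapʳ (e∈ p) g≢e (λ { refl → f∉ p g∈T })) b₁)))
                   nte (w∈ g)

    tame-or-mandatory : ∀ {T₀} → 𝓑 T₀ → (∃ λ x → nt x × Mandatory x) ⊎ (∃ λ T → Tame T)
    tame-or-mandatory {T₀} T₀∈ with minimum-base L-rank.rank T₀ T₀∈
    ... | T , T∈ , r≤ with any? (λ e → any? λ f → pair? T e f ×-dec (f U.≺? e))
    ...   | yes (e , f , p , f≺e) = inj₁ (upward-mandatory T∈ (λ {e} {f} q → L-rank.rank≤⇒⊀ (r≤ e f q)) p f≺e)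
    ...   | no none = inj₂ (T , record { base-T = T∈ ; L-opt = λ {e} {f} q → L-rank.rank≤⇒⊀ (r≤ e f q)
                                       ; U-opt = λ {e} {f} q f≺e → none (e , f , q , f≺e) })
    module _ {T : Subset m} (tame : Tame T) where
      open Tame tame

      lo-mono : ∀ {e f} → Pair T e f → lo (σ e) ℚ.≤ lo (σ f)
      lo-mono p = L.⊀⇒key≤ (L-opt p)

      hi-mono : ∀ {e f} → Pair T e f → hi (σ e) ℚ.≤ hi (σ f)
      hi-mono {e} {f} p = U.⊀⇒key≤ {f} {e} (U-opt p)

      module _ {w : Fin m → ℚ} {Q : Subset m} (w∈ : w ∈ˢ σ) {T′ : Subset m} (opt : Optimal (reveal σ Q w) T′) where

        -- Otherwise `e` could replace in `T′` some `g` that in turn can replace `e` in `T`. Its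
        -- value would be at most the lower limit of the unqueried `e`, which `L-opt` rules out.
        tree-edge-stays : ∀ {e} → nt e → e ∈ T → e ∉ Q → e ∈ T′
        tree-edge-stays {e} nte e∈T e∉Q with e ∈? T′
        ... | yes e∈T′ = e∈T′
        ... | no e∉T′ with exchange (proj₁ opt) base-T e∈T e∉T′
        ...   | g , g∈T′ , g∉T , b′ , b =
          contradiction (value≤lo w∈ opt e∉Q (pair g∈T′ e∉T′ b′)) (<⇒≱ (lo-below (L-opt (pair e∈T g∉T b)) nte (w∈ g)))

        nontree-edge-stays : ∀ {f} → nt f → f ∉ T → f ∉ Q → f ∉ T′
        nontree-edge-stays {f} ntf f∉T f∉Q f∈T′ with exchange base-T (proj₁ opt) f∈T′ f∉T
        ... | g , g∈T , g∉T′ , b , b′ =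
          contradiction (hi≤value w∈ opt f∉Q (pair f∈T′ g∉T′ b′)) (<⇒≱ (hi-above (U-opt (pair g∈T f∉T b)) ntf (w∈ g)))

        -- The cycle that `f` closes in `T′` meets the cut of `e` in `T` in a second edge.
        cut-exchange : ∀ {e f} → Pair T e f → f ∉ T′ → Pair T′ e f ⊎ ∃ λ g → Pair T e g × g ≢ f × Pair T′ g f
        cut-exchange {e} {f} p f∉T′ with exchange (proj₁ opt) (base p) ∈-swap f∉T′
        ... | g , g∈T′ , g∉T₁ , b′ , b₁ with g ≟ e
        ...   | yes refl = inj₁ (pair g∈T′ f∉T′ b′)
        ...   | no g≢e = inj₂ (g , pair (e∈ p) g∉T (subst 𝓑 (swap-swapˡ (f∉ p) (g≢f ∘ sym)) b₁) , g≢f , pair g∈T′ f∉T′ b′)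
          where
          g≢f : g ≢ f
          g≢f refl = g∉T₁ ∈-swap
          g∉T : g ∉ T
          g∉T g∈T = g∉T₁ (∈-swap⁺ g∈T g≢e)

        -- The cut of `e` in `T′` meets the cycle that `f` closes in `T` in a second edge.
        cycle-exchange : ∀ {e f} → Pair T e f → e ∈ T′ → Pair T′ e f ⊎ ∃ λ g → Pair T g f × g ≢ e × Pair T′ e g
        cycle-exchange {e} {f} p e∈T′ with exchange (base p) (proj₁ opt) e∈T′ (∉-swap (∈∉⇒≢ (e∈ p) (f∉ p)))
        ... | g , g∈T₁ , g∉T′ , b₁ , b′ with ∈-swap⁻ {T = T} g∈T₁
        ...   | inj₁ refl = inj₁ (pair e∈T′ g∉T′ b′)
        ...   | inj₂ (g∈T , g≢e) =
          inj₂ (g , pair g∈T (f∉ p) (subst 𝓑 (swap-swapʳ (e∈ p) g≢e (∈∉⇒≢ g∈T (f∉ p))) b₁) , g≢e , pair e∈T′ g∉T′ b′)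

        hi≤lo : ∀ {e f} → e ∉ Q → f ∉ Q → Pair T′ e f → hi (σ e) ℚ.≤ lo (σ f)
        hi≤lo {e} {f} e∉Q f∉Q p = subst₂ (λ I J → hi I ℚ.≤ lo J) (reveal-∉ σ {w = w} e∉Q) (reveal-∉ σ {w = w} f∉Q) (proj₂ opt e f p)

      -- If both are unqueried, `f` stays outside `T′`, so some other edge of the cut of `e` is
      -- worth at most the lower limit of `f`. The overlap excludes `e`, and `cut` excludes all
      -- others.
      cut-witness : ∀ {e f w Q} → Pair T e f → nt e → nt f → lo (σ f) ℚ.< hi (σ e) →
                    (∀ g → Pair T e g → g ≢ f → lo (σ f) ℚ.< w g ⊎ hi (σ e) ℚ.≤ w g) →
                    w ∈ˢ σ → Feas σ w Q → e ∈ Q ⊎ f ∈ Q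
      cut-witness {e} {f} {w} {Q} p nte ntf f<e cut w∈ (T′ , opt) with e ∈? Q | f ∈? Q
      ... | yes e∈Q | _ = inj₁ e∈Q
      ... | no _ | yes f∈Q = inj₂ f∈Q
      ... | no e∉Q | no f∉Q with cut-exchange {Q = Q} w∈ opt p (nontree-edge-stays w∈ opt ntf (f∉ p) f∉Q)
      ...   | inj₁ p′ = contradiction (hi≤lo w∈ opt e∉Q f∉Q p′) (<⇒≱ f<e)
      ...   | inj₂ (g , pg , g≢f , p′) with cut g pg g≢f
      ...     | inj₁ lt = contradiction (value≤lo w∈ opt f∉Q p′) (<⇒≱ lt)
      ...     | inj₂ le = contradiction (ℚₚ.≤-trans le (value≤lo w∈ opt f∉Q p′)) (<⇒≱ f<e)

      -- Dually, `e` stays in `T′`, so some other edge of the cycle of `f` is worth at least the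
      -- upper limit of `e`.
      cycle-witness : ∀ {e f w Q} → Pair T e f → nt e → nt f → lo (σ f) ℚ.< hi (σ e) →
                      (∀ g → Pair T g f → g ≢ e → w g ℚ.< hi (σ e) ⊎ w g ℚ.≤ lo (σ f)) →
                      w ∈ˢ σ → Feas σ w Q → e ∈ Q ⊎ f ∈ Q
      cycle-witness {e} {f} {w} {Q} p nte ntf f<e cycle w∈ (T′ , opt) with e ∈? Q | f ∈? Q
      ... | yes e∈Q | _ = inj₁ e∈Q
      ... | no _ | yes f∈Q = inj₂ f∈Q
      ... | no e∉Q | no f∉Q with cycle-exchange {Q = Q} w∈ opt p (tree-edge-stays w∈ opt nte (e∈ p) e∉Q)
      ...   | inj₁ p′ = contradiction (hi≤lo w∈ opt e∉Q f∉Q p′) (<⇒≱ f<e)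
      ...   | inj₂ (g , pg , g≢e , p′) with cycle g pg g≢e
      ...     | inj₁ lt = contradiction (hi≤value w∈ opt e∉Q p′) (<⇒≱ lt)
      ...     | inj₂ le = contradiction (ℚₚ.≤-trans (hi≤value w∈ opt e∉Q p′) le) (<⇒≱ f<e)

      trivial-hi≤ : ∀ {e g w} → w ∈ˢ σ → Pair T e g → nontrivial (σ g) ≡ false → hi (σ e) ℚ.≤ w g
      trivial-hi≤ {e} {g} w∈ p tg =
        ℚₚ.≤-trans (hi-mono p) (ℚₚ.≤-trans (ℚₚ.≤-reflexive (sym (trivial⇒lo≡hi (σ g) tg))) (lo≤ (σ g) (w∈ g)))

      ≤trivial-lo : ∀ {g f w} → w ∈ˢ σ → Pair T g f → nontrivial (σ g) ≡ false → w g ℚ.≤ lo (σ f)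
      ≤trivial-lo {g} {f} w∈ p tg =
        ℚₚ.≤-trans (≤hi (σ g) (w∈ g)) (ℚₚ.≤-trans (ℚₚ.≤-reflexive (sym (trivial⇒lo≡hi (σ g) tg))) (lo-mono p))

      -- The choice supplies the hypothesis of `cut-witness` for all realisations at once:
      -- non-trivial edges of the cut start no lower than `f′`, and trivial ones are at least the
      -- upper limit of `e` because the tree is tame.
      lowest-cut : ∀ {e f} → Pair T e f → nt f → ∃ λ f′ → Pair T e f′ × nt f′ × lo (σ f′) ℚ.≤ lo (σ f) ×
                   (∀ {w} → w ∈ˢ σ → ∀ g → Pair T e g → g ≢ f′ → lo (σ f′) ℚ.< w g ⊎ hi (σ e) ℚ.≤ w g)
      lowest-cut {e} {f} p ntf
        with argmin (λ g → pair? T e g ×-dec (nontrivial (σ g) 𝔹.≟ true)) L-rank.rank f (p , ntf)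
      ... | f′ , (p′ , ntf′) , least = f′ , p′ , ntf′ , below p ntf , sep
        where
        below : ∀ {g} → Pair T e g → nt g → lo (σ f′) ℚ.≤ lo (σ g)
        below {g} pg ntg = L.⊀⇒key≤ (L-rank.rank≤⇒⊀ (least g (pg , ntg)))
        sep : ∀ {w} → w ∈ˢ σ → ∀ g → Pair T e g → g ≢ f′ → lo (σ f′) ℚ.< w g ⊎ hi (σ e) ℚ.≤ w g
        sep w∈ g pg _ with nontrivial (σ g) 𝔹.≟ true
        ... | yes ntg = inj₁ (ℚₚ.≤-<-trans (below pg ntg) (lo< (σ g) ntg (w∈ g)))
        ... | no tg = inj₂ (trivial-hi≤ w∈ pg (𝔹.¬-not tg))

      highest-on-cycle : ∀ {e f} → Pair T e f → nt e → ∃ λ e′ → Pair T e′ f × nt e′ × hi (σ e) ℚ.≤ hi (σ e′) ×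
                         (∀ {w} → w ∈ˢ σ → ∀ g → Pair T g f → g ≢ e′ → w g ℚ.< hi (σ e′) ⊎ w g ℚ.≤ lo (σ f))
      highest-on-cycle {e} {f} p nte
        with argmin (λ g → pair? T g f ×-dec (nontrivial (σ g) 𝔹.≟ true)) U-rank.rank e (p , nte)
      ... | e′ , (p′ , nte′) , greatest = e′ , p′ , nte′ , above p nte , sep
        where
        above : ∀ {g} → Pair T g f → nt g → hi (σ g) ℚ.≤ hi (σ e′)
        above {g} pg ntg = U.⊀⇒key≤ {e′} {g} (U-rank.rank≤⇒⊀ (greatest g (pg , ntg)))
        sep : ∀ {w} → w ∈ˢ σ → ∀ g → Pair T g f → g ≢ e′ → w g ℚ.< hi (σ e′) ⊎ w g ℚ.≤ lo (σ f)
        sep w∈ g pg _ with nontrivial (σ g) 𝔹.≟ true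
        ... | yes ntg = inj₁ (ℚₚ.<-≤-trans (<hi (σ g) ntg (w∈ g)) (above pg ntg))
        ... | no tg = inj₂ (≤trivial-lo w∈ pg (𝔹.¬-not tg))

      Conflict : Fin m → Fin m → Set
      Conflict e f = Pair T e f × nt e × nt f × lo (σ f) ℚ.< hi (σ e)

      conflict? : ∀ e f → Dec (Conflict e f)
      conflict? e f = pair? T e f ×-dec (nontrivial (σ e) 𝔹.≟ true) ×-dec (nontrivial (σ f) 𝔹.≟ true)
                      ×-dec (lo (σ f) ℚₚ.<? hi (σ e))

      ¬conflict⇒hi≤lo : ∀ {e f} → Pair T e f → ¬ Conflict e f → hi (σ e) ℚ.≤ lo (σ f)
      ¬conflict⇒hi≤lo {e} {f} p ¬c with nontrivial (σ e) 𝔹.≟ true | nontrivial (σ f) 𝔹.≟ true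
      ... | yes nte | yes ntf = ℚₚ.≮⇒≥ λ lt → ¬c (p , nte , ntf , lt)
      ... | no te | _ = ℚₚ.≤-trans (ℚₚ.≤-reflexive (sym (trivial⇒lo≡hi (σ e) (𝔹.¬-not te)))) (lo-mono p)
      ... | _ | no tf = ℚₚ.≤-trans (hi-mono p) (ℚₚ.≤-reflexive (sym (trivial⇒lo≡hi (σ f) (𝔹.¬-not tf))))

      solved-or-witness : Optimal σ T ⊎ (∃ λ e → ∃ λ f → nt e × nt f × e ≢ f × Witness e f)
      solved-or-witness with any? (λ e → any? (conflict? e))
      ... | no none = inj₁ (base-T , λ e f p → ¬conflict⇒hi≤lo p λ c → none (e , f , c))
      ... | yes (e , f , p , nte , ntf , f<e) with lowest-cut p ntf
      ...   | f′ , p′ , ntf′ , f′≤f , sep =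
        inj₂ (e , f′ , nte , ntf′ , ∈∉⇒≢ (e∈ p′) (f∉ p′) ,
              λ w Q w∈ → cut-witness p′ nte ntf′ (ℚₚ.≤-<-trans f′≤f f<e) (sep w∈) w∈)

      record Forces (ŵ : Fin m → ℚ) (y x : Fin m) : Set where
        field
          nt-x : nt x
          nt-y : nt y
          x≢y : x ≢ y
          witness : Witness x y
          forced : ∀ w Q → w ∈ˢ σ → Feas σ w Q → w y ≡ ŵ y → x ∈ Q

      -- `f′` can stay unqueried only if another edge of the cut of `e` is worth at most its lower
      -- limit. Only `e` itself could be, and the predicted value of `e` is too large.
      forces-nontree : ∀ {ŵ e f} → ŵ ∈ˢ σ → Pair T e f → nt e → nt f → lo (σ f) ℚ.< ŵ e → ∃ λ x → Forces ŵ e x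
      forces-nontree {ŵ} {e} {f} ŵ∈ p nte ntf f<ŵe with lowest-cut p ntf
      ... | f′ , p′ , ntf′ , f′≤f , sep = f′ , record
        { nt-x = ntf′ ; nt-y = nte ; x≢y = ∈∉⇒≢ (e∈ p′) (f∉ p′) ∘ sym
        ; witness = λ w Q w∈ F → [ inj₂ , inj₁ ]′ (cut-witness p′ nte ntf′ (ℚₚ.<-trans f′<ŵe ŵe<) (sep w∈) w∈ F)
        ; forced = forced }
        where
        f′<ŵe = ℚₚ.≤-<-trans f′≤f f<ŵe
        ŵe< = <hi (σ e) nte (ŵ∈ e)
        forced : ∀ w Q → w ∈ˢ σ → Feas σ w Q → w e ≡ ŵ e → f′ ∈ Q
        forced w Q w∈ (T′ , opt) we with f′ ∈? Q
        ... | yes f′∈Q = f′∈Q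
        ... | no f′∉Q with cut-exchange {Q = Q} w∈ opt p′ (nontree-edge-stays w∈ opt ntf′ (f∉ p′) f′∉Q)
        ...   | inj₁ q = contradiction (subst (ℚ._≤ lo (σ f′)) we (value≤lo w∈ opt f′∉Q q)) (<⇒≱ f′<ŵe)
        ...   | inj₂ (g , pg , g≢f′ , q) with sep w∈ g pg g≢f′
        ...     | inj₁ lt = contradiction (value≤lo w∈ opt f′∉Q q) (<⇒≱ lt)
        ...     | inj₂ le = contradiction (ℚₚ.≤-trans le (value≤lo w∈ opt f′∉Q q)) (<⇒≱ (ℚₚ.<-trans f′<ŵe ŵe<))

      forces-tree : ∀ {ŵ e f} → ŵ ∈ˢ σ → Pair T e f → nt e → nt f → ŵ f ℚ.< hi (σ e) → ∃ λ x → Forces ŵ f x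
      forces-tree {ŵ} {e} {f} ŵ∈ p nte ntf ŵf<e with highest-on-cycle p nte
      ... | e′ , p′ , nte′ , e≤e′ , sep = e′ , record
        { nt-x = nte′ ; nt-y = ntf ; x≢y = ∈∉⇒≢ (e∈ p′) (f∉ p′)
        ; witness = λ w Q w∈ F → cycle-witness p′ nte′ ntf (ℚₚ.<-trans <ŵf ŵf<e′) (sep w∈) w∈ F
        ; forced = forced }
        where
        ŵf<e′ = ℚₚ.<-≤-trans ŵf<e e≤e′
        <ŵf = lo< (σ f) ntf (ŵ∈ f)
        forced : ∀ w Q → w ∈ˢ σ → Feas σ w Q → w f ≡ ŵ f → e′ ∈ Q
        forced w Q w∈ (T′ , opt) wf with e′ ∈? Q
        ... | yes e′∈Q = e′∈Q
        ... | no e′∉Q with cycle-exchange {Q = Q} w∈ opt p′ (tree-edge-stays w∈ opt nte′ (e∈ p′) e′∉Q)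
        ...   | inj₁ q = contradiction (subst (hi (σ e′) ℚ.≤_) wf (hi≤value w∈ opt e′∉Q q)) (<⇒≱ ŵf<e′)
        ...   | inj₂ (g , pg , g≢e′ , q) with sep w∈ g pg g≢e′
        ...     | inj₁ lt = contradiction (hi≤value w∈ opt e′∉Q q) (<⇒≱ lt)
        ...     | inj₂ le = contradiction (ℚₚ.≤-trans (hi≤value w∈ opt e′∉Q q) le) (<⇒≱ (ℚₚ.<-trans <ŵf ŵf<e′))

      -- Known as prediction mandatory free: no prediction lies inside the interval of an exchange
      -- partner.
      Calm : (Fin m → ℚ) → Set
      Calm ŵ = ∀ {e f} → Pair T e f → nt e → nt f → ŵ e ℚ.≤ lo (σ f) × hi (σ e) ℚ.≤ ŵ f

      forcing-or-calm : ∀ {ŵ} → ŵ ∈ˢ σ → (∃ λ y → ∃ λ x → Forces ŵ y x) ⊎ Calm ŵ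
      forcing-or-calm {ŵ} ŵ∈
        with any? (λ e → any? λ f → pair? T e f ×-dec (nontrivial (σ e) 𝔹.≟ true) ×-dec (nontrivial (σ f) 𝔹.≟ true)
                                    ×-dec ((lo (σ f) ℚₚ.<? ŵ e) ⊎-dec (ŵ f ℚₚ.<? hi (σ e))))
      ... | yes (e , f , p , nte , ntf , inj₁ lt) = inj₁ (e , forces-nontree ŵ∈ p nte ntf lt)
      ... | yes (e , f , p , nte , ntf , inj₂ lt) = inj₁ (f , forces-tree ŵ∈ p nte ntf lt)
      ... | no none = inj₂ λ {e} {f} p nte ntf → ℚₚ.≮⇒≥ (λ lt → none (e , f , p , nte , ntf , inj₁ lt))
                                               , ℚₚ.≮⇒≥ (λ lt → none (e , f , p , nte , ntf , inj₂ lt))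

  -- Schedules built from a vertex cover

  Feas-mono : ∀ {σ w Q Q′} → w ∈ˢ σ → (∀ {e} → e ∈ Q → e ∈ Q′) → Feas σ w Q → Feas σ w Q′
  Feas-mono {σ} {w} {Q} {Q′} w∈ Q⊆ (T , opt) = T , Optimal-resp {reveal σ Q w} {reveal σ Q′ w} tighter opt
    where
    tighter : ∀ e → hi (reveal σ Q′ w e) ℚ.≤ hi (reveal σ Q w e) × lo (reveal σ Q w e) ℚ.≤ lo (reveal σ Q′ w e)
    tighter e with e ∈? Q | e ∈? Q′
    ... | yes e∈ | _ rewrite reveal-∈ σ {w = w} e∈ | reveal-∈ σ {w = w} (Q⊆ e∈) = ℚₚ.≤-refl , ℚₚ.≤-refl
    ... | no e∉ | yes e∈′ rewrite reveal-∈ σ {w = w} e∈′ = ≤hi-reveal {σ = σ} {Q} w∈ e , lo-reveal≤ {σ = σ} {Q} w∈ e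
    ... | no e∉ | no e∉′ rewrite reveal-∉ σ {w = w} e∉ | reveal-∉ σ {w = w} e∉′ = ℚₚ.≤-refl , ℚₚ.≤-refl

  -- The pairs are queried in turn; each is a witness set provided that the
  -- first components queried before it were predicted correctly.
  Chain : (Fin m → ℚ) → ((Fin m → ℚ) → Subset m → Set) → List (Edge m) → Set
  Chain ŵ ℋ [] = ⊤
  Chain ŵ ℋ ((x , y) ∷ ps) =
    (∀ w Q → ℋ w Q → x ∈ Q ⊎ y ∈ Q) × Chain ŵ (λ w Q → ℋ w Q × w x ≡ ŵ x) ps

  record Schedule (σ : State m) (ŵ : Fin m → ℚ) : Set₁ where
    field
      pairs : List (Edge m)
      nts : All (λ (x , y) → nt σ x × nt σ y × x ≢ y) pairs
      disjoint : AllPairs Disjoint pairs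
      chain : Chain ŵ (λ w Q → w ∈ˢ σ × Feas σ w Q) pairs
      feasible : Feas σ ŵ (toSubset (List.map proj₁ pairs))

  module _ {σ : State m} {ŵ : Fin m → ℚ} {C : Subset m} (key : Fin m → ℚ) where

    -- Invariant: a member of `C` is among the first components still to come or was predicted
    -- correctly. Sortedness keeps members with a smaller key than `x` out of the remainder, so they
    -- meet the condition for the witness pair at `x`.
    chain-of-sorted : ∀ {ℋ} ps → AllPairs (λ p q → key (proj₁ p) ℚ.≤ key (proj₁ q)) ps →
      All (λ (x , y) → ∀ w Q → w ∈ˢ σ → Feas σ w Q → (∀ {c} → c ∈ C → key c ℚ.< key x → w c ≡ ŵ c) → x ∈ Q ⊎ y ∈ Q) ps →
      (∀ w Q → ℋ w Q → w ∈ˢ σ × Feas σ w Q × (∀ {c} → c ∈ C → c ∈ₗ List.map proj₁ ps ⊎ w c ≡ ŵ c)) →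
      Chain ŵ ℋ ps
    chain-of-sorted [] _ _ _ = tt
    chain-of-sorted {ℋ} ((x , y) ∷ ps) (x≤ ∷ sorted) (wit ∷ wits) ℋ⇒ =
      (λ w Q h → let w∈ , feas , asked = ℋ⇒ w Q h in wit w Q w∈ feas λ c∈ lt → earlier lt (asked c∈)) ,
      chain-of-sorted ps sorted wits λ w Q (h , wx) → let w∈ , feas , asked = ℋ⇒ w Q h in
        w∈ , feas , λ c∈ → later wx (asked c∈)
      where
      earlier : ∀ {c} {A : Set} → key c ℚ.< key x → c ∈ₗ x ∷ List.map proj₁ ps ⊎ A → A
      earlier lt (inj₂ a) = a
      earlier lt (inj₁ (here refl)) = contradiction lt (ℚₚ.<-irrefl refl)
      earlier lt (inj₁ (there c∈)) with ∈-map⁻ proj₁ c∈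
      ... | q , q∈ , refl = contradiction (All.lookup x≤ q∈) (<⇒≱ lt)
      later : ∀ {w : Fin m → ℚ} {c} → w x ≡ ŵ x → c ∈ₗ x ∷ List.map proj₁ ps ⊎ w c ≡ ŵ c →
              c ∈ₗ List.map proj₁ ps ⊎ w c ≡ ŵ c
      later wx (inj₁ (here refl)) = inj₂ wx
      later wx (inj₁ (there c∈)) = inj₁ c∈
      later wx (inj₂ eq) = inj₂ eq

  module _ {σ : State m} {ŵ : Fin m → ℚ} (ŵ∈ : ŵ ∈ˢ σ) {T : Subset m} (tame : Tame σ T) (calm : Calm σ tame ŵ) where
    open Tame tame

    Conf : Edge m → Set
    Conf (e , f) = Conflict σ tame e f

    conf? : ∀ p → Dec (Conf p)
    conf? (e , f) = conflict? σ tame e f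

    conflicts : List (Edge m)
    conflicts = filter conf? (cartesianProduct (allFin m) (allFin m))

    ∈-conflicts : ∀ {e f} → Conflict σ tame e f → (e , f) ∈ₗ conflicts
    ∈-conflicts {e} {f} c = ∈-filter⁺ conf? (∈-cartesianProduct⁺ (∈-allFin e) (∈-allFin f)) c

    conflicts∈ : ∀ {p} → p ∈ₗ conflicts → Conf p
    conflicts∈ {p} p∈ = proj₂ (∈-filter⁻ conf? {xs = cartesianProduct (allFin m) (allFin m)} p∈)

    open König (lookup T) using (Bipartite)

    matching : CoverMatching conflicts
    matching = coverMatching (lookup T) conflicts (All.tabulate λ {p} p∈ → bip p (conflicts∈ p∈))
      where
      bip : ∀ p → Conf p → Bipartite p
      bip (e , f) (p , _) eq = case trans (sym ([]=⇒lookup (e∈ p))) (trans eq (∉⇒lookup (f∉ p))) of λ ()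
    open CoverMatching matching renaming (cover to C; covers to C-covers; pairs to ps₀)

    covered : ∀ {e f} → Conflict σ tame e f → e ∈ C ⊎ f ∈ C
    covered c = All.lookup C-covers (∈-conflicts c)

    calm-lo : ∀ {e f} → Pair T e f → ŵ e ℚ.≤ lo (σ f)
    calm-lo {e} {f} p with nontrivial (σ e) 𝔹.≟ true | nontrivial (σ f) 𝔹.≟ true
    ... | yes nte | yes ntf = proj₁ (calm p nte ntf)
    ... | no te | _ = ≤trivial-lo σ tame ŵ∈ p (𝔹.¬-not te)
    ... | yes _ | no tf = ℚₚ.≤-trans (≤hi (σ e) (ŵ∈ e)) (ℚₚ.≤-trans (hi-mono σ tame p)
                            (ℚₚ.≤-reflexive (sym (trivial⇒lo≡hi (σ f) (𝔹.¬-not tf)))))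

    calm-hi : ∀ {e f} → Pair T e f → hi (σ e) ℚ.≤ ŵ f
    calm-hi {e} {f} p with nontrivial (σ e) 𝔹.≟ true | nontrivial (σ f) 𝔹.≟ true
    ... | yes nte | yes ntf = proj₂ (calm p nte ntf)
    ... | _ | no tf = trivial-hi≤ σ tame ŵ∈ p (𝔹.¬-not tf)
    ... | no te | yes _ = ℚₚ.≤-trans (ℚₚ.≤-reflexive (sym (trivial⇒lo≡hi (σ e) (𝔹.¬-not te))))
                            (ℚₚ.≤-trans (lo-mono σ tame p) (lo≤ (σ f) (ŵ∈ f)))

    -- By calmness the predicted value of either end settles a conflict, and `C` meets every
    -- conflict.
    cover-feasible : Feas σ ŵ C
    cover-feasible = T , (base-T , opt)
      where
      opt : ∀ e f → Pair T e f → hi (reveal σ C ŵ e) ℚ.≤ lo (reveal σ C ŵ f)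
      opt e f p with e ∈? C | f ∈? C
      ... | yes e∈C | yes f∈C rewrite reveal-∈ σ {w = ŵ} e∈C | reveal-∈ σ {w = ŵ} f∈C =
              ℚₚ.≤-trans (calm-lo p) (lo≤ (σ f) (ŵ∈ f))
      ... | yes e∈C | no f∉C rewrite reveal-∈ σ {w = ŵ} e∈C | reveal-∉ σ {w = ŵ} f∉C = calm-lo p
      ... | no e∉C | yes f∈C rewrite reveal-∉ σ {w = ŵ} e∉C | reveal-∈ σ {w = ŵ} f∈C = calm-hi p
      ... | no e∉C | no f∉C rewrite reveal-∉ σ {w = ŵ} e∉C | reveal-∉ σ {w = ŵ} f∉C =
              ¬conflict⇒hi≤lo σ tame p (λ c → [ e∉C , f∉C ]′ (covered c))

    -- Queried in the order of their keys, the matched pairs are witness sets when their turn comes.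
    key : Fin m → ℚ
    key e = if lookup T e then ℚ.- hi (σ e) else lo (σ e)

    key-tree : ∀ {e} → e ∈ T → key e ≡ ℚ.- hi (σ e)
    key-tree e∈T rewrite []=⇒lookup e∈T = refl

    key-nontree : ∀ {f} → f ∉ T → key f ≡ lo (σ f)
    key-nontree f∉T rewrite ∉⇒lookup f∉T = refl

    PairWitness : Edge m → Set
    PairWitness (x , y) = ∀ w Q → w ∈ˢ σ → Feas σ w Q →
      (∀ {c} → c ∈ C → key c ℚ.< key x → w c ≡ ŵ c) → x ∈ Q ⊎ y ∈ Q

    -- Only an edge `g` of the cycle of `f` with a larger upper limit than `e` can spoil the pair.
    -- It conflicts with `f`, which is outside `C`, so it lies in `C`. The negated upper limit in
    -- `key` puts it before `e`, and by calmness its predicted value is at most the lower limit of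
    -- `f`.
    tree-pair-witness : ∀ {e f} → Conflict σ tame e f → f ∉ C → PairWitness (e , f)
    tree-pair-witness {e} {f} (p , nte , ntf , f<e) f∉C w Q w∈ feas right =
      cycle-witness σ tame p nte ntf f<e cycle w∈ feas
      where
      cycle : ∀ g → Pair T g f → g ≢ e → w g ℚ.< hi (σ e) ⊎ w g ℚ.≤ lo (σ f)
      cycle g pg _ with nontrivial (σ g) 𝔹.≟ true | hi (σ g) ℚₚ.≤? hi (σ e)
      ... | no tg | _ = inj₂ (≤trivial-lo σ tame w∈ pg (𝔹.¬-not tg))
      ... | yes ntg | yes le = inj₁ (ℚₚ.<-≤-trans (<hi (σ g) ntg (w∈ g)) le)
      ... | yes ntg | no gt with covered (pg , ntg , ntf , ℚₚ.<-trans f<e (ℚₚ.≰⇒> gt))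
      ...   | inj₂ f∈C = contradiction f∈C f∉C
      ...   | inj₁ g∈C = inj₂ (subst (ℚ._≤ lo (σ f)) (sym (right g∈C key<)) (calm-lo pg))
        where
        key< : key g ℚ.< key e
        key< = subst₂ ℚ._<_ (sym (key-tree (e∈ pg))) (sym (key-tree (e∈ p))) (ℚₚ.neg-antimono-< (ℚₚ.≰⇒> gt))

    -- Dually, a spoiling `g` lies in the cut of `e` and starts below `f`. Hence it belongs to `C`
    -- and comes earlier, and its predicted value is at least the upper limit of `e`.
    nontree-pair-witness : ∀ {e f} → Conflict σ tame e f → e ∉ C → PairWitness (f , e)
    nontree-pair-witness {e} {f} (p , nte , ntf , f<e) e∉C w Q w∈ feas right =
      Sum.swap (cut-witness σ tame p nte ntf f<e cut w∈ feas)
      where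
      cut : ∀ g → Pair T e g → g ≢ f → lo (σ f) ℚ.< w g ⊎ hi (σ e) ℚ.≤ w g
      cut g pg _ with nontrivial (σ g) 𝔹.≟ true | lo (σ f) ℚₚ.≤? lo (σ g)
      ... | no tg | _ = inj₂ (trivial-hi≤ σ tame w∈ pg (𝔹.¬-not tg))
      ... | yes ntg | yes le = inj₁ (ℚₚ.≤-<-trans le (lo< (σ g) ntg (w∈ g)))
      ... | yes ntg | no gt with covered (pg , nte , ntg , ℚₚ.<-trans (ℚₚ.≰⇒> gt) f<e)
      ...   | inj₁ e∈C = contradiction e∈C e∉C
      ...   | inj₂ g∈C = inj₂ (subst (hi (σ e) ℚ.≤_) (sym (right g∈C key<)) (calm-hi pg))
        where
        key< : key g ℚ.< key f
        key< = subst₂ ℚ._<_ (sym (key-nontree (f∉ pg))) (sym (key-nontree (f∉ p))) (ℚₚ.≰⇒> gt)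

    keyOrder : DecTotalOrder _ _ _
    keyOrder = On.decTotalOrder ℚₚ.≤-decTotalOrder (key ∘ proj₁ {A = Fin m} {B = λ _ → Fin m})

    open Sort keyOrder using (sort; sort-↭; sort-↗)

    schedule : Schedule σ ŵ
    schedule = record
      { pairs = ps
      ; nts = All.map nts′ ok
      ; disjoint = ↭ₛ.AllPairs-resp-↭ (setoid _) disjoint-sym ((λ { refl → id }) , (λ { refl → id }))
                     (↭⇒↭ₛ (↭-sym (sort-↭ ps₀))) disjoint
      ; chain = chain-of-sorted {σ} {ŵ} {C} key ps (Sorted⇒AllPairs (DecTotalOrder.totalOrder keyOrder) (sort-↗ ps₀))
                  (All.map wits ok) λ w Q (w∈ , feas) → w∈ , feas , inj₁ ∘ exhausts′
      ; feasible = Feas-mono {σ} {ŵ} {C} ŵ∈ (∈-toSubset ∘ exhausts′) cover-feasible }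
      where
      ps = sort ps₀
      exhausts′ : ∀ {c} → c ∈ C → c ∈ₗ List.map proj₁ ps
      exhausts′ c∈ = ∈-resp-↭ (↭-map⁺ proj₁ (↭-sym (sort-↭ ps₀))) (exhausts c∈)
      Ok : Edge m → Set
      Ok (x , y) = x ∈ C × y ∉ C × ((x , y) ∈ₗ conflicts ⊎ (y , x) ∈ₗ conflicts)
      ok : All Ok ps
      ok = All-resp-↭ (↭-sym (sort-↭ ps₀)) inside∉
      nts′ : ∀ {p} → Ok p → nt σ (proj₁ p) × nt σ (proj₂ p) × proj₁ p ≢ proj₂ p
      nts′ (_ , _ , inj₁ c) with conflicts∈ c
      ... | p , nte , ntf , _ = nte , ntf , ∈∉⇒≢ (e∈ p) (f∉ p)
      nts′ (_ , _ , inj₂ c) with conflicts∈ c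
      ... | p , nte , ntf , _ = ntf , nte , ∈∉⇒≢ (e∈ p) (f∉ p) ∘ sym
      wits : ∀ {p} → Ok p → PairWitness p
      wits (_ , y∉ , inj₁ c) = tree-pair-witness (conflicts∈ c) y∉
      wits (_ , y∉ , inj₂ c) = nontree-pair-witness (conflicts∈ c) y∉

  -- Charges, payments and the robust fallback

  module Strategies (T₀ : Subset m) (T₀∈ : 𝓑 T₀) (γ : ℕ) (2≤γ : 2 ≤ γ) where

    Weights : Set
    Weights = Fin m → ℚ

    Feas-unfix : ∀ {σ x w Q} → Feas (fix σ x (w x)) w Q → Feas σ w (⁅ x ⁆ ∪ Q)
    Feas-unfix {σ} {x} {w} {Q} (T , opt) = T , Optimal-≗ {reveal (fix σ x (w x)) Q w} (reveal-fix σ x Q w) opt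

    Feas-refix : ∀ {σ x w Q} → Feas σ w (⁅ x ⁆ ∪ Q) → Feas (fix σ x (w x)) w Q
    Feas-refix {σ} {x} {w} {Q} (T , opt) = T , Optimal-≗ {reveal σ (⁅ x ⁆ ∪ Q) w} (sym ∘ reveal-fix σ x Q w) opt

    Feas-fix : ∀ {σ x w Q} → w ∈ˢ σ → Feas σ w Q → Feas (fix σ x (w x)) w Q
    Feas-fix {σ} {x} {w} {Q} w∈ feas = Feas-refix {σ} (Feas-mono {σ} w∈ (q⊆p∪q ⁅ x ⁆ Q) feas)

    Feas-fix≡ : ∀ {σ x w v Q} → w x ≡ v → w ∈ˢ σ → Feas σ w Q → Feas (fix σ x v) w Q
    Feas-fix≡ {σ} refl = Feas-fix {σ}

    Solves : State m → Tree m → Set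
    Solves σ t = ∀ w → w ∈ˢ σ → Feas σ w (toSubset (path t w))

    -- k y counts the queries charged to the unqueried edge y, d y what a feasible set Q pays
    -- for y and them; Y holds the edges whose charged queries are all in Q if y is predicted correctly.
    record Ledger (ŵ : Weights) (Y : Fin m → Set) (σ : State m) (k : Fin m → ℕ) (w : Weights) (Q : Subset m) (d : Fin m → ℕ) : Set where
      field
        own   : ∀ y → nt σ y → [ Q ∈?]ℕ y ≤ d y
        paid  : ∀ y → nt σ y → 1 ≤ k y → 1 ≤ d y
        trust : ∀ y → nt σ y → Y y → w y ≡ ŵ y → k y + [ Q ∈?]ℕ y ≤ d y
    open Ledger

    -- `l` counts the queries still to come, `total σ k` those already made whose cost is charged to
    -- unqueried edges.
    Bound : State m → (k d : Fin m → ℕ) → ℕ → Set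
    Bound σ k d l = l + total σ k ≤ γ * total σ d

    Robust : Weights → (Weights → Subset m → Set) → (Fin m → Set) → State m → (Fin m → ℕ) → Tree m → Set
    Robust ŵ ℋ Y σ k t = ∀ w Q d → w ∈ˢ σ → ℋ w Q → Ledger ŵ Y σ k w Q d → Bound σ k d (length (path t w))

    Ledger-fix : ∀ {ŵ Y Y′ σ k w Q d x v} → (∀ {z} → Y′ z → Y z) → Ledger ŵ Y σ k w Q d → Ledger ŵ Y′ (fix σ x v) k w Q d
    Ledger-fix {σ = σ} {x = x} ⊆Y Λ = record
      { own = λ y nty → own Λ y (unfix nty)
      ; paid = λ y nty → paid Λ y (unfix nty)
      ; trust = λ y nty Yy → trust Λ y (unfix nty) (⊆Y Yy) }
      where
      unfix : ∀ {y v} → nt (fix σ x v) y → nt σ y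
      unfix = proj₁ ∘ nontrivial-unfix {σ = σ} {x}

    ≤-bump : ∀ k y a (z : Fin m) → k z ≤ bump k y a z
    ≤-bump k y a z with does (z ≟ y)
    ... | true = ℕₚ.m≤n+m (k z) a
    ... | false = ℕₚ.≤-refl

    -- What `Q` pays for `x` moves to `y` along with the charge. The witness pair yields `paid`, and
    -- `trust` survives at `y` if a correct `y` forces `x` into `Q`.
    Ledger-join : ∀ {ŵ Y Y′ σ k w Q d x y v} → nt σ y → x ∈ Q ⊎ y ∈ Q →
                  (∀ {z} → Y′ z → Y z) → (Y′ y → w y ≡ ŵ y → x ∈ Q) → Ledger ŵ Y σ k w Q d →
                  Ledger ŵ Y′ (fix σ x v) (bump k y 1) w Q (bump d y ([ Q ∈?]ℕ x))
    Ledger-join {ŵ} {Y} {Y′} {σ} {k} {w} {Q} {d} {x} {y} {v} nty x∨y ⊆Y forced Λ = record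
      { own = λ z ntz → ℕₚ.≤-trans (own Λ z (unfix ntz)) (≤-bump d y _ z)
      ; paid = paid′ ; trust = trust′ }
      where
      unfix : ∀ {z} → nt (fix σ x v) z → nt σ z
      unfix = proj₁ ∘ nontrivial-unfix {σ = σ} {x}
      paid′ : ∀ z → nt (fix σ x v) z → 1 ≤ bump k y 1 z → 1 ≤ bump d y ([ Q ∈?]ℕ x) z
      paid′ z ntz 1≤ with z ≟ y
      ... | no _ = paid Λ z (unfix ntz) 1≤
      ... | yes refl = [ (λ x∈ → ℕₚ.≤-trans (ℕₚ.≤-reflexive (sym (indicator-∈ x∈))) (ℕₚ.m≤m+n _ (d y)))
                       , (λ y∈ → ℕₚ.≤-trans (subst (_≤ d y) (indicator-∈ y∈) (own Λ y nty)) (ℕₚ.m≤n+m (d y) _)) ]′ x∨y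
      trust′ : ∀ z → nt (fix σ x v) z → Y′ z → w z ≡ ŵ z → bump k y 1 z + [ Q ∈?]ℕ z ≤ bump d y ([ Q ∈?]ℕ x) z
      trust′ z ntz Yz wz with z ≟ y
      ... | no _ = trust Λ z (unfix ntz) (⊆Y Yz) wz
      ... | yes refl rewrite indicator-∈ (forced Yz wz) = s≤s (trust Λ y nty (⊆Y Yz) wz)

    -- The query of `x` and its at most γ - 1 charges are settled together by a payment of at least
    -- one.
    close-bound : ∀ {σ k d x v l} → nt σ x → k x < γ → 1 ≤ d x → Bound (fix σ x v) k d l → Bound σ k d (suc l)
    close-bound {σ} {k} {d} {x} {v} {l} ntx kx< 1≤dx b = begin
      suc l + total σ k                   ≡⟨ cong (suc l +_) (total-fix {σ = σ} k v ntx) ⟩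
      suc l + (k x + total (fix σ x v) k) ≡⟨ regroup l (k x) (total (fix σ x v) k) ⟩
      suc (k x) + (l + total (fix σ x v) k) ≤⟨ ℕₚ.+-mono-≤ (ℕₚ.≤-trans kx< (ℕₚ.≤-trans (ℕₚ.≤-reflexive (sym (ℕₚ.*-identityʳ γ))) (ℕₚ.*-monoʳ-≤ γ 1≤dx))) b ⟩
      γ * d x + γ * total (fix σ x v) d   ≡⟨ sym (ℕₚ.*-distribˡ-+ γ (d x) _) ⟩
      γ * (d x + total (fix σ x v) d)     ≡⟨ cong (γ *_) (sym (total-fix {σ = σ} d v ntx)) ⟩
      γ * total σ d                       ∎
      where
      open ℕₚ.≤-Reasoning
      regroup : ∀ l k t → suc l + (k + t) ≡ suc k + (l + t)
      regroup = solve-∀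

    two-bound : ∀ {σ k d x y v v′ l} → nt σ y → nt σ x → x ≢ y → 2 + (k y + k x) ≤ γ * (d y + d x) →
                Bound (fix (fix σ y v) x v′) k d l → Bound σ k d (2 + l)
    two-bound {σ} {k} {d} {x} {y} {v} {v′} {l} nty ntx x≢y 2≤ b = begin
      2 + l + total σ k                 ≡⟨ cong (2 + l +_) (split k) ⟩
      2 + l + (k y + (k x + total σ₂ k)) ≡⟨ regroup l (k y) (k x) (total σ₂ k) ⟩
      2 + (k y + k x) + (l + total σ₂ k) ≤⟨ ℕₚ.+-mono-≤ 2≤ b ⟩
      γ * (d y + d x) + γ * total σ₂ d  ≡⟨ sym (ℕₚ.*-distribˡ-+ γ (d y + d x) _) ⟩
      γ * (d y + d x + total σ₂ d)      ≡⟨ cong (γ *_) (trans (ℕₚ.+-assoc (d y) _ _) (sym (split d))) ⟩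
      γ * total σ d                     ∎
      where
      open ℕₚ.≤-Reasoning
      σ₂ = fix (fix σ y v) x v′
      split : ∀ k → total σ k ≡ k y + (k x + total σ₂ k)
      split k = trans (total-fix {σ = σ} k v nty) (cong (k y +_) (total-fix {σ = fix σ y v} k v′ (nontrivial-fix {σ = σ} ntx x≢y)))
      regroup : ∀ l a b t → 2 + l + (a + (b + t)) ≡ 2 + (a + b) + (l + t)
      regroup = solve-∀

    -- The new query is not settled but reappears as the unit added to `k y`. Charges on `x` would
    -- have to be settled now, hence `k x ≡ 0`.
    join-bound : ∀ {σ k d x y v q l} → nt σ x → nt σ y → x ≢ y → k x ≡ 0 → q ≤ d x →
                 Bound (fix σ x v) (bump k y 1) (bump d y q) l → Bound σ k d (suc l)
    join-bound {σ} {k} {d} {x} {y} {v} {q} {l} ntx nty x≢y kx q≤ b = begin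
      suc l + total σ k                   ≡⟨ cong (suc l +_) (trans (total-fix {σ = σ} k v ntx) (cong (_+ total σ′ k) kx)) ⟩
      suc l + total σ′ k                  ≡⟨ sym (ℕₚ.+-suc l _) ⟩
      l + suc (total σ′ k)                ≡⟨ cong (l +_) (sym (total-bump {σ = σ′} k 1 nty′)) ⟩
      l + total σ′ (bump k y 1)           ≤⟨ b ⟩
      γ * total σ′ (bump d y q)           ≡⟨ cong (γ *_) (total-bump {σ = σ′} d q nty′) ⟩
      γ * (q + total σ′ d)                ≤⟨ ℕₚ.*-monoʳ-≤ γ (ℕₚ.+-monoˡ-≤ _ q≤) ⟩
      γ * (d x + total σ′ d)              ≡⟨ cong (γ *_) (sym (total-fix {σ = σ} d v ntx)) ⟩
      γ * total σ d                       ∎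
      where
      open ℕₚ.≤-Reasoning
      σ′ = fix σ x v
      nty′ = nontrivial-fix {σ = σ} {x = x} {v = v} nty (x≢y ∘ sym)

    done-bound : ∀ {ŵ Y σ k w Q d} → (∀ y → k y < γ) → Ledger ŵ Y σ k w Q d → Bound σ k d 0
    done-bound {σ = σ} {k} {d = d} k< Λ =
      ℕₚ.≤-trans (total-mono {σ = σ} pointwise) (ℕₚ.≤-reflexive (sym (total-* {σ = σ} γ d)))
      where
      pointwise : ∀ y → nt σ y → k y ≤ γ * d y
      pointwise y nty with 1 ℕ.≤? k y
      ... | yes 1≤ = ℕₚ.≤-trans (ℕₚ.<⇒≤ (k< y)) (ℕₚ.≤-trans (ℕₚ.≤-reflexive (sym (ℕₚ.*-identityʳ γ))) (ℕₚ.*-monoʳ-≤ γ (paid Λ y nty 1≤)))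
      ... | no ¬1≤ = ℕₚ.≤-trans (ℕₚ.≤-reflexive (ℕₚ.n<1⇒n≡0 (ℕₚ.≰⇒> ¬1≤))) z≤n

    size : State m → ℕ
    size σ = total σ λ _ → 1

    size-fix : ∀ {σ x v fuel} → nt σ x → size σ ≤ suc fuel → size (fix σ x v) ≤ fuel
    size-fix {σ} {x} {v} ntx le = ℕₚ.≤-pred (subst (_≤ _) (total-fix {σ = σ} (λ _ → 1) v ntx) le)

    ¬nt-size0 : ∀ {σ x} → nt σ x → ¬ (size σ ≤ 0)
    ¬nt-size0 {σ} {x} ntx le = case subst (_≤ 0) (total-fix {σ = σ} (λ _ → 1) 0ℚ ntx) le of λ ()

    Solves-ask : ∀ {σ x} t → (∀ v → Solves (fix σ x v) (t v)) → Solves σ (ask x t)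
    Solves-ask {σ} {x} t s w w∈ = Feas-unfix {σ} (s (w x) w (∈ˢ-fix x w∈))

    Optimal⇒Feas : ∀ {σ T w Q} → w ∈ˢ σ → Optimal σ T → Feas σ w Q
    Optimal⇒Feas {σ} {T} {w} w∈ opt = Feas-mono {σ} {Q = ⊥} w∈ (λ x∈ → contradiction x∈ ∉⊥)
      (T , Optimal-≗ {σ} (λ e → sym (reveal-∉ σ {w = w} ∉⊥)) opt)

    -- Once a prediction has failed, only robustness matters: first the edges carrying charges
    -- are queried, then mandatory edges and witness pairs.
    Fallback : State m → (Fin m → ℕ) → Tree m → Set
    Fallback σ k t = Solves σ t × (∀ ŵ → Robust ŵ (Feas σ) (λ _ → Empty) σ k t)

    fallback : ∀ fuel σ k → size σ ≤ fuel → (∀ y → k y < γ) → ∃ (Fallback σ k)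
    fallback-closing : ∀ fuel σ k → size σ ≤ fuel → (∀ y → k y < γ) → ∀ {x} → nt σ x →
      (∀ w Q → w ∈ˢ σ → Feas σ w Q → x ∈ Q ⊎ 1 ≤ k x) → ∃ (Fallback σ k)

    fallback fuel σ k fits k< with any? (λ y → (nontrivial (σ y) 𝔹.≟ true) ×-dec (1 ℕ.≤? k y))
    ... | yes (y , nty , 1≤) = fallback-closing fuel σ k fits k< nty λ _ _ _ _ → inj₂ 1≤
    ... | no none with tame-or-mandatory σ T₀∈
    ...   | inj₁ (x , ntx , mand) = fallback-closing fuel σ k fits k< ntx λ w Q w∈ feas → inj₁ (mand w Q w∈ feas)
    ...   | inj₂ (T , tame) with solved-or-witness σ tame
    ...     | inj₁ opt = done , (λ w w∈ → Optimal⇒Feas {σ} w∈ opt) , λ ŵ w Q d w∈ feas Λ → done-bound k< Λ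
    ...     | inj₂ (x , y , ntx , nty , x≢y , wit) = pairwise fuel fits
      where
      k≡0 : ∀ {z} → nt σ z → k z ≡ 0
      k≡0 {z} ntz = ℕₚ.n<1⇒n≡0 (ℕₚ.≰⇒> λ 1≤ → none (z , ntz , 1≤))
      -- All charges are settled by now, so a witness pair costs two queries against a payment of at
      -- least one, which `2≤γ` covers.
      pairwise : ∀ fuel → size σ ≤ fuel → ∃ (Fallback σ k)
      pairwise zero le = contradiction le (¬nt-size0 {σ} nty)
      pairwise (suc zero) le = contradiction (size-fix {σ} {v = 0ℚ} nty le) (¬nt-size0 {fix σ y 0ℚ} (nontrivial-fix {σ = σ} ntx x≢y))
      pairwise (suc (suc fuel)) le =
        ask y (λ v → ask x λ v′ → proj₁ (rec v v′)) ,
        Solves-ask {σ} (λ v → ask x (λ v′ → proj₁ (rec v v′)))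
          (λ v → Solves-ask {fix σ y v} (λ v′ → proj₁ (rec v v′)) (λ v′ → proj₁ (proj₂ (rec v v′)))) ,
        λ ŵ w Q d w∈ feas Λ →
          two-bound {σ} {k} {d} nty ntx x≢y
            (subst (λ a → 2 + a ≤ γ * (d y + d x)) (sym (cong₂ _+_ (k≡0 nty) (k≡0 ntx)))
              (ℕₚ.≤-trans 2≤γ (ℕₚ.≤-trans (ℕₚ.≤-reflexive (sym (ℕₚ.*-identityʳ γ))) (ℕₚ.*-monoʳ-≤ γ (pays Λ (wit w Q w∈ feas))))))
            (proj₂ (proj₂ (rec (w y) (w x))) ŵ w Q d (∈ˢ-fix x (∈ˢ-fix y w∈))
              (Feas-fix {fix σ y (w y)} (∈ˢ-fix y w∈) (Feas-fix {σ} w∈ feas))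
              (Ledger-fix {σ = fix σ y (w y)} id (Ledger-fix {σ = σ} id Λ)))
        where
        rec : ∀ v v′ → ∃ (Fallback (fix (fix σ y v) x v′) k)
        rec v v′ = fallback fuel _ k (size-fix {fix σ y v} (nontrivial-fix {σ = σ} ntx x≢y) (size-fix {σ} nty le)) k<
        pays : ∀ {ŵ w Q d} → Ledger ŵ (λ _ → Empty) σ k w Q d → x ∈ Q ⊎ y ∈ Q → 1 ≤ d y + d x
        pays {Q = Q} {d} Λ (inj₁ x∈) = ℕₚ.≤-trans (subst (_≤ d x) (indicator-∈ x∈) (own Λ x ntx)) (ℕₚ.m≤n+m _ _)
        pays {Q = Q} {d} Λ (inj₂ y∈) = ℕₚ.≤-trans (subst (_≤ d y) (indicator-∈ y∈) (own Λ y nty)) (ℕₚ.m≤m+n _ _)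

    fallback-closing zero σ k fits k< ntx _ = contradiction fits (¬nt-size0 {σ} ntx)
    fallback-closing (suc fuel) σ k fits k< {x} ntx must =
      ask x (λ v → proj₁ (rec v)) , Solves-ask {σ} (λ v → proj₁ (rec v)) (λ v → proj₁ (proj₂ (rec v))) ,
      λ ŵ w Q d w∈ feas Λ →
        close-bound {σ} {k} {d} ntx (k< x)
          ([ (λ x∈ → subst (_≤ d x) (indicator-∈ x∈) (own Λ x ntx)) , paid Λ x ntx ]′ (must w Q w∈ feas))
          (proj₂ (proj₂ (rec (w x))) ŵ w Q d (∈ˢ-fix x w∈) (Feas-fix {σ} w∈ feas) (Ledger-fix {σ = σ} id Λ))
      where
      rec : ∀ v → ∃ (Fallback (fix σ x v) k)
      rec v = fallback fuel (fix σ x v) k (size-fix {σ} ntx fits) k<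

    -- Strategies that follow the predictions

    module Planning (ŵ : Weights) where

      -- `N` counts the rounds; `Planned` bounds it by the size of every set feasible for `ŵ`. In
      -- `consistent` the charges serve as the potential of an amortised count, in `robust` as costs
      -- still to be settled.
      record Strategy (ℋ : Weights → Subset m → Set) (Y : Fin m → Set) (N : ℕ) (σ : State m) (k : Fin m → ℕ) : Set where
        field
          tree       : Tree m
          solves     : Solves σ tree
          robust     : Robust ŵ ℋ Y σ k tree
          consistent : ŵ ∈ˢ σ → γ * length (path tree ŵ) ≤ suc γ * N + total σ k
      open Strategy

      module Guarded (σ : State m) (x : Fin m) (k : Fin m → ℕ) (k< : ∀ y → k y < γ) (right : Tree m) where

        wrong : ∀ v → ∃ (Fallback (fix σ x v) k)
        wrong v = fallback (size (fix σ x v)) (fix σ x v) k ℕₚ.≤-refl k<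

        branch : ℚ → Tree m
        branch v = case v ℚₚ.≟ ŵ x of λ { (yes _) → right ; (no _) → proj₁ (wrong v) }

        branch-right : branch (ŵ x) ≡ right
        branch-right with ŵ x ℚₚ.≟ ŵ x
        ... | yes _ = refl
        ... | no ne = contradiction refl ne

        branch-solves : Solves (fix σ x (ŵ x)) right → ∀ v → Solves (fix σ x v) (branch v)
        branch-solves s v with v ℚₚ.≟ ŵ x
        ... | yes refl = s
        ... | no _ = proj₁ (proj₂ (wrong v))

        branch-length : ∀ {w Q d Y} → w ∈ˢ σ → Feas σ w Q → Ledger ŵ Y (fix σ x (w x)) k w Q d →
          (A : ℕ → Set) → (w x ≡ ŵ x → A (length (path right w))) →
          (∀ {l} → Bound (fix σ x (w x)) k d l → A l) → A (length (path (branch (w x)) w))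
        branch-length {w} {Q} {d} w∈ feas Λ A yes-case no-case with w x ℚₚ.≟ ŵ x
        ... | yes eq = yes-case eq
        ... | no _ = no-case (proj₂ (proj₂ (wrong (w x))) ŵ w Q d (∈ˢ-fix x w∈) (Feas-fix {σ} w∈ feas)
                       record { own = own Λ ; paid = paid Λ ; trust = λ _ _ () })

      module _ {ℋ ℋ′ : Weights → Subset m → Set} {Y Y′ : Fin m → Set} {σ : State m} {k : Fin m → ℕ} {N : ℕ}
               (k< : ∀ y → k y < γ) (ℋ⇒Feas : ∀ w Q → w ∈ˢ σ → ℋ w Q → Feas σ w Q)
               {x : Fin m} (ntx : nt σ x) (⊆Y : ∀ {z} → Y′ z → Y z) where

        ask-consistent : ∀ {σ′ : State m} {k′ : Fin m → ℕ} (t : ℚ → Tree m) → total σ′ k′ ≤ suc (total σ k) →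
          γ * length (path (t (ŵ x)) ŵ) ≤ suc γ * N + total σ′ k′ →
          γ * length (path (ask x t) ŵ) ≤ suc γ * suc N + total σ k
        ask-consistent {σ′} {k′} t le c = begin
          γ * suc l                          ≡⟨ ℕₚ.*-suc γ l ⟩
          γ + γ * l                          ≤⟨ ℕₚ.+-monoʳ-≤ γ c ⟩
          γ + (suc γ * N + total σ′ k′)      ≤⟨ ℕₚ.+-monoʳ-≤ γ (ℕₚ.+-monoʳ-≤ (suc γ * N) le) ⟩
          γ + (suc γ * N + suc (total σ k))  ≡⟨ regroup γ N (total σ k) ⟩
          suc γ * suc N + total σ k          ∎
          where
          open ℕₚ.≤-Reasoning
          l = length (path (t (ŵ x)) ŵ)
          regroup : ∀ γ N s → γ + (suc γ * N + suc s) ≡ suc γ * suc N + s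
          regroup = solve-∀

        closing : (∀ w Q → w ∈ˢ σ → ℋ w Q → x ∈ Q ⊎ 1 ≤ k x) →
                  (∀ w Q → w ∈ˢ σ → w x ≡ ŵ x → ℋ w Q → ℋ′ w Q) →
                  Strategy ℋ′ Y′ N (fix σ x (ŵ x)) k → Strategy ℋ Y (suc N) σ k
        closing must ℋ⇒ S = record
          { tree = ask x branch
          ; solves = Solves-ask {σ} branch (branch-solves (solves S))
          ; robust = λ w Q d w∈ h Λ →
              close-bound {σ} {k} {d} {x} {w x} ntx (k< x)
                ([ (λ x∈ → subst (_≤ d x) (indicator-∈ x∈) (own Λ x ntx)) , paid Λ x ntx ]′ (must w Q w∈ h))
                (branch-length {Q = Q} {d} w∈ (ℋ⇒Feas w Q w∈ h) (Ledger-fix {σ = σ} {x = x} {w x} ⊆Y Λ) (Bound (fix σ x (w x)) k d)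
                  (λ eq → subst (λ v → Bound (fix σ x v) k d (length (path (tree S) w))) (sym eq)
                    (robust S w Q d (subst (λ v → w ∈ˢ fix σ x v) eq (∈ˢ-fix x w∈)) (ℋ⇒ w Q w∈ eq h)
                      (Ledger-fix {σ = σ} ⊆Y Λ)))
                  id)
          ; consistent = λ ŵ∈ → ask-consistent {fix σ x (ŵ x)} {k} branch
              (ℕₚ.m≤n⇒m≤1+n (ℕₚ.≤-trans (ℕₚ.m≤n+m _ (k x)) (ℕₚ.≤-reflexive (sym (total-fix {σ = σ} k (ŵ x) ntx)))))
              (subst (λ t → γ * length (path t ŵ) ≤ suc γ * N + total (fix σ x (ŵ x)) k) (sym branch-right)
                (consistent S (∈ˢ-fix x ŵ∈))) }
          where open Guarded σ x k k< (tree S)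

        module _ {y : Fin m} (nty : nt σ y) (x≢y : x ≢ y) (wit : ∀ w Q → w ∈ˢ σ → ℋ w Q → x ∈ Q ⊎ y ∈ Q) (kx≡0 : k x ≡ 0) where

          joining : suc (k y) < γ → (Y′ y → ∀ w Q → w ∈ˢ σ → ℋ w Q → w y ≡ ŵ y → x ∈ Q) →
                    (∀ w Q → w ∈ˢ σ → w x ≡ ŵ x → ℋ w Q → ℋ′ w Q) →
                    Strategy ℋ′ Y′ N (fix σ x (ŵ x)) (bump k y 1) → Strategy ℋ Y (suc N) σ k
          joining room forced ℋ⇒ S = record
            { tree = ask x branch
            ; solves = Solves-ask {σ} branch (branch-solves (solves S))
            ; robust = λ w Q d w∈ h Λ → let
                d′ = bump d y ([ Q ∈?]ℕ x)
                Λ′ : ∀ {v} → Ledger ŵ Y′ (fix σ x v) (bump k y 1) w Q d′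
                Λ′ = Ledger-join {σ = σ} nty (wit w Q w∈ h) ⊆Y (λ Yy → forced Yy w Q w∈ h) Λ in
                join-bound {σ} {k} {d} {x} {y} {w x} ntx nty x≢y kx≡0 (own Λ x ntx)
                  (branch-length {Q = Q} {d′} w∈ (ℋ⇒Feas w Q w∈ h) (Λ′ {w x}) (Bound (fix σ x (w x)) (bump k y 1) d′)
                    (λ eq → subst (λ v → Bound (fix σ x v) (bump k y 1) d′ (length (path (tree S) w))) (sym eq)
                      (robust S w Q d′ (subst (λ v → w ∈ˢ fix σ x v) eq (∈ˢ-fix x w∈)) (ℋ⇒ w Q w∈ eq h) Λ′))
                    id)
            ; consistent = λ ŵ∈ → ask-consistent {fix σ x (ŵ x)} {bump k y 1} branch
                (ℕₚ.≤-trans (ℕₚ.≤-reflexive (total-bump {σ = fix σ x (ŵ x)} k 1 (nontrivial-fix {σ = σ} nty (x≢y ∘ sym))))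
                  (s≤s (ℕₚ.≤-trans (ℕₚ.m≤n+m _ (k x)) (ℕₚ.≤-reflexive (sym (total-fix {σ = σ} k (ŵ x) ntx))))))
                (subst (λ t → γ * length (path t ŵ) ≤ suc γ * N + total (fix σ x (ŵ x)) (bump k y 1)) (sym branch-right)
                  (consistent S (∈ˢ-fix x ŵ∈))) }
            where
            bump< : ∀ z → bump k y 1 z < γ
            bump< z with z ≟ y
            ... | yes refl = room
            ... | no _ = k< z
            open Guarded σ x (bump k y 1) bump< (tree S)

          -- If `y` is predicted correctly, `trust` shows that `Q` pays for all γ - 1 queries
          -- charged to it, and the witness pair adds one: payments of at least γ face only γ + 1
          -- queries. For consistency the two queries cost 2γ, which is the γ + 1 of the round plus
          -- the γ - 1 saved at `y`.
          flushing : suc (k y) ≡ γ → Y y →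
                     (∀ w Q → w ∈ˢ σ → w y ≡ ŵ y → w x ≡ ŵ x → ℋ w Q → ℋ′ w Q) →
                     Strategy ℋ′ Y′ N (fix (fix σ y (ŵ y)) x (ŵ x)) k → Strategy ℋ Y (suc N) σ k
          flushing full Yy ℋ⇒ S = record
            { tree = ask y O.branch
            ; solves = Solves-ask {σ} O.branch (O.branch-solves (Solves-ask {σ₁} I.branch (I.branch-solves (solves S))))
            ; robust = rob
            ; consistent = cons }
            where
            σ₁ = fix σ y (ŵ y)
            module I = Guarded σ₁ x k k< (tree S)
            module O = Guarded σ y k k< (ask x I.branch)
            ntx₁ : ∀ {v} → nt (fix σ y v) x
            ntx₁ = nontrivial-fix {σ = σ} ntx x≢y

            enough : ∀ {w Q d} → Ledger ŵ Y σ k w Q d → w y ≡ ŵ y → x ∈ Q ⊎ y ∈ Q → 2 + (k y + k x) ≤ γ * (d y + d x)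
            enough {w} {Q} {d} Λ wy x∨y = begin
              2 + (k y + k x)    ≡⟨ cong (λ a → 2 + (k y + a)) kx≡0 ⟩
              2 + (k y + 0)      ≡⟨ cong (2 +_) (ℕₚ.+-identityʳ (k y)) ⟩
              suc (suc (k y))    ≡⟨ cong suc full ⟩
              suc γ              ≤⟨ ℕₚ.+-monoˡ-≤ γ (ℕₚ.<⇒≤ 2≤γ) ⟩
              γ + γ              ≡⟨ double γ ⟩
              γ * 2              ≤⟨ ℕₚ.*-monoʳ-≤ γ 2≤γ ⟩
              γ * γ              ≤⟨ ℕₚ.*-monoʳ-≤ γ γ≤ ⟩
              γ * (d y + d x)    ∎
              where
              open ℕₚ.≤-Reasoning
              double : ∀ γ → γ + γ ≡ γ * 2
              double = solve-∀
              regroup : ∀ k p q → k + p + q ≡ k + (p + q)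
              regroup = solve-∀
              1≤ : 1 ≤ [ Q ∈?]ℕ y + [ Q ∈?]ℕ x
              1≤ = [ (λ x∈ → ℕₚ.≤-trans (ℕₚ.≤-reflexive (sym (indicator-∈ x∈))) (ℕₚ.m≤n+m _ ([ Q ∈?]ℕ y)))
                   , (λ y∈ → ℕₚ.≤-trans (ℕₚ.≤-reflexive (sym (indicator-∈ y∈))) (ℕₚ.m≤m+n _ _)) ]′ x∨y
              γ≤ : γ ≤ d y + d x
              γ≤ = begin
                γ                                      ≡⟨ trans (sym full) (ℕₚ.+-comm 1 (k y)) ⟩
                k y + 1                                ≤⟨ ℕₚ.+-monoʳ-≤ (k y) 1≤ ⟩
                k y + ([ Q ∈?]ℕ y + [ Q ∈?]ℕ x)        ≡⟨ sym (regroup (k y) _ _) ⟩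
                k y + [ Q ∈?]ℕ y + [ Q ∈?]ℕ x          ≤⟨ ℕₚ.+-mono-≤ (trust Λ y nty Yy wy) (own Λ x ntx) ⟩
                d y + d x                              ∎

            rob : Robust ŵ ℋ Y σ k (ask y O.branch)
            rob w Q d w∈ h Λ = O.branch-length {Q = Q} {d} w∈ feas (Ledger-fix {σ = σ} {x = y} {w y} ⊆Y Λ) (Bound σ k d ∘ suc)
              (λ eq → let w∈₁ = subst (λ v → w ∈ˢ fix σ y v) eq (∈ˢ-fix y w∈)
                          Λ₁ = Ledger-fix {σ = σ} {x = y} {ŵ y} ⊆Y Λ in
                two-bound {σ} {k} {d} {x} {y} {ŵ y} {w x} nty ntx x≢y (enough Λ eq (wit w Q w∈ h))
                  (I.branch-length {Q = Q} {d} w∈₁ (Feas-fix≡ {σ} eq w∈ feas) (Ledger-fix {σ = σ₁} {x = x} {w x} id Λ₁)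
                    (Bound (fix σ₁ x (w x)) k d)
                    (λ eqx → subst (λ v → Bound (fix σ₁ x v) k d (length (path (tree S) w))) (sym eqx)
                      (robust S w Q d (subst (λ v → w ∈ˢ fix σ₁ x v) eqx (∈ˢ-fix x w∈₁)) (ℋ⇒ w Q w∈ eq eqx h)
                        (Ledger-fix {σ = σ₁} id Λ₁)))
                    id))
              -- A wrong `y`: since γ ≥ 2, it carries at least one charge, so `Q` pays for it, and
              -- this settles γ queries in all.
              (close-bound {σ} {k} {d} {y} {w y} nty (k< y)
                (paid Λ y nty (ℕₚ.≤-pred (subst (2 ≤_) (sym full) 2≤γ))))
              where feas = ℋ⇒Feas w Q w∈ h

            cons : ŵ ∈ˢ σ → γ * length (path (ask y O.branch) ŵ) ≤ suc γ * suc N + total σ k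
            cons ŵ∈ rewrite O.branch-right | I.branch-right = begin
              γ * suc (suc l)                       ≡⟨ regroup₁ γ l ⟩
              γ + γ + γ * l                         ≤⟨ ℕₚ.+-monoʳ-≤ (γ + γ) (consistent S (∈ˢ-fix x (∈ˢ-fix y ŵ∈))) ⟩
              γ + γ + (suc γ * N + total σ₂ k)      ≡⟨ cong (λ a → γ + a + (suc γ * N + total σ₂ k)) (sym full) ⟩
              γ + suc (k y) + (suc γ * N + total σ₂ k) ≡⟨ regroup₂ γ N (k y) (total σ₂ k) ⟩
              suc γ * suc N + (k y + total σ₂ k)    ≤⟨ ℕₚ.+-monoʳ-≤ (suc γ * suc N) (ℕₚ.+-monoʳ-≤ (k y) (ℕₚ.m≤n+m _ (k x))) ⟩
              suc γ * suc N + (k y + (k x + total σ₂ k))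
                ≡⟨ cong (λ a → suc γ * suc N + (k y + a)) (sym (total-fix {σ = σ₁} k (ŵ x) ntx₁)) ⟩
              suc γ * suc N + (k y + total σ₁ k)
                ≡⟨ cong (suc γ * suc N +_) (sym (total-fix {σ = σ} k (ŵ y) nty)) ⟩
              suc γ * suc N + total σ k             ∎
              where
              open ℕₚ.≤-Reasoning
              σ₂ = fix σ₁ x (ŵ x)
              l = length (path (tree S) ŵ)
              regroup₁ : ∀ γ l → γ * suc (suc l) ≡ γ + γ + γ * l
              regroup₁ = solve-∀
              regroup₂ : ∀ γ N k s → γ + suc k + (suc γ * N + s) ≡ suc γ * suc N + (k + s)
              regroup₂ = solve-∀

      ∈ˢ-fix≡ : ∀ {w : Weights} {σ : State m} {x v} → w x ≡ v → w ∈ˢ σ → w ∈ˢ fix σ x v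
      ∈ˢ-fix≡ {x = x} refl = ∈ˢ-fix x

      -- In flush, y already carries γ − 1 charges; it is queried before x, and if its prediction
      -- is correct then all edges charged to it were mandatory.
      data Next (σ : State m) (k : Fin m → ℕ) (x y : Fin m) : State m → (Fin m → ℕ) → Set where
        close : 1 ≤ k x → Next σ k x y (fix σ x (ŵ x)) k
        join  : k x ≡ 0 → suc (k y) < γ → Next σ k x y (fix σ x (ŵ x)) (bump k y 1)
        flush : k x ≡ 0 → suc (k y) ≡ γ → Next σ k x y (fix (fix σ y (ŵ y)) x (ŵ x)) k

      next : ∀ σ k x y → (∀ z → k z < γ) → ∃ λ σ′ → ∃ λ k′ → Next σ k x y σ′ k′
      next σ k x y k< with 1 ℕ.≤? k x | suc (k y) ℕₚ.≟ γ
      ... | yes 1≤ | _ = _ , _ , close 1≤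
      ... | no ¬1≤ | yes full = _ , _ , flush (ℕₚ.n<1⇒n≡0 (ℕₚ.≰⇒> ¬1≤)) full
      ... | no ¬1≤ | no ¬full = _ , _ , join (ℕₚ.n<1⇒n≡0 (ℕₚ.≰⇒> ¬1≤)) (ℕₚ.≤∧≢⇒< (k< y) ¬full)

      next-k< : ∀ {σ k x y σ′ k′} → Next σ k x y σ′ k′ → (∀ z → k z < γ) → ∀ z → k′ z < γ
      next-k< (close _) k< = k<
      next-k< (flush _ _) k< = k<
      next-k< {y = y} (join _ room) k< z with z ≟ y
      ... | yes refl = room
      ... | no _ = k< z

      next-ŵ∈ : ∀ {σ k x y σ′ k′} → Next σ k x y σ′ k′ → ŵ ∈ˢ σ → ŵ ∈ˢ σ′
      next-ŵ∈ {x = x} (close _) ŵ∈ = ∈ˢ-fix x ŵ∈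
      next-ŵ∈ {x = x} (join _ _) ŵ∈ = ∈ˢ-fix x ŵ∈
      next-ŵ∈ {x = x} {y} (flush _ _) ŵ∈ = ∈ˢ-fix x (∈ˢ-fix y ŵ∈)

      next-nt : ∀ {σ k x y σ′ k′} → Next σ k x y σ′ k′ → ∀ {z} → nt σ z → z ≢ x → z ≢ y → nt σ′ z
      next-nt {σ} (close _) ntz z≢x _ = nontrivial-fix {σ = σ} ntz z≢x
      next-nt {σ} (join _ _) ntz z≢x _ = nontrivial-fix {σ = σ} ntz z≢x
      next-nt {σ} {y = y} (flush _ _) ntz z≢x z≢y = nontrivial-fix {σ = fix σ y (ŵ y)} (nontrivial-fix {σ = σ} ntz z≢y) z≢x

      next-Feas : ∀ {σ k x y σ′ k′} → Next σ k x y σ′ k′ → ∀ {Q} → ŵ ∈ˢ σ → Feas σ ŵ (⁅ x ⁆ ∪ Q) → Feas σ′ ŵ Q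
      next-Feas {σ} (close _) ŵ∈ feas = Feas-refix {σ} feas
      next-Feas {σ} (join _ _) ŵ∈ feas = Feas-refix {σ} feas
      next-Feas {σ} {y = y} (flush _ _) ŵ∈ feas = Feas-refix {fix σ y (ŵ y)} (Feas-fix {σ} ŵ∈ feas)

      module _ {σ : State m} {k : Fin m → ℕ} {x y : Fin m} (ntx : nt σ x) (nty : nt σ y) (x≢y : x ≢ y) where

        next-total : ∀ {σ′ k′} → Next σ k x y σ′ k′ → ∀ f → f x + total σ′ f ≤ total σ f
        next-total (close _) f = ℕₚ.≤-reflexive (sym (total-fix {σ = σ} f (ŵ x) ntx))
        next-total (join _ _) f = ℕₚ.≤-reflexive (sym (total-fix {σ = σ} f (ŵ x) ntx))
        next-total (flush _ _) f =
          ℕₚ.≤-trans (ℕₚ.≤-reflexive (sym (total-fix {σ = fix σ y (ŵ y)} f (ŵ x) (nontrivial-fix {σ = σ} ntx x≢y))))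
            (ℕₚ.≤-trans (ℕₚ.m≤n+m _ (f y)) (ℕₚ.≤-reflexive (sym (total-fix {σ = σ} f (ŵ y) nty))))

        serve : ∀ {σ′ k′ ℋ ℋ′ Y Y′ N} → Next σ k x y σ′ k′ →
                (∀ z → k z < γ) → (∀ w Q → w ∈ˢ σ → ℋ w Q → Feas σ w Q) →
                (∀ w Q → w ∈ˢ σ → ℋ w Q → x ∈ Q ⊎ y ∈ Q) → Y y →
                (∀ {z} → Y′ z → Y z) → (Y′ y → ∀ w Q → w ∈ˢ σ → ℋ w Q → w y ≡ ŵ y → x ∈ Q) →
                (∀ w Q → w x ≡ ŵ x → ℋ w Q → Feas σ′ w Q → ℋ′ w Q) →
                Strategy ℋ′ Y′ N σ′ k′ → Strategy ℋ Y (suc N) σ k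
        serve (close 1≤) k< ℋ⇒Feas wit Yy ⊆Y forced ℋ⇒ S = closing k< ℋ⇒Feas ntx ⊆Y (λ _ _ _ _ → inj₂ 1≤)
          (λ w Q w∈ eq h → ℋ⇒ w Q eq h (Feas-fix≡ {σ} eq w∈ (ℋ⇒Feas w Q w∈ h))) S
        serve (join kx room) k< ℋ⇒Feas wit Yy ⊆Y forced ℋ⇒ S = joining k< ℋ⇒Feas ntx ⊆Y nty x≢y wit kx room forced
          (λ w Q w∈ eq h → ℋ⇒ w Q eq h (Feas-fix≡ {σ} eq w∈ (ℋ⇒Feas w Q w∈ h))) S
        serve (flush kx full) k< ℋ⇒Feas wit Yy ⊆Y forced ℋ⇒ S = flushing k< ℋ⇒Feas ntx ⊆Y nty x≢y wit kx full Yy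
          (λ w Q w∈ eqy eq h → ℋ⇒ w Q eq h
            (Feas-fix≡ {fix σ y (ŵ y)} eq (∈ˢ-fix≡ eqy w∈) (Feas-fix≡ {σ} eqy w∈ (ℋ⇒Feas w Q w∈ h)))) S

      Partners : List (Edge m) → Fin m → Set
      Partners ps z = z ∈ₗ List.map proj₂ ps

      Nontrivial : State m → Edge m → Set
      Nontrivial σ (x , y) = nt σ x × nt σ y × x ≢ y

      next-nts : ∀ {σ k x y σ′ k′ ps} → Next σ k x y σ′ k′ → All (Disjoint (x , y)) ps →
                 All (Nontrivial σ) ps → All (Nontrivial σ′) ps
      next-nts nx [] [] = []
      next-nts nx ((ac , ad , bc , bd) ∷ ds) ((nta , ntb , a≢b) ∷ nts) =
        (next-nt nx nta (ac ∘ sym) (bc ∘ sym) , next-nt nx ntb (ad ∘ sym) (bd ∘ sym) , a≢b) ∷ next-nts nx ds nts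

      -- In a matched pair a correct `y` need not force `x`, so trust in `y` ends with its own
      -- charge. By disjointness `y` is no later partner, hence trusting the `Partners` of the
      -- remaining pairs suffices.
      run : ∀ ps {σ k ℋ} → All (Nontrivial σ) ps → AllPairs Disjoint ps → Chain ŵ ℋ ps →
            ŵ ∈ˢ σ → (∀ z → k z < γ) → Feas σ ŵ (toSubset (List.map proj₁ ps)) →
            Strategy (λ w Q → ℋ w Q × Feas σ w Q) (Partners ps) (length ps) σ k
      -- The empty set is feasible for `ŵ` and reveals nothing, so the same tree is certified for
      -- every `w`.
      run [] {σ} nts disj chain ŵ∈ k< (T , opt) = record
        { tree = done
        ; solves = λ w w∈ → T , Optimal-≗ {reveal σ ⊥ ŵ} (λ e → trans (reveal-∉ σ {w = ŵ} ∉⊥) (sym (reveal-∉ σ {w = w} ∉⊥))) opt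
        ; robust = λ w Q d w∈ h Λ → done-bound k< Λ
        ; consistent = λ _ → ℕₚ.≤-trans (ℕₚ.≤-reflexive (ℕₚ.*-zeroʳ γ)) z≤n }
      run ((x , y) ∷ ps) {σ} {k} {ℋ} ((ntx , nty , x≢y) ∷ nts) (d ∷ disj) (wit , chain) ŵ∈ k< feas
        with next σ k x y k<
      ... | σ′ , k′ , nx =
        serve {σ} {k} ntx nty x≢y {Y = Partners ((x , y) ∷ ps)} {Y′ = Partners ps} nx k< (λ _ _ _ → proj₂)
          (λ w Q _ → wit w Q ∘ proj₁) (here refl) there
          (λ y∈ → contradiction y∈ y∉)
          (λ w Q eq (h , _) feas′ → (h , eq) , feas′)
          (run ps (next-nts nx d nts) disj chain (next-ŵ∈ nx ŵ∈) (next-k< nx k<) (next-Feas nx ŵ∈ feas))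
        where
        y∉ : ¬ Partners ps y
        y∉ y∈ with ∈-map⁻ proj₂ y∈
        ... | q , q∈ , refl = proj₂ (proj₂ (proj₂ (All.lookup d q∈))) refl

      -- With `ŵ` as the realisation the conditions on earlier queries hold by `refl`, and disjoint
      -- witness pairs need distinct members of `Q`.
      chain-count : ∀ ps {σ ℋ Q} → All (Nontrivial σ) ps → AllPairs Disjoint ps → Chain ŵ ℋ ps → ℋ ŵ Q →
                    length ps ≤ total σ ([ Q ∈?]ℕ)
      chain-count [] _ _ _ _ = z≤n
      chain-count ((x , y) ∷ ps) {σ} {ℋ} {Q} ((ntx , nty , x≢y) ∷ nts) (d ∷ disj) (wit , chain) h = begin
        suc (length ps)                       ≤⟨ ℕₚ.+-mono-≤ met (chain-count ps (nts₂ d nts) disj chain (h , refl)) ⟩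
        q y + q x + total σ₂ q                ≡⟨ ℕₚ.+-assoc (q y) _ _ ⟩
        q y + (q x + total σ₂ q)              ≡⟨ cong (q y +_) (sym (total-fix {σ = fix σ y (ŵ y)} q (ŵ x) (nontrivial-fix {σ = σ} ntx x≢y))) ⟩
        q y + total (fix σ y (ŵ y)) q         ≡⟨ sym (total-fix {σ = σ} q (ŵ y) nty) ⟩
        total σ q                             ∎
        where
        open ℕₚ.≤-Reasoning
        q = [ Q ∈?]ℕ
        σ₂ = fix (fix σ y (ŵ y)) x (ŵ x)
        met : 1 ≤ q y + q x
        met = [ (λ x∈ → ℕₚ.≤-trans (ℕₚ.≤-reflexive (sym (indicator-∈ x∈))) (ℕₚ.m≤n+m _ (q y)))
              , (λ y∈ → ℕₚ.≤-trans (ℕₚ.≤-reflexive (sym (indicator-∈ y∈))) (ℕₚ.m≤m+n _ _)) ]′ (wit ŵ Q h)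
        nts₂ : ∀ {ps} → All (Disjoint (x , y)) ps → All (Nontrivial σ) ps → All (Nontrivial σ₂) ps
        nts₂ [] [] = []
        nts₂ ((ac , ad , bc , bd) ∷ ds) ((nta , ntb , a≢b) ∷ nts) =
          (fix₂ nta (ac ∘ sym) (bc ∘ sym) , fix₂ ntb (ad ∘ sym) (bd ∘ sym) , a≢b) ∷ nts₂ ds nts
          where
          fix₂ : ∀ {z} → nt σ z → z ≢ x → z ≢ y → nt σ₂ z
          fix₂ ntz z≢x z≢y = nontrivial-fix {σ = fix σ y (ŵ y)} (nontrivial-fix {σ = σ} ntz z≢y) z≢x

      Everywhere : Fin m → Set
      Everywhere _ = ⊤

      Planned : State m → (Fin m → ℕ) → Set
      Planned σ k = ∃ λ N → (∀ Q → Feas σ ŵ Q → N ≤ total σ ([ Q ∈?]ℕ)) × Strategy (Feas σ) Everywhere N σ k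

      -- Before the calm case each round has an edge `x` that lies in every set feasible for `ŵ`,
      -- being mandatory or forced by `y`. This is what makes `N` a lower bound; the extra query of
      -- a flush is not counted in it.
      plan : ∀ fuel σ k → size σ ≤ fuel → ŵ ∈ˢ σ → (∀ z → k z < γ) → Planned σ k
      plan fuel σ k fits ŵ∈ k< with tame-or-mandatory σ T₀∈
      plan zero σ k fits ŵ∈ k< | inj₁ (x , ntx , _) = contradiction fits (¬nt-size0 {σ} ntx)
      plan (suc fuel) σ k fits ŵ∈ k< | inj₁ (x , ntx , mand)
        with plan fuel (fix σ x (ŵ x)) k (size-fix {σ} ntx fits) (∈ˢ-fix x ŵ∈) k<
      ... | N , N≤ , S = suc N ,
        (λ Q feas → ℕₚ.≤-trans (ℕₚ.+-mono-≤ (ℕₚ.≤-reflexive (sym (indicator-∈ (mand ŵ Q ŵ∈ feas)))) (N≤ Q (Feas-fix {σ} ŵ∈ feas)))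
          (ℕₚ.≤-reflexive (sym (total-fix {σ = σ} ([ Q ∈?]ℕ) (ŵ x) ntx)))) ,
        closing k< (λ _ _ _ → id) ntx id (λ w Q w∈ feas → inj₁ (mand w Q w∈ feas))
          (λ w Q w∈ eq → Feas-fix≡ {σ} eq w∈) S
      plan fuel σ k fits ŵ∈ k< | inj₂ (T , tame) with forcing-or-calm σ tame ŵ∈
      plan fuel σ k fits ŵ∈ k< | inj₂ (T , tame) | inj₂ calm =
        length pairs , (λ Q feas → chain-count pairs nts disjoint chain (ŵ∈ , feas)) , record
          { tree = tree S ; solves = solves S ; consistent = consistent S
          ; robust = λ w Q d w∈ feas Λ → robust S w Q d w∈ ((w∈ , feas) , feas)
              record { own = own Λ ; paid = paid Λ ; trust = λ y nty _ → trust Λ y nty tt } }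
        where
        open Schedule (schedule ŵ∈ tame calm)
        open Strategy
        S = run pairs nts disjoint chain ŵ∈ k< feasible
      plan zero σ k fits ŵ∈ k< | inj₂ (T , tame) | inj₁ (y , x , F) = contradiction fits (¬nt-size0 {σ} (Forces.nt-x F))
      plan (suc fuel) σ k fits ŵ∈ k< | inj₂ (T , tame) | inj₁ (y , x , F) with next σ k x y k<
      ... | σ′ , k′ , nx with plan fuel σ′ k′
          (ℕₚ.≤-pred (ℕₚ.≤-trans (next-total {σ} (Forces.nt-x F) (Forces.nt-y F) (Forces.x≢y F) nx (λ _ → 1)) fits))
          (next-ŵ∈ nx ŵ∈) (next-k< nx k<)
      ...   | N , N≤ , S = suc N ,
        (λ Q feas → ℕₚ.≤-trans (ℕₚ.+-mono-≤ (ℕₚ.≤-reflexive (sym (indicator-∈ (forced ŵ Q ŵ∈ feas refl))))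
            (N≤ Q (next-Feas nx ŵ∈ (Feas-mono {σ} ŵ∈ (q⊆p∪q ⁅ x ⁆ Q) feas))))
          (next-total {σ} nt-x nt-y x≢y nx ([ Q ∈?]ℕ))) ,
        serve {σ} {k} nt-x nt-y x≢y nx k< (λ _ _ _ → id) witness tt id (λ _ → forced) (λ _ _ _ _ feas → feas) S
        where open Forces F

-- Spanning trees

module Graph (P : Instance) where

  private
    V = Fin (n P)
    E = Fin (m P)

  reach-trans : ∀ {S u v x} → Reach P S u v → Reach P S v x → Reach P S u x
  reach-trans (here _) r = r
  reach-trans (step e e∈ adj r) r′ = step e e∈ adj (reach-trans r r′)

  reach-sym : ∀ {S u v} → Reach P S u v → Reach P S v u
  reach-sym (here v) = here v
  reach-sym (step e e∈ adj r) = reach-trans (reach-sym r) (step e e∈ (Sum.swap (Sum.map Product.swap Product.swap adj)) (here _))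

  reach-mono : ∀ {S S′ u v} → (∀ {e} → e ∈ S → e ∈ S′) → Reach P S u v → Reach P S′ u v
  reach-mono S⊆ (here v) = here v
  reach-mono S⊆ (step e e∈ adj r) = step e (S⊆ e∈) adj (reach-mono S⊆ r)

  Joined : Subset (m P) → E → Set
  Joined S e = Reach P S (src P e) (tgt P e)

  edge-joined : ∀ {S e} → e ∈ S → Joined S e
  edge-joined {e = e} e∈ = step e e∈ (inj₁ (refl , refl)) (here _)

  -- What remains of a walk through `e` after cutting it at its first and last use of `e`.
  Through : Subset (m P) → E → V → V → Set
  Through S e u v = Reach P S u (src P e) × Reach P S (tgt P e) v
                  ⊎ Reach P S u (tgt P e) × Reach P S (src P e) v

  reach-del : ∀ {S u v} e → Reach P S u v → Reach P (del S e) u v ⊎ Through (del S e) e u v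
  reach-del e (here v) = inj₁ (here v)
  reach-del {S} e (step e′ e′∈ adj r) with e′ ≟ e | reach-del e r
  ... | no e′≢e | inj₁ r′ = inj₁ (step e′ (∈-del⁺ e′∈ e′≢e) adj r′)
  ... | no e′≢e | inj₂ (inj₁ (p , q)) = inj₂ (inj₁ (step e′ (∈-del⁺ e′∈ e′≢e) adj p , q))
  ... | no e′≢e | inj₂ (inj₂ (p , q)) = inj₂ (inj₂ (step e′ (∈-del⁺ e′∈ e′≢e) adj p , q))
  reach-del e (step .e e∈ (inj₁ (refl , refl)) r) | yes refl | inj₁ r′ = inj₂ (inj₁ (here _ , r′))
  reach-del e (step .e e∈ (inj₁ (refl , refl)) r) | yes refl | inj₂ (inj₁ (p , q)) = inj₂ (inj₁ (here _ , q))
  reach-del e (step .e e∈ (inj₁ (refl , refl)) r) | yes refl | inj₂ (inj₂ (p , q)) = inj₁ q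
  reach-del e (step .e e∈ (inj₂ (refl , refl)) r) | yes refl | inj₁ r′ = inj₂ (inj₂ (here _ , r′))
  reach-del e (step .e e∈ (inj₂ (refl , refl)) r) | yes refl | inj₂ (inj₁ (p , q)) = inj₁ q
  reach-del e (step .e e∈ (inj₂ (refl , refl)) r) | yes refl | inj₂ (inj₂ (p , q)) = inj₂ (inj₂ (here _ , q))

  through-joined : ∀ {S e u v} → Joined S e → Through S e u v → Reach P S u v
  through-joined j (inj₁ (p , q)) = reach-trans p (reach-trans j q)
  through-joined j (inj₂ (p , q)) = reach-trans p (reach-trans (reach-sym j) q)

  joined-through : ∀ {S e u v} → Reach P S u v → Through S e u v → Joined S e
  joined-through r (inj₁ (p , q)) = reach-trans (reach-sym p) (reach-trans r (reach-sym q))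
  joined-through r (inj₂ (p , q)) = reach-sym (reach-trans (reach-sym p) (reach-trans r (reach-sym q)))

  through-mono : ∀ {S S′ e u v} → (∀ {e} → e ∈ S → e ∈ S′) → Through S e u v → Through S′ e u v
  through-mono S⊆ = Sum.map (Product.map (reach-mono S⊆) (reach-mono S⊆)) (Product.map (reach-mono S⊆) (reach-mono S⊆))

  reach-empty : ∀ {S u v} → ¬ Nonempty S → Reach P S u v → u ≡ v
  reach-empty empty (here _) = refl
  reach-empty empty (step e e∈ _ _) = contradiction (e , e∈) empty

  abstract
    reach? : ∀ S u v → Dec (Reach P S u v)
    reach? S = go ∣ S ∣ S ℕₚ.≤-refl
      where
      go : ∀ fuel S → ∣ S ∣ ≤ fuel → ∀ u v → Dec (Reach P S u v)
      go fuel S le u v with nonempty? S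
      ... | no empty = map′ (λ { refl → here u }) (reach-empty empty) (u ≟ v)
      go zero S le u v | yes (e , e∈) = contradiction (ℕₚ.≤-trans (ℕₚ.≤-reflexive (∣del∣ S e∈)) le) λ ()
      go (suc fuel) S le u v | yes (e , e∈) =
        map′ [ reach-mono del⊆ , through-joined (edge-joined e∈) ∘ through-mono del⊆ ]′ (reach-del e)
          (rec u v ⊎-dec ((rec u (src P e) ×-dec rec (tgt P e) v) ⊎-dec (rec u (tgt P e) ×-dec rec (src P e) v)))
        where
        rec : ∀ u v → Dec (Reach P (del S e) u v)
        rec = go fuel (del S e) (ℕₚ.≤-pred (ℕₚ.≤-trans (ℕₚ.≤-reflexive (∣del∣ S e∈)) le))
        del⊆ : ∀ {x} → x ∈ del S e → x ∈ S
        del⊆ = proj₁ ∘ ∈-del⁻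

  Connects : Subset (m P) → Set
  Connects S = ∀ u v → Reach P S u v

  Independent : Subset (m P) → List V → Set
  Independent S = AllPairs (λ u v → ¬ Reach P S u v)

  -- Deleting an edge separates at most one vertex of an independent set from the rest.
  independent : ∀ S → ∃ λ vs → Independent S vs × n P ≤ length vs + ∣ S ∣
  independent S = go ∣ S ∣ S ℕₚ.≤-refl
    where
    module _ (S : Subset (m P)) (e : E) where
      Away : V → Set
      Away v = ¬ Reach P (del S e) v (src P e)

      away? : ∀ v → Dec (Away v)
      away? v = ¬? (reach? (del S e) v (src P e))

      keep : ∀ {vs} → All Away vs → Independent (del S e) vs → Independent S vs
      keep [] [] = []
      keep (a ∷ as) (i ∷ is) = All.zipWith (λ (b , ¬r) r → [ ¬r , [ (λ (p , _) → a p) , (λ (_ , q) → b (reach-sym q)) ]′ ]′ (reach-del e r)) (as , i) ∷ keep as is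

      filter-length : ∀ {vs} → Independent (del S e) vs → length vs ≤ suc (length (filter away? vs))
      filter-length [] = z≤n
      filter-length {v ∷ vs} (i ∷ is) with reach? (del S e) v (src P e)
      ... | no _ = s≤s (filter-length is)
      ... | yes r = s≤s (ℕₚ.≤-reflexive (cong length (sym (filter-all away? (All.map (λ ¬r r′ → ¬r (reach-trans r (reach-sym r′))) i)))))

    go : ∀ fuel S → ∣ S ∣ ≤ fuel → ∃ λ vs → Independent S vs × n P ≤ length vs + ∣ S ∣
    go fuel S le with nonempty? S
    ... | no empty = allFin (n P) , AllPairs.map (λ u≢v r → u≢v (reach-empty empty r)) (allFin⁺ (n P)) ,
          ℕₚ.≤-trans (ℕₚ.≤-reflexive (sym (length-tabulate {n = n P} id))) (ℕₚ.m≤m+n _ _)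
    go zero S le | yes (e , e∈) = contradiction (ℕₚ.≤-trans (ℕₚ.≤-reflexive (∣del∣ S e∈)) le) λ ()
    go (suc fuel) S le | yes (e , e∈) with go fuel (del S e) (ℕₚ.≤-pred (ℕₚ.≤-trans (ℕₚ.≤-reflexive (∣del∣ S e∈)) le))
    ... | vs , ind , n≤ = filter (away? S e) vs , keep S e (Allₚ.all-filter (away? S e) vs) (AllPairsₚ.filter⁺ (away? S e) ind) , (begin
      n P                                     ≤⟨ n≤ ⟩
      length vs + ∣ del S e ∣                 ≤⟨ ℕₚ.+-monoˡ-≤ _ (filter-length S e ind) ⟩
      suc (length vs′) + ∣ del S e ∣          ≡⟨ sym (ℕₚ.+-suc (length vs′) _) ⟩
      length vs′ + suc ∣ del S e ∣            ≡⟨ cong (length vs′ +_) (∣del∣ S e∈) ⟩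
      length vs′ + ∣ S ∣                      ∎)
      where
      open ℕₚ.≤-Reasoning
      vs′ = filter (away? S e) vs

  -- Two members of the set given by `independent` would not be joined, so it has at most one.
  connects⇒size : ∀ {S} → Connects S → n P ≤ suc ∣ S ∣
  connects⇒size {S} conn with independent S
  ... | [] , _ , n≤ = ℕₚ.m≤n⇒m≤1+n n≤
  ... | _ ∷ [] , _ , n≤ = n≤
  ... | u ∷ v ∷ _ , (¬r ∷ _) ∷ _ , _ = contradiction (conn u v) ¬r

  -- Otherwise the other n - 2 edges of the tree would connect all n vertices.
  tree-separates : ∀ {T e} → SpanningTree P T → e ∈ T → ¬ Joined (del T e) e
  tree-separates {T} {e} (conn , size) e∈ j = ℕₚ.<⇒≱ (ℕₚ.≤-reflexive (trans (cong suc (∣del∣ T e∈)) size))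
    (connects⇒size λ u v → [ id , through-joined j ]′ (reach-del e (conn u v)))

  swap-spanning : ∀ {T e f} → SpanningTree P T → e ∈ T → f ∉ T → ¬ Joined (del T e) f → SpanningTree P (swap T e f)
  swap-spanning {T} {e} {f} (conn , size) e∈ f∉ ¬j =
    (λ u v → [ reach-mono ∈-add⁺ , through-joined e-joined ∘ through-mono ∈-add⁺ ]′ (reach-del e (conn u v))) ,
    trans (cong suc (trans (∣add∣ (del T e) (f∉ ∘ proj₁ ∘ ∈-del⁻)) (∣del∣ T e∈))) size
    where
    e-joined : Joined (swap T e f) e
    e-joined with reach-del e (conn (src P f) (tgt P f))
    ... | inj₁ j = contradiction j ¬j
    ... | inj₂ t = joined-through (edge-joined (∈-add {S = del T e})) (through-mono (∈-add⁺ {S = del T e}) t)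

  abstract
    spanning? : ∀ T → Dec (SpanningTree P T)
    spanning? T = all? (λ u → all? (reach? T u)) ×-dec (suc ∣ T ∣ ℕ.≟ n P)

  -- An edge of the T-path joining the ends of f that leaves the component S of T′ − f.
  crossing : ∀ {T S f} → SpanningTree P T → ¬ Joined S f → ∀ fuel R → ∣ R ∣ ≤ fuel → (∀ {e} → e ∈ R → e ∈ T) →
             Joined R f → ∃ λ e → e ∈ T × ¬ Joined S e × ¬ Joined (del T e) f
  crossing {T} {S} {f} span ¬Sf fuel R le R⊆ j
    with any? (λ e → (e ∈? R) ×-dec reach? (del R e) (src P f) (tgt P f))
  crossing {T} {S} {f} span ¬Sf zero R le R⊆ j | yes (e , e∈ , _) =
    contradiction (ℕₚ.≤-trans (ℕₚ.≤-reflexive (∣del∣ R e∈)) le) λ ()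
  crossing {T} {S} {f} span ¬Sf (suc fuel) R le R⊆ j | yes (e , e∈ , j′) =
    crossing span ¬Sf fuel (del R e) (ℕₚ.≤-pred (ℕₚ.≤-trans (ℕₚ.≤-reflexive (∣del∣ R e∈)) le)) (R⊆ ∘ proj₁ ∘ ∈-del⁻) j′
  -- `R` is now the path in `T` between the ends of `f`. If `S` joined the ends of each of its
  -- edges, it would join those of `f`.
  ... | no minimal with any? (λ e → (e ∈? R) ×-dec ¬? (reach? S (src P e) (tgt P e)))
  ...   | no none = contradiction (follow j) ¬Sf
    where
    S-joined : ∀ e → e ∈ R → Joined S e
    S-joined e e∈ with reach? S (src P e) (tgt P e)
    ... | yes r = r
    ... | no ¬r = contradiction (e , e∈ , ¬r) none
    follow : ∀ {u v} → Reach P R u v → Reach P S u v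
    follow (here v) = here v
    follow (step e e∈ (inj₁ (refl , refl)) r) = reach-trans (S-joined e e∈) (follow r)
    follow (step e e∈ (inj₂ (refl , refl)) r) = reach-trans (reach-sym (S-joined e e∈)) (follow r)
  -- By minimality `e` is needed on the path, so a connection of the ends of `f` avoiding `e` would,
  -- with the rest of the path, join the ends of `e` in the tree without `e`.
  ...   | yes (e , e∈ , ¬Se) = e , R⊆ e∈ , ¬Se , λ T-f → 
    [ (λ j′ → minimal (e , e∈ , j′))
    , (λ t → tree-separates span (R⊆ e∈) (joined-through T-f (through-mono del⊆ t))) ]′ (reach-del e j)
    where
    del⊆ : ∀ {x} → x ∈ del R e → x ∈ del T e
    del⊆ x∈ = ∈-del⁺ (R⊆ (proj₁ (∈-del⁻ x∈))) (proj₂ (∈-del⁻ x∈))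

  abstract
    -- `e` lies on the cycle that `f` closes in `T` and links the two components of `T′` without
    -- `f`, so both swaps give trees.
    exchange : ∀ {T T′} → SpanningTree P T → SpanningTree P T′ → ∀ {f} → f ∈ T′ → f ∉ T →
               ∃ λ e → e ∈ T × e ∉ T′ × SpanningTree P (swap T e f) × SpanningTree P (swap T′ f e)
    exchange {T} {T′} span span′ {f} f∈ f∉ with crossing span (tree-separates span′ f∈) ∣ T ∣ T ℕₚ.≤-refl id (proj₁ span _ _)
    ... | e , e∈ , ¬Se , ¬Tf = e , e∈ , e∉ , swap-spanning span e∈ f∉ ¬Tf , swap-spanning span′ f∈ e∉ ¬Se
      where
      e∉ : e ∉ T′
      e∉ e∈′ = ¬Se (edge-joined (∈-del⁺ e∈′ (∈∉⇒≢ e∈ f∉)))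

-- Feasible query sets

wsum-del : ∀ {k} (w : Fin k → ℚ) (S : Subset k) {e} → e ∈ S → wsum w S ≡ w e ℚ.+ wsum w (del S e)
wsum-del w (true ∷ S) here = cong (w zero ℚ.+_) (sym (ℚₚ.+-identityˡ _))
wsum-del w (b ∷ S) (there {i = i} e∈) =
  trans (cong ((if b then w zero else 0ℚ) ℚ.+_) (wsum-del (w ∘ suc) S e∈)) (x∙yz≈y∙xz (if b then w zero else 0ℚ) (w (suc i)) _)

wsum-add : ∀ {k} (w : Fin k → ℚ) (S : Subset k) {e} → e ∉ S → wsum w (add S e) ≡ w e ℚ.+ wsum w S
wsum-add w (true ∷ S) {zero} e∉ = contradiction here e∉
wsum-add w (false ∷ S) {zero} e∉ = cong (w zero ℚ.+_) (sym (ℚₚ.+-identityˡ _))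
wsum-add w (b ∷ S) {suc e} e∉ =
  trans (cong ((if b then w zero else 0ℚ) ℚ.+_) (wsum-add (w ∘ suc) S (e∉ ∘ there))) (x∙yz≈y∙xz (if b then w zero else 0ℚ) (w (suc e)) _)

above : ∀ I {t} → t ℚ.< hi I → ∃ λ v → v ∈ᴵ I × t ℚ.< v
above (point v) t<v = v , refl , t<v
above (open′ l u l<u) {t} t<u with l ℚₚ.<? t
... | yes l<t = let v , t<v , v<u = ℚₚ.<-dense t<u in v , (ℚₚ.<-trans l<t t<v , v<u) , t<v
... | no l≮t = let v , l<v , v<u = ℚₚ.<-dense l<u in v , (l<v , v<u) , ℚₚ.≤-<-trans (ℚₚ.≮⇒≥ l≮t) l<v

below : ∀ I {t} → lo I ℚ.< t → ∃ λ v → v ∈ᴵ I × v ℚ.< t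
below (point v) v<t = v , refl , v<t
below (open′ l u l<u) {t} l<t with t ℚₚ.<? u
... | yes t<u = let v , l<v , v<t = ℚₚ.<-dense l<t in v , (l<v , ℚₚ.<-trans v<t t<u) , v<t
... | no t≮u = let v , l<v , v<u = ℚₚ.<-dense l<u in v , (l<v , v<u) , ℚₚ.<-≤-trans v<u (ℚₚ.≮⇒≥ t≮u)

_∈ᴵ?_ : ∀ v I → Dec (v ∈ᴵ I)
v ∈ᴵ? point a = v ℚₚ.≟ a
v ∈ᴵ? open′ l u _ = (l ℚₚ.<? v) ×-dec (v ℚₚ.<? u)

wellFormed? : ∀ P → Dec (WellFormedIntervals P)
wellFormed? P = all? λ e → ((triv P e 𝔹.≟ true) →-dec (L P e ℚₚ.≟ U P e))
                           ×-dec ((triv P e 𝔹.≟ false) →-dec (L P e ℚₚ.<? U P e))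

module Interface (P : Instance) (wf : WellFormedIntervals P) where
  open Graph P
  open Matroid (SpanningTree P) spanning? exchange

  interval : State (m P)
  interval e with triv P e | proj₂ (wf e)
  ... | true  | _   = point (L P e)
  ... | false | L<U = open′ (L P e) (U P e) (L<U refl)

  InI⇒∈ : ∀ e {v} → InI P e v → v ∈ᴵ interval e
  InI⇒∈ e v∈ with triv P e | proj₂ (wf e)
  ... | true  | _ = v∈
  ... | false | _ = v∈

  ∈⇒InI : ∀ e {v} → v ∈ᴵ interval e → InI P e v
  ∈⇒InI e v∈ with triv P e | proj₂ (wf e)
  ... | true  | _ = v∈
  ... | false | _ = v∈

  module _ {w : Fin (m P) → ℚ} (w∈ : w ∈ˢ interval) where

    Compatible : Subset (m P) → (Fin (m P) → ℚ) → Set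
    Compatible Q w′ = (∀ e → e ∈ Q → w′ e ≡ w e) × (∀ e → e ∉ Q → InI P e (w′ e))

    compatible⇒∈ : ∀ {Q w′} → Compatible Q w′ → w′ ∈ˢ reveal interval Q w
    compatible⇒∈ {Q} {w′} (on , off) e with e ∈? Q
    ... | yes e∈ = subst (w′ e ∈ᴵ_) (sym (reveal-∈ interval {w = w} e∈)) (on e e∈)
    ... | no e∉ = subst (w′ e ∈ᴵ_) (sym (reveal-∉ interval {w = w} e∉)) (InI⇒∈ e (off e e∉))

    ∈⇒compatible : ∀ {Q w′} → w′ ∈ˢ reveal interval Q w → Compatible Q w′
    ∈⇒compatible {Q} {w′} w′∈ = (λ e e∈ → subst (w′ e ∈ᴵ_) (reveal-∈ interval {w = w} e∈) (w′∈ e))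
                              , (λ e e∉ → ∈⇒InI e (subst (w′ e ∈ᴵ_) (reveal-∉ interval {w = w} e∉) (w′∈ e)))

  wsum-swap : ∀ (w : Fin (m P) → ℚ) T {e f} → e ∈ T → f ∉ T → w e ℚ.+ wsum w (swap T e f) ≡ w f ℚ.+ wsum w T
  wsum-swap w T {e} {f} e∈ f∉ = begin
    w e ℚ.+ wsum w (swap T e f)           ≡⟨ cong (w e ℚ.+_) (wsum-add w (del T e) (f∉ ∘ proj₁ ∘ ∈-del⁻)) ⟩
    w e ℚ.+ (w f ℚ.+ wsum w (del T e))    ≡⟨ x∙yz≈y∙xz (w e) (w f) _ ⟩
    w f ℚ.+ (w e ℚ.+ wsum w (del T e))    ≡⟨ cong (w f ℚ.+_) (sym (wsum-del w T e∈)) ⟩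
    w f ℚ.+ wsum w T                      ∎
    where open ≡-Reasoning

  swap-cheaper : ∀ (w : Fin (m P) → ℚ) T {e f} → e ∈ T → f ∉ T → w f ℚ.≤ w e → wsum w (swap T e f) ℚ.≤ wsum w T
  swap-cheaper w T {e} {f} e∈ f∉ le = ℚₚ.≮⇒≥ λ lt → ℚₚ.<-irrefl (sym (wsum-swap w T e∈ f∉)) (ℚₚ.+-mono-≤-< le lt)

  cheaper-swap : ∀ (w : Fin (m P) → ℚ) T {e f} → e ∈ T → f ∉ T → wsum w T ℚ.≤ wsum w (swap T e f) → w e ℚ.≤ w f
  cheaper-swap w T {e} {f} e∈ f∉ le = ℚₚ.≮⇒≥ λ lt → ℚₚ.<-irrefl (sym (wsum-swap w T e∈ f∉)) (ℚₚ.+-mono-<-≤ lt le)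

  -- By symmetric exchange every spanning tree is moved towards T without getting heavier.
  locally-optimal⇒MST : ∀ {w T} → SpanningTree P T → (∀ e f → Pair T e f → w e ℚ.≤ w f) → IsMST P w T
  locally-optimal⇒MST {w} {T} span opt = span , λ T′ span′ → go T′ span′ (<-wellFounded _)
    where
    outside-T : Fin (m P) → ℕ
    outside-T i = if lookup T i then 0 else 1
    go : ∀ T′ → SpanningTree P T′ → Acc _<_ (weight outside-T T′) → wsum w T ℚ.≤ wsum w T′
    go T′ span′ (acc rs) with any? (λ f → (f ∈? T′) ×-dec ¬? (f ∈? T))
    ... | no none = ℚₚ.≤-reflexive (cong (wsum w) (⊆-antisym T⊆ ⊆T))
      where
      ⊆T : ∀ {x} → x ∈ T′ → x ∈ T
      ⊆T {x} x∈ with x ∈? T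
      ... | yes x∈T = x∈T
      ... | no x∉T = contradiction (x , x∈ , x∉T) none
      T⊆ : ∀ {x} → x ∈ T → x ∈ T′
      T⊆ {x} x∈ with x ∈? T′
      ... | yes x∈T′ = x∈T′
      ... | no x∉T′ with exchange span′ span x∈ x∉T′
      ...   | g , g∈T′ , g∉T , _ = contradiction (⊆T g∈T′) g∉T
    ... | yes (f , f∈T′ , f∉T) with exchange span span′ f∈T′ f∉T
    ...   | e , e∈T , e∉T′ , span₁ , span₂ =
      ℚₚ.≤-trans (go (swap T′ f e) span₂ (rs closer)) (swap-cheaper w T′ f∈T′ e∉T′ (opt e f (pair e∈T f∉T span₁)))
      where
      open ℕₚ.≤-Reasoning
      closer : weight outside-T (swap T′ f e) < weight outside-T T′
      closer = begin-strict
        weight outside-T (swap T′ f e)               ≡⟨ weight-add outside-T (del T′ f) (e∉T′ ∘ proj₁ ∘ ∈-del⁻) ⟩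
        weight outside-T (del T′ f) + outside-T e    ≡⟨ cong (λ b → weight outside-T (del T′ f) + (if b then 0 else 1)) ([]=⇒lookup e∈T) ⟩
        weight outside-T (del T′ f) + 0              <⟨ ℕₚ.+-monoʳ-< _ (s≤s z≤n) ⟩
        weight outside-T (del T′ f) + 1              ≡⟨ cong (λ b → weight outside-T (del T′ f) + (if b then 0 else 1)) (sym (∉⇒lookup f∉T)) ⟩
        weight outside-T (del T′ f) + outside-T f    ≡⟨ weight-del outside-T T′ f∈T′ ⟩
        weight outside-T T′                          ∎

  module _ {w : Fin (m P) → ℚ} {Q : Subset (m P)} (w∈ : w ∈ˢ interval) where

    Feas⇒Feasible : Feas interval w Q → Feasible P w Q
    Feas⇒Feasible (T , (span , opt)) = T , span , λ w′ on off → locally-optimal⇒MST span λ e f p →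
      let w′∈ = compatible⇒∈ w∈ {Q} (on , off) in
      ℚₚ.≤-trans (≤hi (reveal interval Q w e) (w′∈ e)) (ℚₚ.≤-trans (opt e f p) (lo≤ (reveal interval Q w f) (w′∈ f)))

    -- If the lower limit of `f` were below the upper limit of `e`, admissible values could make `e`
    -- dearer than `f` with all other weights kept, and the swap would beat `T`.
    Feasible⇒Feas : Feasible P w Q → Feas interval w Q
    Feasible⇒Feas (T , span , mst) = T , (span , λ e f p → ℚₚ.≮⇒≥ λ lt → violated e f p lt)
      where
      ρ = reveal interval Q w
      violated : ∀ e f → Pair T e f → ¬ (lo (ρ f) ℚ.< hi (ρ e))
      violated e f p lt with above (ρ e) lt
      ... | a , a∈ , lo<a with below (ρ f) lo<a
      ...   | b , b∈ , b<a = <⇒≱ b<a (subst₂ ℚ._≤_ at-e at-f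
                (cheaper-swap w′ T (e∈ p) (f∉ p) (proj₂ (mst w′ (proj₁ compat) (proj₂ compat)) _ (base p))))
        where
        w′ : Fin (m P) → ℚ
        w′ i = if does (i ≟ e) then a else if does (i ≟ f) then b else w i
        at-e : w′ e ≡ a
        at-e with e ≟ e
        ... | yes _ = refl
        ... | no ne = contradiction refl ne
        at-f : w′ f ≡ b
        at-f with f ≟ e | f ≟ f
        ... | yes f≡e | _ = contradiction (sym f≡e) (∈∉⇒≢ (e∈ p) (f∉ p))
        ... | no _ | yes _ = refl
        ... | no _ | no ne = contradiction refl ne
        w∈ρ : ∀ i → w i ∈ᴵ ρ i
        w∈ρ = compatible⇒∈ w∈ {Q} ((λ _ _ → refl) , λ i _ → ∈⇒InI i (w∈ i))
        w′∈ : w′ ∈ˢ ρ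
        w′∈ i = cases (i ≟ e) (i ≟ f)
          where
          cases : (d : Dec (i ≡ e)) (d′ : Dec (i ≡ f)) → (if does d then a else if does d′ then b else w i) ∈ᴵ ρ i
          cases (yes refl) _ = a∈
          cases (no _) (yes refl) = b∈
          cases (no _) (no _) = w∈ρ i
        compat = ∈⇒compatible w∈ {Q} w′∈

    feasible? : Dec (Feasible P w Q)
    feasible? = map′ (λ (T , opt) → Feas⇒Feasible (T , opt)) (λ feas → let (T , opt) = Feasible⇒Feas feas in T , opt)
      (anySubset? λ T → spanning? T ×-dec all? λ e → all? λ f → optimal? T e f)
      where
      optimal? : ∀ T e f → Dec (Pair T e f → hi (reveal interval Q w e) ℚ.≤ lo (reveal interval Q w f))
      optimal? T e f = pair? T e f →-dec (hi (reveal interval Q w e) ℚₚ.≤? lo (reveal interval Q w f))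

-- The algorithm

sum-indicator : ∀ {k} (Q : Subset k) → sum [ Q ∈?]ℕ ≡ ∣ Q ∣
sum-indicator [] = refl
sum-indicator (true ∷ Q) = cong suc (sum-indicator Q)
sum-indicator (false ∷ Q) = sum-indicator Q

total-indicator≤ : ∀ {k} (σ : State k) (Q : Subset k) → total σ [ Q ∈?]ℕ ≤ ∣ Q ∣
total-indicator≤ σ Q = ℕₚ.≤-trans (sum-mono _ _ pointwise) (ℕₚ.≤-reflexive (sum-indicator Q))
  where
  pointwise : ∀ e → (if nontrivial (σ e) then [ Q ∈?]ℕ e else 0) ≤ [ Q ∈?]ℕ e
  pointwise e with nontrivial (σ e)
  ... | true = ℕₚ.≤-refl
  ... | false = z≤n

total-0 : ∀ {k} (σ : State k) → total σ (λ _ → 0) ≡ 0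
total-0 σ = sym (total-* {σ = σ} 0 (λ _ → 0))

∣toSubset∣≤ : ∀ {k} (xs : List (Fin k)) → ∣ toSubset xs ∣ ≤ length xs
∣toSubset∣≤ {k} [] = ℕₚ.≤-reflexive (∣⊥∣≡0 k)
∣toSubset∣≤ (x ∷ xs) = ℕₚ.≤-trans (p⊆q⇒∣p∣≤∣q∣ ⊆add) (ℕₚ.≤-trans (∣add∣≤ (toSubset xs) x) (s≤s (∣toSubset∣≤ xs)))
  where
  ⊆add : ⁅ x ⁆ ∪ toSubset xs ⊆ add (toSubset xs) x
  ⊆add e∈ = [ (λ { refl → ∈-add }) , ∈-add⁺ ]′ (∈∪⁻ e∈)

-- From decision trees to adaptive algorithms

path-cong : ∀ {k} (t : Tree k) {w w′ : Fin k → ℚ} → (∀ e → w e ≡ w′ e) → path t w ≡ path t w′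
path-cong done eq = refl
path-cong (ask e t) {w} {w′} eq = cong (e ∷_) (trans (cong (λ v → path (t v) w) (eq e)) (path-cong (t (w′ e)) eq))

follow : ∀ {k} → Tree k → List (Fin k × ℚ) → Maybe (Fin k)
follow done _ = nothing
follow (ask e t) [] = just e
follow (ask e t) ((_ , v) ∷ h) = follow (t v) h

least : {R : ℕ → Set} → (∀ k → Dec (R k)) → ∀ N → R N → ∃ λ k → R k × (∀ j → j < k → ¬ R j)
least R? zero r = 0 , r , λ _ ()
least R? (suc N) r with R? 0
... | yes r₀ = 0 , r₀ , λ _ ()
... | no ¬r₀ with least (R? ∘ suc) N r
...   | k , rk , min = suc k , rk , λ { zero _ → ¬r₀ ; (suc j) (s≤s j<k) → min j j<k }

observe : ∀ {k} → (Fin k → ℚ) → Fin k → Fin k × ℚ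
observe w e = e , w e

follow-take : ∀ {k} (t : Tree k) (w : Fin k → ℚ) i →
  let h = map (observe w) (take i (path t w)) ; h′ = map (observe w) (take (suc i) (path t w)) in
  (follow t h ≡ nothing × h′ ≡ h) ⊎ ∃ λ e → follow t h ≡ just e × h′ ≡ h ++ [ (e , w e) ]
follow-take done w zero = inj₁ (refl , refl)
follow-take done w (suc i) = inj₁ (refl , refl)
follow-take (ask e t) w zero = inj₂ (e , refl , refl)
follow-take (ask e t) w (suc i) with follow-take (t (w e)) w i
... | inj₁ (eq , eq′) = inj₁ (eq , cong ((e , w e) ∷_) eq′)
... | inj₂ (e′ , eq , eq′) = inj₂ (e′ , eq , cong ((e , w e) ∷_) eq′)

history-step : ∀ A P w k {r} → A P (history A P w k) ≡ r →
  history A P w (suc k) ≡ history A P w k ++ (case r of λ { nothing → [] ; (just e) → [ (e , w e) ] })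
history-step A P w k refl with A P (history A P w k)
... | nothing = sym (++-identityʳ _)
... | just e = refl

module _ (A : Algorithm) (P : Instance) (w : Fin (m P) → ℚ) (t : Tree (m P)) (A≗ : ∀ h → A P h ≡ follow t h) where

  history-path : ∀ k → history A P w k ≡ map (observe w) (take k (path t w))
  history-path zero = refl
  history-path (suc k) with follow-take t w k
  ... | inj₁ (eq , eq′) = trans (history-step A P w k (trans (A≗ _) (trans (cong (follow t) (history-path k)) eq)))
          (trans (++-identityʳ _) (trans (history-path k) (sym eq′)))
  ... | inj₂ (e , eq , eq′) = trans (history-step A P w k (trans (A≗ _) (trans (cong (follow t) (history-path k)) eq)))
          (trans (cong (_++ [ (e , w e) ]) (history-path k)) (sym eq′))

  queried-path : ∀ k → queriedSet P (history A P w k) ≡ toSubset (take k (path t w))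
  queried-path k = trans (cong (queriedSet P) (history-path k)) (queried (take k (path t w)))
    where
    queried : ∀ xs → queriedSet P (map (observe w) xs) ≡ toSubset xs
    queried [] = refl
    queried (x ∷ xs) = cong (⁅ x ⁆ ∪_) (queried xs)

  -- Deciding feasibility locates the first feasible prefix of the path, which queries no more than
  -- the whole path does.
  first-feasible : (∀ Q → Dec (Feasible P w Q)) → Feasible P w (toSubset (path t w)) → ∀ {num den b} →
    den * length (path t w) ≤ num * b →
    ∃ λ k → Feasible P w (queriedSet P (history A P w k))
          × (∀ j → j < k → ¬ Feasible P w (queriedSet P (history A P w j)))
          × (den * ∣ queriedSet P (history A P w k) ∣ ≤ num * b)
  first-feasible dec feas {num} {den} {b} bound
    with least (λ k → dec (queriedSet P (history A P w k))) (length (path t w))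
               (subst (Feasible P w) (sym (trans (queried-path (length (path t w))) (cong toSubset (take-all _ (path t w) ℕₚ.≤-refl)))) feas)
  ... | k , fk , min = k , fk , min , ℕₚ.≤-trans (ℕₚ.*-monoʳ-≤ den (begin
    ∣ queriedSet P (history A P w k) ∣    ≡⟨ cong ∣_∣ (queried-path k) ⟩
    ∣ toSubset (take k (path t w)) ∣      ≤⟨ ∣toSubset∣≤ (take k (path t w)) ⟩
    length (take k (path t w))            ≡⟨ length-take k (path t w) ⟩
    k ℕ.⊓ length (path t w)               ≤⟨ ℕₚ.m⊓n≤n k _ ⟩
    length (path t w)                     ∎)) bound
    where open ℕₚ.≤-Reasoning

module _ (γ : ℕ) (2≤γ : 2 ≤ γ) where

  module Solve (P : Instance) (wf : WellFormedIntervals P) (T₀ : Subset (m P)) (T₀∈ : SpanningTree P T₀)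
               (ŵ∈ : pred P ∈ˢ Interface.interval P wf) where
    open Interface P wf public
    open Graph P
    open Matroid (SpanningTree P) spanning? exchange
    open Strategies T₀ T₀∈ γ 2≤γ
    open Planning (pred P)
    open Strategy

    planned : Planned interval (λ _ → 0)
    planned = plan _ interval (λ _ → 0) ℕₚ.≤-refl ŵ∈ (λ _ → ℕₚ.≤-trans (s≤s z≤n) 2≤γ)

    strategy = proj₂ (proj₂ planned)

    queryTree : Tree (m P)
    queryTree = tree strategy

    module _ {w : Fin (m P) → ℚ} (w∈ : w ∈ˢ interval) where

      finds : Feasible P w (toSubset (path queryTree w))
      finds = Feas⇒Feasible w∈ (solves strategy w w∈)

      module _ {Q : Subset (m P)} (feas : Feasible P w Q) where

        robust-bound : length (path queryTree w) ≤ γ * ∣ Q ∣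
        robust-bound = begin
          length (path queryTree w)                    ≤⟨ ℕₚ.m≤m+n _ _ ⟩
          length (path queryTree w) + total interval (λ _ → 0)
            ≤⟨ robust strategy w Q [ Q ∈?]ℕ w∈ (Feasible⇒Feas w∈ feas)
                 record { own = λ _ _ → ℕₚ.≤-refl ; paid = λ _ _ () ; trust = λ _ _ _ _ → ℕₚ.≤-refl } ⟩
          γ * total interval [ Q ∈?]ℕ                  ≤⟨ ℕₚ.*-monoʳ-≤ γ (total-indicator≤ interval Q) ⟩
          γ * ∣ Q ∣                                    ∎
          where open ℕₚ.≤-Reasoning

        consistent-bound : (∀ e → pred P e ≡ w e) → γ * length (path queryTree w) ≤ suc γ * ∣ Q ∣
        consistent-bound correct = begin
          γ * length (path queryTree w)                ≡⟨ cong (λ p → γ * length p) (sym (path-cong queryTree correct)) ⟩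
          γ * length (path queryTree (pred P))         ≤⟨ consistent strategy ŵ∈ ⟩
          suc γ * N + total interval (λ _ → 0)         ≡⟨ cong (suc γ * N +_) (total-0 interval) ⟩
          suc γ * N + 0                                ≡⟨ ℕₚ.+-identityʳ _ ⟩
          suc γ * N                                    ≤⟨ ℕₚ.*-monoʳ-≤ (suc γ) (ℕₚ.≤-trans (proj₁ (proj₂ planned) Q feas′) (total-indicator≤ interval Q)) ⟩
          suc γ * ∣ Q ∣                                ∎
          where
          open ℕₚ.≤-Reasoning
          N = proj₁ planned
          feas′ : Feas interval (pred P) Q
          feas′ = let (T , opt) = Feasible⇒Feas w∈ feas in
            T , Optimal-≗ {reveal interval Q w} (λ e → cong (λ v → if lookup Q e then point v else interval e) (sym (correct e))) opt

  -- The decisions are arguments so that `competitive` can match on them. Input that fails one of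
  -- them gets the tree `done`.
  strategyTree : (P : Instance) → Dec (WellFormedIntervals P) → Dec (∃ (SpanningTree P)) →
                 (∀ wf → Dec (∀ e → pred P e ∈ᴵ Interface.interval P wf e)) → Tree (m P)
  strategyTree P (yes wf) (yes (T₀ , T₀∈)) ŵ? with ŵ? wf
  ... | yes ŵ∈ = Solve.queryTree P wf T₀ T₀∈ ŵ∈
  ... | no _ = done
  strategyTree P _ _ _ = done

  treeFor : (P : Instance) → Tree (m P)
  treeFor P = strategyTree P (wellFormed? P) (anySubset? (Graph.spanning? P))
                (λ wf → all? λ e → pred P e ∈ᴵ? Interface.interval P wf e)

  algorithm : Algorithm
  algorithm P = follow (treeFor P)

  record Competitive (P : Instance) (w : Fin (m P) → ℚ) (t : Tree (m P)) : Set where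
    field
      decidable  : ∀ Q → Dec (Feasible P w Q)
      finds      : Feasible P w (toSubset (path t w))
      robust     : ∀ Q → Feasible P w Q → length (path t w) ≤ γ * ∣ Q ∣
      consistent : ∀ Q → Feasible P w Q → (∀ e → pred P e ≡ w e) → γ * length (path t w) ≤ suc γ * ∣ Q ∣

  competitive : ∀ P w → Valid P w → ∀ {Q} → Feasible P w Q → Competitive P w (treeFor P)
  competitive P w (wf′ , _ , _ , pred∈ , _ , w∈′) (T , span , _) =
    go (wellFormed? P) (anySubset? (Graph.spanning? P)) (λ wf → all? λ e → pred P e ∈ᴵ? Interface.interval P wf e)
    where
    go : ∀ wf? span? ŵ? → Competitive P w (strategyTree P wf? span? ŵ?)
    go (no ¬wf) _ _ = contradiction wf′ ¬wf
    -- Every feasible query set comes with a spanning tree.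
    go (yes _) (no none) _ = contradiction (T , span) none
    go (yes wf) (yes (T₀ , T₀∈)) ŵ? with ŵ? wf
    ... | no ¬ŵ∈ = contradiction (λ e → Interface.InI⇒∈ P wf e (pred∈ e)) ¬ŵ∈
    ... | yes ŵ∈ = record
      { decidable = λ Q → feasible? w∈ ; finds = finds w∈
      ; robust = λ Q → robust-bound w∈ ; consistent = λ Q → consistent-bound w∈ }
      where
      open Solve P wf T₀ T₀∈ ŵ∈
      w∈ : w ∈ˢ interval
      w∈ e = InI⇒∈ e (w∈′ e)

theorem4p2 : (γ : ℕ) → 2 ≤ γ →
    Σ Algorithm λ A →
    (∀ (P : Instance) (w : Fin (m P) → ℚ) → Valid P w → (∀ e → pred P e ≡ w e) →
    CompetitiveOn A P w (suc γ) γ)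
    × (∀ (P : Instance) (w : Fin (m P) → ℚ) → Valid P w → CompetitiveOn A P w γ 1)
theorem4p2 γ 2≤γ = algorithm γ 2≤γ ,
  (λ P w valid correct OPT (feas , _) → let open Competitive (competitive γ 2≤γ P w valid feas) in
    first-feasible (algorithm γ 2≤γ) P w (treeFor γ 2≤γ P) (λ _ → refl) decidable finds {suc γ} {γ} {∣ OPT ∣} (consistent OPT feas correct)) ,
  (λ P w valid OPT (feas , _) → let open Competitive (competitive γ 2≤γ P w valid feas) in
    first-feasible (algorithm γ 2≤γ) P w (treeFor γ 2≤γ P) (λ _ → refl) decidable finds {γ} {1} {∣ OPT ∣}
      (ℕₚ.≤-trans (ℕₚ.≤-reflexive (ℕₚ.+-identityʳ _)) (robust OPT feas)))
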